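{- Let $k,n$ be positive integers. Then the following hold. (i) Suppose $k\leq n$. If $n=5$ then $\mathrm{Smo}(C_{k;n})=3$ and $\widehat{\mathrm{Smo}}(C_{k;n})=1$; otherwise $$\mathrm{Smo}(C_{k;n})-1=\widehat{\mathrm{Smo}}(C_{k;n})=\begin{cases}\lfloor\frac n2\rfloor, & \text{if } n\leq 4 \text{ or } n=7;\\ \lfloor\frac n2\rfloor+1, & \text{if } n=6 \text{ or } n\geq 8.\end{cases}$$ (ii) Suppose $k>n$. Then $\mathrm{Smo}(C_{k;n})\leq\widehat{\mathrm{Smo}}(C_{k;n})+1$. Moreover, $$\begin{cases}\frac{\lceil k/n\rceil n}{2}+1\leq\widehat{\mathrm{Smo}}(C_{k;n})\leq\left\lceil\frac{(\lceil k/n\rceil+1)n}{2}\right\rceil-1, & \text{if } n\geq3 \text{ and } \lceil k/n\rceil n\equiv0\pmod2;\\[4pt] \widehat{\mathrm{Smo}}(C_{k;n})=\left\lfloor\frac{(\lceil k/n\rceil+1)n}{2}\right\rfloor, & \text{otherwise,}\end{cases}$$ and $$\begin{cases}\frac{\lceil k/n\rceil n}{2}+1\leq\mathrm{Smo}(C_{k;n})\leq\left\lceil\frac{(\lceil k/n\rceil+1)n}{2}\right\rceil, & \text{if } n\geq3 \text{ and } \lceil k/n\rceil n\equiv0\pmod2;\\[4pt] \mathrm{Smo}(C_{k;n})=\left\lfloor\frac{(\lceil k/n\rceil+1)n}{2}\right\rfloor, & \text{if } n=2;\\[4pt] \mathrm{Smo}(C_{k;n})=\left\lfloor\frac{(\lceil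 k/n\rceil+1)n}{2}\right\rfloor+1, & \text{otherwise.}\end{cases}$$
   Context: Cyclic semigroups. $C_{k;n}=\langle s\rangle$ denotes the finite cyclic semigroup (written additively) with generator $s$, index $k$ and period $n$: $k$ is the least positive integer such that $ks=ts$ for some positive integer $t\neq k$, and $n$ is the least positive integer with $(k+n)s=ks$. So $C_{k;n}=\{s,2s,\ldots,(k+n-1)s\}$ has $k+n-1$ elements; for $k=1$ it is the cyclic group of order $n$. The generator $s$ is fixed, and for $a\in C_{k;n}$, $\mathrm{ind}(a)$ is the least positive integer $t$ with $ts=a$. An element $e$ is idempotent if $e+e=e$. Sequences. For a set $\mathcal{S}$, $\mathcal{F}(\mathcal{S})$ is the set of finite unordered sequences (multisets) of terms from $\mathcal{S}$, repetition allowed; $|T|$ is the number of terms of $T$ counted with multiplicity. For a commutative semigroup $\mathcal{S}$ and $T\in\mathcal{F}(\mathcal{S})$, $\Sigma(T)$ is the set of all sums of nonempty subsequences of $T$. $\mathop{\bullet}_{a\mid T} f(a)$ denotes the sequence obtained from $T$ by applying $f$ to each term (with multiplicity). $T$ is idempotent-sum free if no nonempty subsequence of $T$ has an idempotent as its sum. $T$ is a minimal idempotent-sum sequence if $T$ is nonempty, the sum of all its terms is an idempotent, and no nonempty proper subsequence of $T$ has an idempotent as its sum. Smooth sequences. Let $G$ be an abelian group and $g\in G$. Let $T\in\mathcal{F}(G)$ be a nonempty sequence of the form $T=(n_1g)\cdot\ldots\cdot(n_\ell g)$ with integers $1=n_1\leq\cdots\leq n_\ell$, $N=n_1+\cdots+n_\ell\leq\mathrm{ord}(g)$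 and $\Sigma(T)=\{g,2g,\ldots,Ng\}$. If $N<\mathrm{ord}(g)$, $T$ is called $g$-smooth; if $N=\mathrm{ord}(g)$, $T$ is called zero-sum $g$-smooth. In particular (taking $G=\mathbb{Z}$, $g=1$, of infinite order), a nonempty sequence $T$ of positive integers is $1$-smooth if and only if $\Sigma(T)=[1,\sum_{a\mid T}a]$, where $[a,b]$ denotes an interval of integers. The invariants. For $\max(k,n)>1$, $\mathrm{Smo}(C_{k;n})$ [resp. $\widehat{\mathrm{Smo}}(C_{k;n})$] is the least positive integer $\ell$ such that every minimal idempotent-sum [resp. idempotent-sum free] sequence $T\in\mathcal{F}(C_{k;n})$ of length at least $\ell$ satisfies: if $k>n$, the sequence $\mathop{\bullet}_{a\mid T}\mathrm{ind}(a)\in\mathcal{F}(\mathbb{Z})$ is $1$-smooth; if $k\leq n$, the sequence $\mathop{\bullet}_{a\mid T}(\mathrm{ind}(a)+n\mathbb{Z})\in\mathcal{F}(\mathbb{Z}/n\mathbb{Z})$ is zero-sum $g$-smooth [resp. $g$-smooth] for some $g\in\mathbb{Z}/n\mathbb{Z}$ with $\mathrm{ord}(g)=n$. By convention $\mathrm{Smo}(C_{1;1})=1$ and $\widehat{\mathrm{Smo}}(C_{1;1})=0$. -}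

module Defs where

open import Level using (Level; _⊔_)
open import Algebra.Bundles using (CommutativeSemigroup; AbelianGroup)
import Algebra.Definitions
import Algebra.Definitions.RawMonoid
open import Data.Nat.Base as ℕ using (ℕ; _≤_; _<_; NonZero; pred)
open import Data.Nat.DivMod using (_/_)
open import Data.Nat.ListAction using (sum)
open import Data.Integer.Base as ℤ using (ℤ; +_; 0ℤ; 1ℤ)
import Data.Integer.Properties as ℤ
open import Data.Integer.Divisibility.Signed using (_∣_; divides; ∣m∣n⇒∣m+n; ∣m⇒∣-m)
open import Data.Integer.Tactic.RingSolver using (solve-∀)
open import Data.List.Base using (List; _∷_; map; length; replicate)
open import Data.List.NonEmpty.Base using (List⁺; _∷_; toList; foldr₁)
open import Data.List.Relation.Unary.Linked using (Linked)
open import Data.List.Relation.Binary.Pointwise using (Pointwise)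
open import Data.List.Relation.Binary.Sublist.Propositional using (_⊆_)
import Data.List.Relation.Binary.Permutation.Setoid as Permutation
open import Data.Product.Base using (_×_; _,_; ∃; ∃-syntax)
open import Function.Bundles using (_⇔_)
open import Relation.Binary.PropositionalEquality using (_≡_; _≢_; refl; sym; subst)
open import Relation.Nullary.Negation using (¬_)

private
  variable
    c ℓ p : Level

⌈_/_⌉ : (k n : ℕ) .{{_ : NonZero n}} → ℕ
⌈ k / n ⌉ = (k ℕ.+ pred n) / n

LeastPositive : (ℕ → Set p) → ℕ → Set p
LeastPositive P m = 1 ≤ m × P m × (∀ j → 1 ≤ j → P j → m ≤ j)

-- An unordered sequence is represented by a list of its terms.  Everything
-- below is invariant under permuting that list, and the subsequences of an
-- unordered sequence are, up to permutation, the sublists of such a list.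
module Sequences (S : CommutativeSemigroup c ℓ) where

  open CommutativeSemigroup S
  open Algebra.Definitions _≈_ using (_IdempotentOn_)

  infixr 8 _·_

  -- The sum of t copies of x for t ≥ 1; the value at t = 0 is a dummy.
  _·_ : ℕ → Carrier → Carrier
  t · x = foldr₁ _∙_ (x ∷ replicate (pred t) x)

  σ : List⁺ Carrier → Carrier
  σ = foldr₁ _∙_

  _∈Σ_ : Carrier → List Carrier → Set (c ⊔ ℓ)
  x ∈Σ T = ∃[ U ] toList U ⊆ T × σ U ≈ x

  IdempotentSum : List⁺ Carrier → Set ℓ
  IdempotentSum U = _∙_ IdempotentOn σ U

  IdempotentSumFree : List Carrier → Set (c ⊔ ℓ)
  IdempotentSumFree T = ∀ U → toList U ⊆ T → ¬ IdempotentSum U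

  MinimalIdempotentSum : List Carrier → Set (c ⊔ ℓ)
  MinimalIdempotentSum T =
    (∃[ V ] toList V ≡ T × IdempotentSum V) ×
    (∀ U → toList U ⊆ T → length (toList U) < length T → ¬ IdempotentSum U)

module Smoothness (G : AbelianGroup c ℓ) where

  open AbelianGroup G
  open Algebra.Definitions.RawMonoid rawMonoid using () renaming (_×_ to _·_)
  open Permutation setoid using (_↭_)
  open Sequences commutativeSemigroup using (_∈Σ_)

  -- Comparisons with ord(g), the least m ≥ 1 with mg = 0 if there is one and
  -- ∞ otherwise.
  _≤ord_ _<ord_ _≡ord_ : ℕ → Carrier → Set ℓ
  N ≤ord g = ∀ m → 1 ≤ m → m · g ≈ ε → N ≤ m
  N <ord g = ∀ m → 1 ≤ m → m · g ≈ ε → N < m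
  N ≡ord g = LeastPositive (λ m → m · g ≈ ε) N

  SmoothOfSum : Carrier → List Carrier → ℕ → Set (c ⊔ ℓ)
  SmoothOfSum g T N = ∃[ ns ]
    Linked _≤_ (1 ∷ ns) ×
    map (_· g) (1 ∷ ns) ↭ T ×
    N ≡ sum (1 ∷ ns) ×
    N ≤ord g ×
    (∀ x → x ∈Σ T ⇔ (∃[ j ] 1 ≤ j × j ≤ N × x ≈ j · g))

  Smooth ZeroSumSmooth : Carrier → List Carrier → Set (c ⊔ ℓ)
  Smooth        g T = ∃[ N ] SmoothOfSum g T N × N <ord g
  ZeroSumSmooth g T = ∃[ N ] SmoothOfSum g T N × N ≡ord g

-- ℤ/nℤ as the setoid of integers up to congruence, so that the coset a + nℤ
-- is represented by a itself.
module _ (n : ℕ) where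

  infix 4 _≡ₙ_

  -- A record rather than a plain abbreviation, so that a and b can be
  -- inferred from a ≡ₙ b.
  record _≡ₙ_ (a b : ℤ) : Set where
    constructor congruent
    field n∣a-b : + n ∣ a ℤ.- b

  private
    reflexive : ∀ {a b} → a ≡ b → a ≡ₙ b
    reflexive {a} refl = congruent (divides 0ℤ (ℤ.+-inverseʳ a))

    symmetric : ∀ {a b} → a ≡ₙ b → b ≡ₙ a
    symmetric {a} {b} (congruent d) = congruent (subst (+ n ∣_) (eq a b) (∣m⇒∣-m d))
      where
      eq : ∀ a b → ℤ.- (a ℤ.- b) ≡ b ℤ.- a
      eq = solve-∀

    transitive : ∀ {a b c} → a ≡ₙ b → b ≡ₙ c → a ≡ₙ c
    transitive {a} {b} {c} (congruent d) (congruent e) =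
      congruent (subst (+ n ∣_) (eq a b c) (∣m∣n⇒∣m+n d e))
      where
      eq : ∀ a b c → (a ℤ.- b) ℤ.+ (b ℤ.- c) ≡ a ℤ.- c
      eq = solve-∀

    +-congruent : ∀ {a b c d} → a ≡ₙ b → c ≡ₙ d → (a ℤ.+ c) ≡ₙ (b ℤ.+ d)
    +-congruent {a} {b} {c} {d} (congruent x) (congruent y) =
      congruent (subst (+ n ∣_) (eq a b c d) (∣m∣n⇒∣m+n x y))
      where
      eq : ∀ a b c d → (a ℤ.- b) ℤ.+ (c ℤ.- d) ≡ (a ℤ.+ c) ℤ.- (b ℤ.+ d)
      eq = solve-∀

    neg-congruent : ∀ {a b} → a ≡ₙ b → (ℤ.- a) ≡ₙ (ℤ.- b)
    neg-congruent {a} {b} (congruent x) = congruent (subst (+ n ∣_) (eq a b) (∣m⇒∣-m x))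
      where
      eq : ∀ a b → ℤ.- (a ℤ.- b) ≡ (ℤ.- a) ℤ.- (ℤ.- b)
      eq = solve-∀

  ℤ/_ℤ : AbelianGroup _ _
  ℤ/_ℤ = record
    { Carrier = ℤ
    ; _≈_ = _≡ₙ_
    ; _∙_ = ℤ._+_
    ; ε = 0ℤ
    ; _⁻¹ = ℤ.-_
    ; isAbelianGroup = record
      { isGroup = record
        { isMonoid = record
          { isSemigroup = record
            { isMagma = record
              { isEquivalence = record
                { refl = reflexive refl ; sym = symmetric ; trans = transitive }
              ; ∙-cong = +-congruent
              }
            ; assoc = λ a b c → reflexive (ℤ.+-assoc a b c)
            }
          ; identity = (λ a → reflexive (ℤ.+-identityˡ a))
                     , (λ a → reflexive (ℤ.+-identityʳ a))
          }
        ; inverse = (λ a → reflexive (ℤ.+-inverseˡ a))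
                  , (λ a → reflexive (ℤ.+-inverseʳ a))
        ; ⁻¹-cong = neg-congruent
        }
      ; comm = λ a b → reflexive (ℤ.+-comm a b)
      }
    }

record IsCyclic (S : CommutativeSemigroup c ℓ) (s : CommutativeSemigroup.Carrier S)
                (k n : ℕ) : Set (c ⊔ ℓ) where
  open CommutativeSemigroup S
  open Sequences S
  field
    generated : ∀ a → ∃[ t ] 1 ≤ t × t · s ≈ a
    index     : LeastPositive (λ j → ∃[ t ] 1 ≤ t × t ≢ j × j · s ≈ t · s) k
    period    : LeastPositive (λ m → (k ℕ.+ m) · s ≈ k · s) n

module Invariants (S : CommutativeSemigroup c ℓ) (s : CommutativeSemigroup.Carrier S)
                  (k n : ℕ) where

  open CommutativeSemigroup S using (Carrier; _≈_)
  open Sequences S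
  open Smoothness using (Smooth; ZeroSumSmooth; _≡ord_)

  IsInd : Carrier → ℕ → Set ℓ
  IsInd a = LeastPositive (λ t → t · s ≈ a)

  -- The sequence ts of the indices of the terms of T is determined by T.
  IndicesSatisfy : (List ℤ → Set) → List Carrier → Set (c ⊔ ℓ)
  IndicesSatisfy Q T = ∃[ ts ] Pointwise IsInd T ts × Q (map (+_) ts)

  IndicesSmooth₁ IndicesSmooth IndicesZeroSumSmooth : List Carrier → Set (c ⊔ ℓ)
  IndicesSmooth₁ = IndicesSatisfy (Smooth ℤ.+-0-abelianGroup 1ℤ)
  IndicesSmooth = IndicesSatisfy λ T →
    ∃[ g ] _≡ord_ (ℤ/ n ℤ) n g × Smooth (ℤ/ n ℤ) g T
  IndicesZeroSumSmooth = IndicesSatisfy λ T →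
    ∃[ g ] _≡ord_ (ℤ/ n ℤ) n g × ZeroSumSmooth (ℤ/ n ℤ) g T

  IsSmo : ℕ → Set (c ⊔ ℓ)
  IsSmo m =
    (k ≡ 1 → n ≡ 1 → m ≡ 1) ×
    (1 < k ℕ.⊔ n → LeastPositive
      (λ l → ∀ T → MinimalIdempotentSum T → l ≤ length T →
        (n < k → IndicesSmooth₁ T) × (k ≤ n → IndicesZeroSumSmooth T))
      m)

  IsŜmo : ℕ → Set (c ⊔ ℓ)
  IsŜmo m =
    (k ≡ 1 → n ≡ 1 → m ≡ 0) ×
    (1 < k ℕ.⊔ n → LeastPositive
      (λ l → ∀ T → IdempotentSumFree T → l ≤ length T →
        (n < k → IndicesSmooth₁ T) × (k ≤ n → IndicesSmooth T))
      m)

{-# OPTIONS --safe #-}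

-- Let K = ⌈ k / n ⌉ n.  A multiple x s is idempotent exactly if n ∣ x and
-- x ≥ K, so an idempotent-sum free sequence is a sequence of indices that is
-- zero-sum free modulo K.  The upper bounds rest on the theorem of Savchev and
-- Chen that a zero-sum free sequence of length ℓ > K / 2 in ℤ/Kℤ is smooth.  It
-- is proved by induction on ℓ for all sequences α with |Σ₀(α)| < 2ℓ, where
-- Σ₀ = Σ ∪ {0}: complementation gives |Σ₀(α)| ≥ |Σ₀(δ)| + |Σ₀(α δ⁻¹)| - 1, so
-- three distinct terms, having at least seven subset sums, can be removed, and
-- appending a term to a smooth sequence either keeps it smooth or doubles the
-- number of its subset sums.
-- For k > n all indices are multiples of a generator g modulo K, and since the
-- subset sums divisible by n stay below K while there are many small
-- coefficients, g is 1.  The lower bounds come from sequences consisting mostly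
-- of 2's.  Where only bounds for an invariant are known, it exists because the
-- defining property is decidable below the upper bound.
module Submission where

open import Defs
open import Algebra.Bundles using (CommutativeSemigroup; AbelianGroup)
import Algebra.Definitions.RawMonoid
import Algebra.Properties.Group
import Algebra.Properties.Monoid.Mult
open import Data.Empty using (⊥; ⊥-elim)
open import Data.Fin.Base using (zero; suc; fromℕ<)
open import Data.Fin.Properties using (injective⇒≤; fromℕ<-injective)
open import Data.List.Base using (List; []; _∷_; _++_; map; replicate; applyUpTo; length; lookup)
open import Data.List.Membership.Propositional using (_∈_)
open import Data.List.Membership.Propositional.Properties using (∈-lookup; ∈-∃++)
open import Data.List.Properties using (length-++; length-map; length-replicate; length-applyUpTo)
open import Data.List.Relation.Binary.Permutation.Propositional using (_↭_; refl; prep; swap; trans; ↭-sym; ↭⇒↭ₛ′)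
open import Data.List.Relation.Binary.Permutation.Propositional.Properties using (All-resp-↭; ++-comm; map⁺; shift; ↭-length)
open import Data.List.Relation.Binary.Pointwise as Pointwise using (Pointwise; []; _∷_)
open import Data.List.Relation.Unary.All as All using (All; []; _∷_)
import Data.List.Relation.Unary.All.Properties as All
open import Data.List.Relation.Unary.AllPairs as AllPairs using (AllPairs; []; _∷_)
import Data.List.Relation.Unary.AllPairs.Properties as AllPairs
open import Data.List.Relation.Unary.Any using (here; there)
open import Data.Nat.Base hiding (∣_-_∣)
open import Data.Nat.Divisibility
open import Data.Nat.DivMod
open import Data.Nat.GCD using (gcd; gcd[m,n]∣m; gcd[m,n]∣n; gcd-greatest; c*gcd[m,n]≡gcd[cm,cn])
open import Data.Nat.ListAction using (sum)
open import Data.Nat.ListAction.Properties using (sum-++; sum-↭)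
open import Data.Nat.Properties
open import Algebra.Properties.CommutativeSemigroup +-commutativeSemigroup using (x∙yz≈y∙xz)
open import Data.Nat.Tactic.RingSolver using (solve)
open import Data.Product.Base using (_×_; _,_; ∃-syntax; ∃₂; proj₁; proj₂)
open import Data.Sum.Base using (_⊎_; inj₁; inj₂; [_,_]′)
open import Data.Unit.Base using (tt)
open import Function.Base using (_∘_; case_of_)
open import Relation.Binary.Definitions using (tri<; tri≈; tri>)
open import Relation.Binary.PropositionalEquality as ≡ using (_≡_; _≢_; refl; sym; cong; cong₂; subst; subst₂)
open import Relation.Nullary using (¬_; Dec; yes; no; contradiction)
open import Relation.Nullary.Decidable using (map′; _×-dec_; _⊎-dec_; _→-dec_; ¬?; True; toWitness; toWitnessFalse)

-- The condition |Σ₀(α)| < 2ℓ is what the induction can carry: removing three distinct terms lowers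
-- the left side by at least six and the right side by exactly six, whereas ℓ > K / 2 need not
-- survive a removal. Sequences with at most two values offer no such triple and are settled
-- directly. For k > n the conclusion concerns indices as integers, but the structure theorem only
-- speaks of residues modulo K, and an index may be as large as k + n - 1 ≥ K. Therefore all terms
-- are first shown to lie below K. Afterwards a coefficient y with y g < K determines its index
-- exactly, so that sums of such indices are true multiples of g. For k ≤ n any generator is
-- allowed, and a lower-bound sequence has to be tested against all of them. A smooth sequence has a
-- coefficient 1, so g is congruent to one of its terms, which leaves only the candidates 2, 3 and
-- -1.

private
  variable
    a b c d g h i j k l m n p x y z B κ : ℕ
    ts us xs ys zs ms : List ℕ

-- For the variable lists of the ring solver, whose macro cannot resolve the overloaded _∷_.
infixr 5 _&_
pattern _&_ x xs = List._∷_ x xs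

-- A linear inequality follows from p ≤ q with slack s, by an equation that the ring solver proves.
lin : ∀ {p q l r} s → p ≤ q → l + q + s ≡ r + p → l ≤ r
lin {p} {q} {l} {r} s p≤q eq = +-cancelʳ-≤ q l r (≤-trans (m≤m+n (l + q) s) (≤-trans (≤-reflexive eq) (+-monoʳ-≤ r p≤q)))

lin⊥ : ∀ {p q} s → p ≤ q → 1 + q + s ≡ p → ⊥
lin⊥ {q = q} s p≤q eq = 1+n≰n (≤-trans (m≤m+n (suc q) s) (≤-trans (≤-reflexive eq) p≤q))

excess : m ≤ n → ∃[ d ] m + d ≡ n
excess h = m≤n⇒∃[o]m+o≡n h

infixl 6 _⊕_
_⊕_ : a ≤ b → c ≤ d → a + c ≤ b + d
_⊕_ = +-mono-≤

infixl 7 _⊛_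
_⊛_ : ∀ k → a ≤ b → k * a ≤ k * b
k ⊛ a≤b = *-monoʳ-≤ k a≤b

-- Subset sums together with their number of terms

-- The count `c` separates the empty selection from the nonempty ones and the full selection from
-- the proper ones. Zero-sum freeness and minimality need both distinctions, and a sum alone does
-- not reveal how many terms it uses.
data SumOf : List ℕ → ℕ → ℕ → Set where
  nil  : SumOf [] 0 0
  skip : SumOf ts c x → SumOf (a ∷ ts) c x
  take : SumOf ts c x → SumOf (a ∷ ts) (suc c) (a + x)

castSum : x ≡ y → SumOf ts c x → SumOf ts c y
castSum refl p = p

emptySum : ∀ ts → SumOf ts 0 0
emptySum []       = nil
emptySum (t ∷ ts) = skip (emptySum ts)

fullSum : ∀ ts → SumOf ts (length ts) (sum ts)
fullSum []       = nil
fullSum (t ∷ ts) = take (fullSum ts)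

zeroTerms : SumOf ts 0 x → x ≡ 0
zeroTerms nil      = refl
zeroTerms (skip p) = zeroTerms p

SumOf-↭ : ts ↭ us → SumOf ts c x → SumOf us c x
SumOf-↭ refl p = p
SumOf-↭ (prep a σ) (skip p) = skip (SumOf-↭ σ p)
SumOf-↭ (prep a σ) (take p) = take (SumOf-↭ σ p)
SumOf-↭ (swap a b σ) (skip (skip p)) = skip (skip (SumOf-↭ σ p))
SumOf-↭ (swap a b σ) (skip (take p)) = take (skip (SumOf-↭ σ p))
SumOf-↭ (swap a b σ) (take (skip p)) = skip (take (SumOf-↭ σ p))
SumOf-↭ (swap a b σ) (take (take {x = x} p)) =
  castSum (x∙yz≈y∙xz b a x) (take (take (SumOf-↭ σ p)))
SumOf-↭ (trans σ τ) p = SumOf-↭ τ (SumOf-↭ σ p)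

infixr 5 _++ˢ_
_++ˢ_ : SumOf ts c x → SumOf us d y → SumOf (ts ++ us) (c + d) (x + y)
nil ++ˢ q = q
skip p ++ˢ q = skip (p ++ˢ q)
take {x = x} {a = a} p ++ˢ q = castSum (sym (+-assoc a x _)) (take (p ++ˢ q))

inject₁ : ∀ us → SumOf ts c x → SumOf (ts ++ us) c x
inject₁ us p = subst₂ (SumOf _) (+-identityʳ _) (+-identityʳ _) (p ++ˢ emptySum us)

inject₂ : ∀ ts → SumOf us d y → SumOf (ts ++ us) d y
inject₂ ts q = emptySum ts ++ˢ q

record Complement (ts : List ℕ) (c x : ℕ) : Set where
  constructor complement-of
  field
    {count total} : ℕ
    isSum  : SumOf ts count total
    counts : c + count ≡ length ts
    totals : x + total ≡ sum ts

complement : SumOf ts c x → Complement ts c x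
complement nil = complement-of nil refl refl
complement {c = c} {x = x} (skip {a = a} p) with complement p
... | complement-of {count} {total} q e f =
  complement-of (take q) (≡.trans (+-suc c count) (cong suc e))
    (≡.trans (x∙yz≈y∙xz x a total) (cong (a +_) f))
complement (take {x = x} {a = a} p) with complement p
... | complement-of q e f =
  complement-of (skip q) (cong suc e) (≡.trans (+-assoc a x _) (cong (a +_) f))

SumOf≤sum : SumOf ts c x → x ≤ sum ts
SumOf≤sum p = ≤-trans (m≤m+n _ _) (≤-reflexive (Complement.totals (complement p)))

SumOf-count≤ : SumOf ts c x → c ≤ length ts
SumOf-count≤ p = ≤-trans (m≤m+n _ _) (≤-reflexive (Complement.counts (complement p)))

count≤SumOf : All (1 ≤_) ts → SumOf ts c x → c ≤ x
count≤SumOf [] nil = z≤n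
count≤SumOf (_ ∷ pos) (skip p) = count≤SumOf pos p
count≤SumOf (1≤a ∷ pos) (take p) = +-mono-≤ 1≤a (count≤SumOf pos p)

length≤sum : All (1 ≤_) ts → length ts ≤ sum ts
length≤sum pos = count≤SumOf pos (fullSum _)

sumOf? : ∀ ts c x → Dec (SumOf ts c x)
sumOf? [] zero zero = yes nil
sumOf? [] zero (suc x) = no λ ()
sumOf? [] (suc c) x = no λ ()
sumOf? (a ∷ ts) zero x = map′ skip (λ { (skip p) → p }) (sumOf? ts zero x)
sumOf? (a ∷ ts) (suc c) x with a ≤? x
... | no a≰x = map′ skip (λ { (skip p) → p ; (take _) → contradiction (m≤m+n a _) a≰x }) (sumOf? ts (suc c) x)
... | yes a≤x = map′
  [ skip , castSum (m+[n∸m]≡n a≤x) ∘ take ]′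
  (λ { (skip p) → inj₁ p ; (take p) → inj₂ (castSum (sym (m+n∸m≡n a _)) p) })
  (sumOf? ts (suc c) x ⊎-dec sumOf? ts c (x ∸ a))

someSum? : ∀ ts x → Dec (∃[ c ] SumOf ts c x)
someSum? ts x = map′ (λ (c , _ , p) → c , p) (λ (c , p) → c , s≤s (SumOf-count≤ p) , p)
  (anyUpTo? (λ c → sumOf? ts c x) (suc (length ts)))

member : a ∈ ts → SumOf ts 1 a
member (here refl) = castSum (+-identityʳ _) (take (emptySum _))
member (there a∈ts) = skip (member a∈ts)

-- Complete sequences of positive integers

-- The value 0 is included, so that `[]` is complete and inductions can start there. For a nonempty
-- list of positive integers this is 1-smoothness.
Complete : List ℕ → Set
Complete ys = ∀ j → j ≤ sum ys → ∃[ c ] SumOf ys c j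

complete? : ∀ ys → Dec (Complete ys)
complete? ys = map′ (λ f j j≤ → f (s≤s j≤)) (λ f {j} j< → f j (s≤s⁻¹ j<))
  (allUpTo? (someSum? ys) (suc (sum ys)))

Complete-↭ : ys ↭ us → Complete ys → Complete us
Complete-↭ σ comp j j≤ = case comp j (≤-trans j≤ (≤-reflexive (sym (sum-↭ σ)))) of λ (c , p) → c , SumOf-↭ σ p

complete-[] : Complete []
complete-[] zero z≤n = 0 , nil

-- A target above `sum ys` uses `y`: it is at least `y` because `y` exceeds `sum ys` by at most one,
-- and what remains is at most `sum ys`.
complete-∷ : Complete ys → y ≤ suc (sum ys) → Complete (y ∷ ys)
complete-∷ {ys} {y} comp y≤ j j≤ with j ≤? sum ys
... | yes j≤N = let c , p = comp j j≤N in c , skip p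
... | no j≰N =
  let y≤j = ≤-trans y≤ (≰⇒> j≰N)
      c , p = comp (j ∸ y) (≤-trans (∸-monoˡ-≤ y j≤) (≤-reflexive (m+n∸m≡n y _)))
  in suc c , castSum (m+[n∸m]≡n y≤j) (take p)

ones-sum : All (1 ≤_) ys → sum ys ≤ length ys → All (_≡ 1) ys
ones-sum [] _ = []
ones-sum {y ∷ ys} (1≤y ∷ pos) h = y≡1 ∷ ones-sum pos (s≤s⁻¹ (≤-trans (+-monoˡ-≤ _ 1≤y) h))
  where
  y≡1 : y ≡ 1
  y≡1 = ≤-antisym (+-cancelʳ-≤ (length ys) y 1 (≤-trans (+-monoʳ-≤ y (length≤sum pos)) h)) 1≤y

complete-ones : All (_≡ 1) ys → Complete ys
complete-ones [] = complete-[]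
complete-ones (refl ∷ ones) = complete-∷ (complete-ones ones) z<s

private
  few-ones-and-rest : ∀ v ys → All (1 ≤_) ys → v + sum ys < 2 * (v + length ys) →
                      Complete (replicate v 1 ++ ys)
  few-ones-and-rest v [] [] _ = complete-ones (All.++⁺ (All.replicate⁺ v refl) [])
  few-ones-and-rest v (1 ∷ ys) (_ ∷ pos) h =
    Complete-↭ (↭-sym (shift 1 (replicate v 1) ys))
      (few-ones-and-rest (suc v) ys pos (subst₂ _<_ (+-suc v (sum ys)) (cong (2 *_) (+-suc v (length ys))) h))
  few-ones-and-rest v (y@(suc (suc z)) ∷ ys) (_ ∷ pos) h =
    Complete-↭ (↭-sym (shift y (replicate v 1) ys))
      (complete-∷ (few-ones-and-rest v ys pos (shorter v z (sum ys) (length ys) h))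
        (subst (y ≤_) (cong suc (sym sum≡)) (small v z (sum ys) (length ys) (length≤sum pos) h)))
    where
    shorter : ∀ v z s l → v + (suc (suc z) + s) < 2 * (v + suc l) → v + s < 2 * (v + l)
    shorter v z s l h = lin z h (solve (v & z & s & l & []))
    small : ∀ v z s l → l ≤ s → v + (suc (suc z) + s) < 2 * (v + suc l) → suc (suc z) ≤ suc (v + s)
    small v z s l l≤s h = lin 0 (h ⊕ 2 ⊛ l≤s) (solve (v & z & s & l & []))
    sum-ones : ∀ v → sum (replicate v 1) ≡ v
    sum-ones zero = refl
    sum-ones (suc v) = cong suc (sum-ones v)
    sum≡ : sum (replicate v 1 ++ ys) ≡ v + sum ys
    sum≡ = ≡.trans (sum-++ (replicate v 1) ys) (cong (_+ sum ys) (sum-ones v))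

complete-long : All (1 ≤_) ys → sum ys < 2 * length ys → Complete ys
complete-long = few-ones-and-rest 0 _

-- Long zero-sum free sequences

Pointwise-↭ : ∀ {a b r} {A : Set a} {B : Set b} {R : A → B → Set r} {xs ys zs} →
              Pointwise R xs ys → ys ↭ zs → ∃[ ws ] xs ↭ ws × Pointwise R ws zs
Pointwise-↭ pw refl = _ , refl , pw
Pointwise-↭ (r ∷ pw) (prep y σ) = let ws , τ , qw = Pointwise-↭ pw σ in _ , prep _ τ , r ∷ qw
Pointwise-↭ (r ∷ s ∷ pw) (swap y z σ) = let ws , τ , qw = Pointwise-↭ pw σ in _ , swap _ _ τ , s ∷ r ∷ qw
Pointwise-↭ pw (trans σ σ′) =
  let ws , τ , qw = Pointwise-↭ pw σ ; vs , τ′ , rw = Pointwise-↭ qw σ′ in vs , trans τ τ′ , rw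

find-other : ∀ {P : ℕ → Set} → (∀ x → Dec (P x)) → ∀ ts → All P ts ⊎ ∃₂ λ x us → ¬ P x × ts ↭ x ∷ us
find-other P? [] = inj₁ []
find-other P? (t ∷ ts) with P? t | find-other P? ts
... | no ¬p | _ = inj₂ (t , ts , ¬p , refl)
... | yes p | inj₁ ps = inj₁ (p ∷ ps)
... | yes _ | inj₂ (x , us , ¬p , σ) = inj₂ (x , t ∷ us , ¬p , trans (prep t σ) (swap t x refl))

separate : ∀ {P Q : ℕ → Set} {ts} → All (λ x → P x ⊎ Q x) ts → ∃₂ λ us vs → All P us × All Q vs × ts ↭ us ++ vs
separate [] = [] , [] , [] , [] , refl
separate (inj₁ p ∷ ps) = let us , vs , all-p , all-q , σ = separate ps in _ ∷ us , vs , p ∷ all-p , all-q , prep _ σ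
separate (inj₂ q ∷ ps) =
  let us , vs , all-p , all-q , σ = separate ps
  in us , _ ∷ vs , all-p , q ∷ all-q , trans (prep _ σ) (↭-sym (shift _ us vs))

-- Congruences and subset sums modulo n

module Congruence (n : ℕ) .{{_ : NonZero n}} where

  private
    variable
      q r s : ℕ

  infix 4 _≈_ _≈?_

  record _≈_ (x y : ℕ) : Set where
    constructor residues
    field
      residue≡ : x % n ≡ y % n

  ≈-refl : x ≈ x
  ≈-refl = residues refl

  ≈-reflexive : x ≡ y → x ≈ y
  ≈-reflexive refl = ≈-refl

  ≈-sym : x ≈ y → y ≈ x
  ≈-sym (residues e) = residues (sym e)

  ≈-trans : x ≈ y → y ≈ z → x ≈ z
  ≈-trans (residues e) (residues f) = residues (≡.trans e f)

  _≈?_ : ∀ x y → Dec (x ≈ y)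
  x ≈? y = map′ residues _≈_.residue≡ (x % n ≟ y % n)

  infixl 6 _⊞_
  _⊞_ : p ≈ q → r ≈ s → p + r ≈ q + s
  _⊞_ {p} {q} {r} {s} (residues e) (residues f) = residues
    (≡.trans (%-distribˡ-+ p r n) (≡.trans (cong₂ (λ i j → (i + j) % n) e f) (sym (%-distribˡ-+ q s n))))

  infixl 7 _⊠_
  _⊠_ : ∀ k → p ≈ q → k * p ≈ k * q
  zero ⊠ e = ≈-refl
  suc k ⊠ e = e ⊞ k ⊠ e

  shift-multiple : x + p * n ≡ y + q * n → x ≈ y
  shift-multiple {x} {p} {y} {q} e = residues
    (≡.trans (sym ([m+kn]%n≡m%n x p n)) (≡.trans (cong (_% n) e) ([m+kn]%n≡m%n y q n)))

  multiple-shift : x ≈ y → x + (y / n) * n ≡ y + (x / n) * n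
  multiple-shift {x} {y} (residues e) = begin
    x + y / n * n                    ≡⟨ cong (_+ y / n * n) (m≡m%n+[m/n]*n x n) ⟩
    x % n + x / n * n + y / n * n    ≡⟨ cong (λ i → i + x / n * n + y / n * n) e ⟩
    y % n + x / n * n + y / n * n    ≡⟨ lemma (y % n) (x / n * n) (y / n * n) ⟩
    y % n + y / n * n + x / n * n    ≡⟨ cong (_+ x / n * n) (m≡m%n+[m/n]*n y n) ⟨
    y + x / n * n                    ∎
    where
    open ≡.≡-Reasoning
    lemma : ∀ a b c → a + b + c ≡ a + c + b
    lemma a b c = solve (a & b & c & [])

  +-cancelʳ-≈ : ∀ z → x + z ≈ y + z → x ≈ y
  +-cancelʳ-≈ {x} {y} z e = shift-multiple {p = (y + z) / n} {q = (x + z) / n}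
    (+-cancelˡ-≡ z _ _ (≡.trans (lemma z x _) (≡.trans (multiple-shift e) (sym (lemma z y _)))))
    where
    lemma : ∀ z x a → z + (x + a) ≡ x + z + a
    lemma z x a = solve (z & x & a & [])

  -- The counterpart of `lin` for congruences. Adding the hypothesis crosswise avoids subtraction
  -- and leaves an identity for the ring solver.
  linᶜ : p ≈ q → x + q ≡ y + p → x ≈ y
  linᶜ {p} {q} {x} {y} p≈q e = +-cancelʳ-≈ q (≈-trans (≈-reflexive e) (≈-refl ⊞ p≈q))

  linᶜ˘ : q ≈ p → x + q ≡ y + p → x ≈ y
  linᶜ˘ e = linᶜ (≈-sym e)

  ∣⇒≈0 : n ∣ x → x ≈ 0
  ∣⇒≈0 {x} n∣x = residues (≡.trans (n∣m⇒m%n≡0 x n n∣x) (sym (n∣m⇒m%n≡0 0 n (divides 0 refl))))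

  ≈0⇒∣ : x ≈ 0 → n ∣ x
  ≈0⇒∣ {x} (residues e) = m%n≡0⇒n∣m x n (≡.trans e (n∣m⇒m%n≡0 0 n (divides 0 refl)))

  %-≈ : ∀ x → x % n ≈ x
  %-≈ x = residues (m%n%n≡m%n x n)

  <⇒≈⇒≡ : x < n → y < n → x ≈ y → x ≡ y
  <⇒≈⇒≡ x<n y<n (residues e) = ≡.trans (sym (m<n⇒m%n≡m x<n)) (≡.trans e (m<n⇒m%n≡m y<n))

  SumMod : List ℕ → ℕ → ℕ → Set
  SumMod ts c x = ∃[ y ] SumOf ts c y × y ≈ x

  ZeroFree : List ℕ → Set
  ZeroFree ts = ∀ {c x} → SumOf ts (suc c) x → ¬ x ≈ 0

  ZeroFree-↭ : ∀ {ts us} → ts ↭ us → ZeroFree ts → ZeroFree us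
  ZeroFree-↭ σ zf p = zf (SumOf-↭ (↭-sym σ) p)

  SumMod-↭ : ∀ {ts us c} → ts ↭ us → SumMod ts c x → SumMod us c x
  SumMod-↭ σ (y , p , e) = y , SumOf-↭ σ p , e

  _++ᵐ_ : ∀ {ts us c d} → SumMod ts c x → SumMod us d y → SumMod (ts ++ us) (c + d) (x + y)
  (_ , p , e) ++ᵐ (_ , q , f) = _ , p ++ˢ q , e ⊞ f

  -- No condition on the order of `g` is built in. For a zero-sum free `ts`, `multiple≉0` keeps g,
  -- 2g, ... up to the total away from 0, and `smooth-order` recovers the order from that.
  record SmoothBy (g : ℕ) (ts : List ℕ) : Set where
    constructor smoothBy
    field
      coefficients : List ℕ
      multiples    : Pointwise (λ y t → y * g ≈ t) coefficients ts
      positive     : All (1 ≤_) coefficients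
      complete     : Complete coefficients

    total : ℕ
    total = sum coefficients

    coefficient-sum : ∀ {c j} → SumOf coefficients c j → SumMod ts c (j * g)
    coefficient-sum = go multiples
      where
      go : ∀ {ys ts c j} → Pointwise (λ y t → y * g ≈ t) ys ts → SumOf ys c j → SumMod ts c (j * g)
      go [] nil = 0 , nil , ≈-refl
      go (_ ∷ pw) (skip p) = let y , q , e = go pw p in y , skip q , e
      go (e ∷ pw) (take {x = x} {a = a} p) =
        let y , q , f = go pw p
        in _ , take q , ≈-trans (≈-sym e ⊞ f) (≈-reflexive (sym (*-distribʳ-+ g a x)))

    multiple-sum : ∀ {j} → j ≤ total → ∃[ c ] SumMod ts c (j * g)
    multiple-sum j≤ = let c , p = complete _ j≤ in c , coefficient-sum p

    multiple-sum⁺ : ∀ {j} → 1 ≤ j → j ≤ total → ∃[ c ] SumMod ts (suc c) (j * g)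
    multiple-sum⁺ 1≤j j≤ with complete _ j≤
    ... | zero , p = contradiction (≤-trans 1≤j (≤-reflexive (zeroTerms p))) 1+n≰n
    ... | suc c , p = c , coefficient-sum p

    length≤total : length ts ≤ total
    length≤total = subst (_≤ total) (Pointwise.Pointwise-length multiples) (length≤sum positive)

    multiple≉0 : ZeroFree ts → ∀ {j} → 1 ≤ j → j ≤ total → ¬ j * g ≈ 0
    multiple≉0 zf 1≤j j≤ e = let c , y , p , f = multiple-sum⁺ 1≤j j≤ in zf p (≈-trans f e)

  open SmoothBy using (total; multiple≉0; multiple-sum; multiple-sum⁺; length≤total)

  SmoothBy-↭ : ∀ {g ts us} → ts ↭ us → SmoothBy g ts → SmoothBy g us
  SmoothBy-↭ σ (smoothBy ys pw pos comp) =
    let ws , τ , qw = Pointwise-↭ pw σ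
    in smoothBy ws qw (All-resp-↭ τ pos) (Complete-↭ τ comp)

  smooth-∷ : ∀ {g b ts} (S : SmoothBy g ts) → 1 ≤ y → y ≤ suc (total S) → y * g ≈ b → SmoothBy g (b ∷ ts)
  smooth-∷ (smoothBy ys pw pos comp) 1≤y y≤ e = smoothBy (_ ∷ ys) (e ∷ pw) (1≤y ∷ pos) (complete-∷ comp y≤)

  Distinct : List ℕ → Set
  Distinct = AllPairs (λ x y → ¬ x ≈ y)

  infix 4 _∈Σ₀_ _∈Σ₁_
  _∈Σ₀_ _∈Σ₁_ : ℕ → List ℕ → Set
  x ∈Σ₀ ts = ∃[ c ] SumMod ts c x
  x ∈Σ₁ ts = ∃[ c ] SumMod ts (suc c) x

  -- |Σ(ts) ∪ {0}| < 2 |ts|, stated without cardinalities.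
  Small : List ℕ → Set
  Small ts = ∀ {xs} → Distinct xs → All (_∈Σ₀ ts) xs → length xs < 2 * length ts

  Small-↭ : ∀ {ts us} → ts ↭ us → Small ts → Small us
  Small-↭ σ small dist sums = subst (λ l → _ < 2 * l) (↭-length σ)
    (small dist (All.map (λ (c , s) → c , SumMod-↭ (↭-sym σ) s) sums))

  -- If z + σ(ρ) ≈ y for a sum y over a part of ρ, then z and the rest of ρ add up to 0.
  split-bound : ∀ {δ ρ zs ys} → ZeroFree (δ ++ ρ) → Small (δ ++ ρ) →
                Distinct zs → All (_∈Σ₁ δ) zs → Distinct ys → All (_∈Σ₀ ρ) ys →
                length zs + length ys < 2 * length (δ ++ ρ)
  split-bound {δ} {ρ} {zs} {ys} zf small dzs zs∈ dys ys∈ =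
    subst (_< _) (≡.trans (length-++ (map (_+ sum ρ) zs)) (cong (_+ length ys) (length-map _ zs)))
      (small
        (AllPairs.++⁺ (AllPairs.map⁺ (AllPairs.map (λ z≉w e → z≉w (+-cancelʳ-≈ _ e)) dzs)) dys
          (All.map⁺ (All.map (λ z∈ → All.map (cross z∈) ys∈) zs∈)))
        (All.++⁺ (All.map⁺ (All.map (λ (c , s) → _ , s ++ᵐ (_ , fullSum ρ , ≈-refl)) zs∈))
          (All.map (λ (c , y , p , e) → c , y , inject₂ δ p , e) ys∈)))
    where
    cross : z ∈Σ₁ δ → y ∈Σ₀ ρ → ¬ z + sum ρ ≈ y
    cross {z} {y} (c , z₀ , p , z₀≈z) (d , y₀ , q , y₀≈y) e with complement q
    ... | complement-of {total = y′} q′ _ y₀+y′≡ = zf (p ++ˢ q′)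
      (linᶜ (≈-trans (z₀≈z ⊞ ≈-reflexive y₀+y′≡) (≈-trans e (≈-sym y₀≈y))) (solve (z₀ & y₀ & y′ & [])))

-- Counting subset sums when terms are appended or removed

module SavchevChen (n : ℕ) .{{_ : NonZero n}} where

  open Congruence n
  open SmoothBy using (total; multiple≉0; multiple-sum; multiple-sum⁺; length≤total)

  private
    variable
      δ ρ τ : List ℕ

  difference : i < j → ∃[ d ] j ≡ suc (i + d)
  difference i<j = let d , e = excess i<j in d , sym e

  NonMultiple : ℕ → ℕ → ℕ → Set
  NonMultiple g m b = ∀ {j} → 1 ≤ j → j ≤ m → ¬ j * g ≈ b

  nonMultiple? : ∀ g m b → (∃[ j ] 1 ≤ j × j ≤ m × j * g ≈ b) ⊎ NonMultiple g m b
  nonMultiple? g m b with anyUpTo? (λ i → suc i * g ≈? b) m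
  ... | yes (i , i<m , e) = inj₁ (suc i , s≤s z≤n , i<m , e)
  ... | no none = inj₂ λ { {suc j} _ j≤m e → none (j , j≤m , e) }

  multiples : (g b m : ℕ) → List ℕ
  multiples g b m = applyUpTo (λ i → b + i * g) (suc m)

  multiples-distinct : NonMultiple g m 0 → Distinct (multiples g b m)
  multiples-distinct {g} {m} {b} nm = AllPairs.applyUpTo⁺₁ _ (suc m) apart
    where
    apart : ∀ {i j} → i < j → j < suc m → ¬ b + i * g ≈ b + j * g
    apart {i} {j} i<j j≤m e with difference i<j
    ... | d , refl = nm z<s (≤-trans (s≤s (m≤n+m d i)) (s≤s⁻¹ j≤m))
      (linᶜ˘ e (solve (b & i & d & g & [])))

  rows : (g b m : ℕ) → List ℕ
  rows g b m = multiples g 0 m ++ multiples g b m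

  length-rows : ∀ g b m → length (rows g b m) ≡ 2 * suc m
  length-rows g b m = ≡.trans (length-++ (multiples g 0 m))
    (cong₂ _+_ (length-applyUpTo (λ i → i * g) (suc m)) (≡.trans (length-applyUpTo (λ i → b + i * g) (suc m)) (sym (+-identityʳ (suc m)))))

  Negated : ℕ → ℕ → ℕ → Set
  Negated g m b = ∀ {j} → j ≤ m → ¬ b + j * g ≈ 0

  -- Cancelling the smaller multiple leaves either `b` as a multiple of `g`, or `b` plus a multiple
  -- of `g` congruent to 0.
  row-apart : NonMultiple g m b → Negated g m b → i ≤ m → j ≤ m → ¬ i * g ≈ b + j * g
  row-apart {g} {m} {b} {i} {j} nm neg i≤m j≤m e with i ≤? j
  ... | yes i≤j with d , refl ← excess i≤j =
    neg (≤-trans (m≤n+m d i) j≤m) (linᶜ˘ e (solve (b & i & d & g & [])))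
  ... | no i≰j with d , refl ← difference (≰⇒> i≰j) =
    nm z<s (≤-trans (s≤s (m≤n+m d j)) i≤m) (linᶜ e (solve (b & j & d & g & [])))

  rows-distinct : NonMultiple g m 0 → NonMultiple g m b → Negated g m b → Distinct (rows g b m)
  rows-distinct {g} {m} {b} nm₀ nm neg = AllPairs.++⁺ (multiples-distinct nm₀) (multiples-distinct nm₀)
    (All.applyUpTo⁺₁ (λ i → i * g) (suc m) λ i<m → All.applyUpTo⁺₁ (λ j → b + j * g) (suc m) λ j<m →
      row-apart nm neg (s≤s⁻¹ i<m) (s≤s⁻¹ j<m))

  rows-all : ∀ {P : ℕ → Set} → (∀ {i} → i ≤ m → P (i * g)) → (∀ {i} → i ≤ m → P (b + i * g)) → All P (rows g b m)
  rows-all {m} {g} {b} p q = All.++⁺ (All.applyUpTo⁺₁ (λ i → i * g) (suc m) (p ∘ s≤s⁻¹))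
                                     (All.applyUpTo⁺₁ (λ i → b + i * g) (suc m) (q ∘ s≤s⁻¹))

  ∈Σ₀-skip : x ∈Σ₀ ts → x ∈Σ₀ (a ∷ ts)
  ∈Σ₀-skip (c , y , p , e) = c , y , skip p , e

  ∈Σ₁-skip : x ∈Σ₁ ts → x ∈Σ₁ (a ∷ ts)
  ∈Σ₁-skip (c , y , p , e) = c , y , skip p , e

  ∈Σ₁-take : x ∈Σ₀ ts → (a + x) ∈Σ₁ (a ∷ ts)
  ∈Σ₁-take (c , y , p , e) = c , _ , take p , ≈-refl ⊞ e

  ∈Σ₁-head : a ∈Σ₁ (a ∷ ts)
  ∈Σ₁-head {a} = 0 , _ , take (emptySum _) , ≈-reflexive (+-identityʳ a)

  Σ₁⇒Σ₀ : x ∈Σ₁ ts → x ∈Σ₀ ts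
  Σ₁⇒Σ₀ (c , s) = suc c , s

  zeroFree : ZeroFree ts → x ∈Σ₁ ts → ¬ x ≈ 0
  zeroFree zf (_ , _ , p , e) f = zf p (≈-trans e f)

  ZeroFree-++ʳ : ∀ τ → ZeroFree (τ ++ ρ) → ZeroFree ρ
  ZeroFree-++ʳ τ zf p = zf (inject₂ τ p)

  ZeroFree-∷ : ZeroFree (a ∷ ts) → ZeroFree ts
  ZeroFree-∷ zf p = zf (skip p)

  smooth-rows : (S : SmoothBy g ρ) → m ≤ total S → ZeroFree (b ∷ ρ) → NonMultiple g m b →
                Distinct (rows g b m) × All (_∈Σ₀ (b ∷ ρ)) (rows g b m)
  smooth-rows S m≤ zf nm =
    rows-distinct (λ 1≤j j≤ → multiple≉0 S (ZeroFree-∷ zf) 1≤j (≤-trans j≤ m≤)) nm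
      (λ j≤ → zeroFree zf (∈Σ₁-take (multiple-sum S (≤-trans j≤ m≤))))
    , rows-all (λ i≤ → ∈Σ₀-skip (multiple-sum S (≤-trans i≤ m≤)))
               (λ i≤ → Σ₁⇒Σ₀ (∈Σ₁-take (multiple-sum S (≤-trans i≤ m≤))))

  -- A coefficient up to `suc (total S)` keeps completeness. If `b` has none, the multiples of `g`
  -- up to the total and their translates by `b` are all distinct sums of `b ∷ ρ`, and `split-bound`
  -- adds to them the sums `zs` of the terms `τ` that are still waiting.
  extend : (S : SmoothBy g ρ) → ZeroFree (τ ++ b ∷ ρ) → Small (τ ++ b ∷ ρ) → Distinct zs → All (_∈Σ₁ τ) zs →
           (∃[ y ] 1 ≤ y × y ≤ suc (total S) × y * g ≈ b) ⊎
           (NonMultiple g (suc (total S)) b × length zs + 2 * suc (total S) < 2 * length (τ ++ b ∷ ρ))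
  extend {g = g} {ρ = ρ} {τ = τ} {b = b} {zs = zs} S zf small dzs zs∈ with nonMultiple? g (suc (total S)) b
  ... | inj₁ found = inj₁ found
  ... | inj₂ nm =
    let dist , sums = smooth-rows S ≤-refl (ZeroFree-++ʳ τ zf) (λ 1≤j j≤ → nm 1≤j (m≤n⇒m≤1+n j≤))
    in inj₂ (nm , subst (λ l → length zs + l < 2 * length (τ ++ b ∷ ρ)) (length-rows g b (total S))
               (split-bound zf small dzs zs∈ dist sums))

  -- With total N, a failure to append would produce 2(N + 1) sums, at least twice the length,
  -- against `Small`. The overall length stays fixed while N only grows, so every remaining term can
  -- be appended.
  finish : ∀ τ (S : SmoothBy g ρ) → ZeroFree (τ ++ ρ) → Small (τ ++ ρ) → length (τ ++ ρ) ≤ suc (total S) →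
           SmoothBy g (τ ++ ρ)
  finish [] S zf small l≤ = S
  finish {ρ = ρ} (b ∷ τ) S zf small l≤ =
    case extend {τ = τ} {zs = []} S (ZeroFree-↭ σ zf) (Small-↭ σ small) [] [] of λ where
      (inj₁ (y , 1≤y , y≤ , e)) → SmoothBy-↭ (↭-sym σ)
        (finish τ (smooth-∷ S 1≤y y≤ e) (ZeroFree-↭ σ zf) (Small-↭ σ small)
          (≤-trans (≤-reflexive (↭-length (↭-sym σ))) (≤-trans l≤ (s≤s (m≤n+m _ y)))))
      (inj₂ (_ , bound)) → contradiction (*-monoʳ-≤ 2 l≤)
        (<⇒≱ (subst (λ l → 2 * suc (total S) < 2 * l) (↭-length (↭-sym σ)) bound))
    where
    σ : b ∷ τ ++ ρ ↭ τ ++ b ∷ ρ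
    σ = ↭-sym (shift b τ ρ)

  -- If a + a ≈ 0, the partial sums s and the residues a + s are 2 (|ts| + 1) distinct residues.
  pairs : ℕ → List ℕ → List ℕ
  pairs a [] = 0 ∷ a ∷ []
  pairs a (x ∷ ts) = 0 ∷ a ∷ map (x +_) (pairs a ts)

  length-pairs : ∀ a ts → length (pairs a ts) ≡ 2 * suc (length ts)
  length-pairs a [] = refl
  length-pairs a (x ∷ ts) = ≡.trans (cong (2 +_) (≡.trans (length-map (x +_) (pairs a ts)) (length-pairs a ts)))
    (sym (*-suc 2 (suc (length ts))))

  pairs-sums : ∀ a ts → All (λ d → d ∈Σ₀ ts ⊎ ∃[ e ] e ∈Σ₀ ts × d ≡ a + e) (pairs a ts)
  pairs-sums a [] = inj₁ (0 , 0 , nil , ≈-refl) ∷ inj₂ (0 , (0 , 0 , nil , ≈-refl) , sym (+-identityʳ a)) ∷ []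
  pairs-sums a (x ∷ ts) =
    inj₁ (0 , 0 , emptySum _ , ≈-refl) ∷
    inj₂ (0 , (0 , 0 , emptySum _ , ≈-refl) , sym (+-identityʳ a)) ∷
    All.map⁺ (All.map
      [ inj₁ ∘ Σ₁⇒Σ₀ ∘ ∈Σ₁-take
      , (λ (e , e∈ , d≡) → inj₂ (x + e , Σ₁⇒Σ₀ (∈Σ₁-take e∈) , ≡.trans (cong (x +_) d≡) (x∙yz≈y∙xz x a e))) ]′
      (pairs-sums a ts))

  pairs-distinct : ∀ ts → a + a ≈ 0 → ZeroFree (a ∷ ts) → Distinct (pairs a ts)
  pairs-distinct [] _ zf = (zeroFree zf ∈Σ₁-head ∘ ≈-sym ∷ []) ∷ [] ∷ []
  pairs-distinct {a} (x ∷ ts) 2a≈0 zf =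
    (zeroFree zf ∈Σ₁-head ∘ ≈-sym ∷ All.map⁺ (All.map (λ s e → zero-apart s (≈-sym e)) (pairs-sums a ts))) ∷
    All.map⁺ (All.map a-apart (pairs-sums a ts)) ∷
    AllPairs.map⁺ (AllPairs.map (λ {d} {e} d≉e f → d≉e (linᶜ f (cross x d e))) (pairs-distinct ts 2a≈0 λ where
      (skip p) → zf (skip (skip p))
      (take p) → zf (take (skip p))))
    where
    cross : ∀ x d e → d + (x + e) ≡ e + (x + d)
    cross x d e = solve (x & d & e & [])
    zero-apart : ∀ {d} → d ∈Σ₀ ts ⊎ ∃[ e ] e ∈Σ₀ ts × d ≡ a + e → ¬ x + d ≈ 0
    zero-apart (inj₁ s) = zeroFree zf (∈Σ₁-skip (∈Σ₁-take s))
    zero-apart (inj₂ (e , s , refl)) f = zeroFree zf (∈Σ₁-take (Σ₁⇒Σ₀ (∈Σ₁-take s)))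
      (≈-trans (≈-reflexive (x∙yz≈y∙xz a x e)) f)
    a-apart : ∀ {d} → d ∈Σ₀ ts ⊎ ∃[ e ] e ∈Σ₀ ts × d ≡ a + e → ¬ a ≈ x + d
    a-apart {d} (inj₁ s) f = zeroFree zf (∈Σ₁-take (Σ₁⇒Σ₀ (∈Σ₁-take s)))
      (≈-trans (≈-refl ⊞ ≈-sym f) 2a≈0)
    a-apart (inj₂ (e , s , refl)) f = zeroFree zf (∈Σ₁-skip (∈Σ₁-take s)) (linᶜ (≈-sym f) (solve (a & x & e & [])))

  no-involution : ZeroFree (a ∷ ts) → Small (a ∷ ts) → ¬ a + a ≈ 0
  no-involution {a} {ts} zf small 2a≈0 = <-irrefl (length-pairs a ts)
    (small (pairs-distinct ts 2a≈0 zf)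
      (All.map [ ∈Σ₀-skip , (λ { (e , s , refl) → Σ₁⇒Σ₀ (∈Σ₁-take s) }) ]′ (pairs-sums a ts)))

  two-sums : ZeroFree (a ∷ b ∷ []) → ¬ a ≈ b →
             Distinct (a ∷ b ∷ a + b ∷ []) × All (_∈Σ₁ (a ∷ b ∷ [])) (a ∷ b ∷ a + b ∷ [])
  two-sums {a} {b} zf a≉b =
    (a≉b ∷ (λ e → zeroFree zf (∈Σ₁-skip ∈Σ₁-head) (linᶜ˘ e (solve (a & b & [])))) ∷ [])
      ∷ ((λ e → zeroFree zf ∈Σ₁-head (linᶜ˘ e (solve (a & b & [])))) ∷ []) ∷ [] ∷ []
    , ∈Σ₁-head ∷ ∈Σ₁-skip ∈Σ₁-head ∷ ∈Σ₁-take (Σ₁⇒Σ₀ ∈Σ₁-head) ∷ []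

  private
    -- Together with 0 these are the seven sums. `a + b` is left out because it may be congruent to
    -- `c`.
    six-sums : ZeroFree (a ∷ b ∷ c ∷ []) → ¬ a ≈ b → ¬ a ≈ c → ¬ b ≈ c → ¬ a + c ≈ b → ¬ b + c ≈ a →
               let zs = a ∷ b ∷ c ∷ a + c ∷ b + c ∷ a + (b + c) ∷ []
               in Distinct zs × All (_∈Σ₁ (a ∷ b ∷ c ∷ [])) zs
    six-sums {a} {b} {c} zf a≉b a≉c b≉c ac≉b bc≉a =
      ( (a≉b ∷ a≉c ∷ (λ e → c≉0 (linᶜ˘ e (solve (a & c & [])))) ∷ (bc≉a ∘ ≈-sym)
          ∷ (λ e → bc≉0 (linᶜ˘ e (solve (a & b & c & [])))) ∷ [])
      ∷ (b≉c ∷ (ac≉b ∘ ≈-sym) ∷ (λ e → c≉0 (linᶜ˘ e (solve (b & c & []))))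
          ∷ (λ e → ac≉0 (linᶜ˘ e (solve (a & b & c & [])))) ∷ [])
      ∷ ((λ e → a≉0 (linᶜ˘ e (solve (a & c & [])))) ∷ (λ e → b≉0 (linᶜ˘ e (solve (b & c & []))))
          ∷ (λ e → ab≉0 (linᶜ˘ e (solve (a & b & c & [])))) ∷ [])
      ∷ ((λ e → a≉b (linᶜ e (solve (a & b & c & [])))) ∷ (λ e → b≉0 (linᶜ˘ e (solve (a & b & c & [])))) ∷ [])
      ∷ ((λ e → a≉0 (linᶜ˘ e (solve (a & b & c & [])))) ∷ [])
      ∷ [] ∷ [])
      , ∈a ∷ ∈b ∷ ∈c ∷ ∈Σ₁-take (Σ₁⇒Σ₀ (∈Σ₁-skip ∈Σ₁-head)) ∷ ∈bc ∷ ∈Σ₁-take (Σ₁⇒Σ₀ (∈Σ₁-take (Σ₁⇒Σ₀ ∈Σ₁-head))) ∷ []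
      where
      ∈a : a ∈Σ₁ (a ∷ b ∷ c ∷ [])
      ∈a = ∈Σ₁-head
      ∈b : b ∈Σ₁ (a ∷ b ∷ c ∷ [])
      ∈b = ∈Σ₁-skip ∈Σ₁-head
      ∈c : c ∈Σ₁ (a ∷ b ∷ c ∷ [])
      ∈c = ∈Σ₁-skip (∈Σ₁-skip ∈Σ₁-head)
      ∈bc : (b + c) ∈Σ₁ (a ∷ b ∷ c ∷ [])
      ∈bc = ∈Σ₁-skip (∈Σ₁-take (Σ₁⇒Σ₀ ∈Σ₁-head))
      a≉0 : ¬ a ≈ 0
      a≉0 = zeroFree zf ∈a
      b≉0 : ¬ b ≈ 0
      b≉0 = zeroFree zf ∈b
      c≉0 : ¬ c ≈ 0
      c≉0 = zeroFree zf ∈c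
      ab≉0 : ¬ a + b ≈ 0
      ab≉0 = zeroFree zf (∈Σ₁-take (Σ₁⇒Σ₀ ∈Σ₁-head))
      ac≉0 : ¬ a + c ≈ 0
      ac≉0 = zeroFree zf (∈Σ₁-take (Σ₁⇒Σ₀ (∈Σ₁-skip ∈Σ₁-head)))
      bc≉0 : ¬ b + c ≈ 0
      bc≉0 = zeroFree zf ∈bc

    remove-three : ZeroFree (a ∷ b ∷ c ∷ ρ) → Small (a ∷ b ∷ c ∷ ρ) → ¬ a ≈ b → ¬ a ≈ c → ¬ b ≈ c →
                   ¬ a + c ≈ b → ¬ b + c ≈ a → Small ρ
    remove-three {a} {b} {c} {ρ} zf small a≉b a≉c b≉c ac≉b bc≉a {xs} dist sums =
      let d , s = six-sums (λ p → zf (inject₁ ρ p)) a≉b a≉c b≉c ac≉b bc≉a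
      in arith (length xs) (length ρ) (split-bound {δ = a ∷ b ∷ c ∷ []} zf small d s dist sums)
      where
      arith : ∀ x l → 6 + x < 2 * (3 + l) → x < 2 * l
      arith x l h = lin 0 h (solve (x & l & []))

  -- Any two of the relations a + b ≈ c, a + c ≈ b, b + c ≈ a give 2x ≈ 0 for their common summand
  -- x, which `no-involution` excludes. So at most one holds, and the terms are ordered such that
  -- its left side is the pair sum omitted in `six-sums`.
  Small-remove-three : ZeroFree (a ∷ b ∷ c ∷ ρ) → Small (a ∷ b ∷ c ∷ ρ) → ¬ a ≈ b → ¬ a ≈ c → ¬ b ≈ c → Small ρ
  Small-remove-three {a} {b} {c} {ρ} zf small a≉b a≉c b≉c with a + c ≈? b | b + c ≈? a
  ... | no ac≉b | no bc≉a = remove-three zf small a≉b a≉c b≉c ac≉b bc≉a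
  ... | yes ac≈b | _ = remove-three (ZeroFree-↭ σ zf) (Small-↭ σ small) a≉c a≉b (b≉c ∘ ≈-sym)
    (λ ab≈c → no-involution zf small (linᶜ (ab≈c ⊞ ac≈b) (solve (a & b & c & []))))
    (λ cb≈a → no-involution (ZeroFree-↭ π zf) (Small-↭ π small) (linᶜ (cb≈a ⊞ ac≈b) (solve (a & b & c & []))))
    where
    σ : a ∷ b ∷ c ∷ ρ ↭ a ∷ c ∷ b ∷ ρ
    σ = prep a (swap b c refl)
    π : a ∷ b ∷ c ∷ ρ ↭ c ∷ a ∷ b ∷ ρ
    π = trans σ (swap a c refl)
  ... | no ac≉b | yes bc≈a = remove-three (ZeroFree-↭ σ zf) (Small-↭ σ small) b≉c (a≉b ∘ ≈-sym) (a≉c ∘ ≈-sym)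
    (λ ba≈c → no-involution (ZeroFree-↭ π zf) (Small-↭ π small) (linᶜ (ba≈c ⊞ bc≈a) (solve (a & b & c & []))))
    (λ ca≈b → ac≉b (≈-trans (≈-reflexive (+-comm a c)) ca≈b))
    where
    σ : a ∷ b ∷ c ∷ ρ ↭ b ∷ c ∷ a ∷ ρ
    σ = trans (swap a b refl) (prep b (swap a c refl))
    π : a ∷ b ∷ c ∷ ρ ↭ b ∷ a ∷ c ∷ ρ
    π = swap a b refl

-- Zero-sum free sequences with two values

module TwoValued (n : ℕ) .{{_ : NonZero n}} where

  open Congruence n
  open SavchevChen n
  open SmoothBy using (total; multiple≉0; multiple-sum; multiple-sum⁺; length≤total)

  private
    variable
      x′ y′ : ℕ
      ρ : List ℕ

  constant-sum : All (_≈ b) ts → x ≤ length ts → SumMod ts x (x * b)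
  constant-sum {x = zero} _ _ = 0 , emptySum _ , ≈-refl
  constant-sum {x = suc x} (e ∷ es) (s≤s x≤) =
    let y , p , f = constant-sum es x≤ in _ , take p , e ⊞ f

  smooth-constant : All (_≈ g) ts → SmoothBy g ts
  smooth-constant [] = smoothBy [] [] [] complete-[]
  smooth-constant {g} (e ∷ es) = smooth-∷ (smooth-constant es) ≤-refl z<s
    (≈-trans (≈-reflexive (+-identityʳ g)) (≈-sym e))

  total-constant : (es : All (_≈ g) ts) → total (smooth-constant es) ≡ length ts
  total-constant [] = refl
  total-constant (e ∷ es) = cong suc (total-constant es)

  smooth-++ : (S : SmoothBy g ρ) → 1 ≤ j → j ≤ suc (total S) → j * g ≈ c → All (_≈ c) ts → SmoothBy g (ts ++ ρ)
  smooth-++ {g} {ρ} {j} {c} S 1≤j j≤ e = proj₁ ∘ go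
    where
    go : All (_≈ c) ts → ∃[ S′ ] total S ≤ total {g} {ts ++ ρ} S′
    go [] = S , ≤-refl
    go (f ∷ fs) = let S′ , le = go fs in
      smooth-∷ S′ 1≤j (≤-trans j≤ (s≤s le)) (≈-trans e (≈-sym f)) , m≤n⇒m≤o+n j le

  module Grid (b c u′ w′ : ℕ) where
    private
      u : ℕ
      u = suc u′
      w : ℕ
      w = suc w′

    value : ℕ × ℕ → ℕ
    value (x , y) = x * b + y * c

    -- Two points of this border can only be identified by a relation J b ≈ Y c with J = 1 or Y = 1.
    border : List (ℕ × ℕ)
    border = applyUpTo (λ i → i , 0) (suc u) ++ applyUpTo (λ i → i , 1) (suc u) ++
             applyUpTo (λ i → u′ , 2 + i) w′ ++ applyUpTo (λ i → u , 2 + i) w′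

    length-border : length border ≡ 2 * (u + w)
    length-border = ≡.trans (length-++ (applyUpTo (λ i → i , 0) (suc u))) (≡.trans
      (cong₂ _+_ (length-applyUpTo (λ i → i , 0) (suc u)) (≡.trans (length-++ (applyUpTo (λ i → i , 1) (suc u)))
        (cong₂ _+_ (length-applyUpTo (λ i → i , 1) (suc u)) (≡.trans (length-++ (applyUpTo (λ i → u′ , 2 + i) w′))
          (cong₂ _+_ (length-applyUpTo (λ i → u′ , 2 + i) w′) (length-applyUpTo (λ i → u , 2 + i) w′))))))
      (arith u′ w′))
      where
      arith : ∀ u′ w′ → suc (suc u′) + (suc (suc u′) + (w′ + w′)) ≡ 2 * (suc u′ + suc w′)
      arith u′ w′ = solve (u′ & w′ & [])

    border-All : ∀ {P : ℕ × ℕ → Set} → (∀ {x y} → x ≤ u → y ≤ w → P (x , y)) → All P border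
    border-All f =
      All.++⁺ (All.applyUpTo⁺₁ (λ i → i , 0) (suc u) (λ i< → f (s≤s⁻¹ i<) z≤n))
      (All.++⁺ (All.applyUpTo⁺₁ (λ i → i , 1) (suc u) (λ i< → f (s≤s⁻¹ i<) z<s))
      (All.++⁺ (All.applyUpTo⁺₁ (λ i → u′ , 2 + i) w′ (λ i< → f (n≤1+n u′) (s≤s i<)))
               (All.applyUpTo⁺₁ (λ i → u , 2 + i) w′ (λ i< → f ≤-refl (s≤s i<)))))

    module _ (nonzero : ∀ {x y} → x ≤ u → y ≤ w → 1 ≤ x + y → ¬ x * b + y * c ≈ 0)
             (c≉ : NonMultiple b u c) (b≉ : NonMultiple c w b) where

      crossing : ∀ {J Y} → suc J ≤ u → suc Y ≤ w → J ≡ 0 ⊎ Y ≡ 0 → ¬ suc J * b ≈ suc Y * c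
      crossing _ Y≤ (inj₁ refl) e = b≉ z<s Y≤ (≈-trans (≈-sym e) (≈-reflexive (+-identityʳ b)))
      crossing J≤ _ (inj₂ refl) e = c≉ z<s J≤ (≈-trans e (≈-reflexive (+-identityʳ c)))

      -- Cancelling the common part leaves a nonempty zero-sum if one point dominates the other, and
      -- otherwise a relation between a multiple of `b` and a multiple of `c`. `J` and `Y` are one
      -- less than the coordinate differences, so `J ≡ 0` or `Y ≡ 0` says that one of the two
      -- multiples is the value itself, as `crossing` requires.
      apart : x ≤ u → y ≤ w → x′ ≤ u → y′ ≤ w → ¬ (x ≡ x′ × y ≡ y′) →
              (∀ {J Y} → x ≡ suc (x′ + J) → y′ ≡ suc (y + Y) → J ≡ 0 ⊎ Y ≡ 0) →
              (∀ {J Y} → x′ ≡ suc (x + J) → y ≡ suc (y′ + Y) → J ≡ 0 ⊎ Y ≡ 0) →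
              ¬ value (x , y) ≈ value (x′ , y′)
      apart {x} {y} {x′} {y′} x≤ y≤ x′≤ y′≤ ne up down e with compare x x′ | compare y y′
      ... | equal _ | equal _ = ne (refl , refl)
      ... | less _ J | less _ Y = nonzero (≤-trans (s≤s (m≤n+m J x)) x′≤) (≤-trans (s≤s (m≤n+m Y y)) y′≤) z<s
        (linᶜ˘ e (solve (x & y & J & Y & b & c & [])))
      ... | less _ J | equal _ = nonzero {y = 0} (≤-trans (s≤s (m≤n+m J x)) x′≤) z≤n z<s
        (linᶜ˘ e (solve (x & y & J & b & c & [])))
      ... | less _ J | greater _ Y = crossing (≤-trans (s≤s (m≤n+m J x)) x′≤) (≤-trans (s≤s (m≤n+m Y y′)) y≤)
        (down refl refl) (linᶜ˘ e (solve (x & y′ & J & Y & b & c & [])))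
      ... | equal _ | less _ Y = nonzero {x = 0} z≤n (≤-trans (s≤s (m≤n+m Y y)) y′≤) z<s
        (linᶜ˘ e (solve (x & y & Y & b & c & [])))
      ... | equal _ | greater _ Y = nonzero {x = 0} z≤n (≤-trans (s≤s (m≤n+m Y y′)) y≤) z<s
        (linᶜ e (solve (x & y′ & Y & b & c & [])))
      ... | greater _ J | less _ Y = crossing (≤-trans (s≤s (m≤n+m J x′)) x≤) (≤-trans (s≤s (m≤n+m Y y)) y′≤)
        (up refl refl) (linᶜ e (solve (x′ & y & J & Y & b & c & [])))
      ... | greater _ J | equal _ = nonzero {y = 0} (≤-trans (s≤s (m≤n+m J x′)) x≤) z≤n z<s
        (linᶜ e (solve (x′ & y & J & b & c & [])))
      ... | greater _ J | greater _ Y = nonzero (≤-trans (s≤s (m≤n+m J x′)) x≤) (≤-trans (s≤s (m≤n+m Y y′)) y≤) z<s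
        (linᶜ e (solve (x′ & y′ & J & Y & b & c & [])))

      one-step : ∀ {J} → i < suc u → i ≡ suc (u′ + J) → J ≡ 0
      one-step {J = J} i≤ refl = n≤0⇒n≡0 (+-cancelˡ-≤ (suc u′) J 0 (≤-trans (s≤s⁻¹ i≤) (≤-reflexive (cong suc (sym (+-identityʳ u′))))))

      border-distinct : Distinct (map value border)
      border-distinct = AllPairs.map⁺
        (AllPairs.++⁺
          (AllPairs.applyUpTo⁺₁ (λ i → i , 0) (suc u) λ i<j j< →
            apart (≤-trans (<⇒≤ i<j) (s≤s⁻¹ j<)) z≤n (s≤s⁻¹ j<) z≤n (λ { (refl , _) → <-irrefl refl i<j })
              (λ _ ()) (λ _ ()))
          (AllPairs.++⁺
            (AllPairs.applyUpTo⁺₁ (λ i → i , 1) (suc u) λ i<j j< →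
              apart (≤-trans (<⇒≤ i<j) (s≤s⁻¹ j<)) z<s (s≤s⁻¹ j<) z<s (λ { (refl , _) → <-irrefl refl i<j })
                (λ _ ()) (λ _ ()))
            (AllPairs.++⁺
              (AllPairs.applyUpTo⁺₁ (λ i → u′ , 2 + i) w′ λ i<j j< →
                apart (n≤1+n u′) (s≤s (≤-trans i<j (<⇒≤ j<))) (n≤1+n u′) (s≤s j<) (λ { (_ , refl) → <-irrefl refl i<j })
                  (λ e _ → contradiction e (m≢1+m+n u′)) (λ e _ → contradiction e (m≢1+m+n u′)))
              (AllPairs.applyUpTo⁺₁ (λ i → u , 2 + i) w′ λ i<j j< →
                apart ≤-refl (s≤s (≤-trans i<j (<⇒≤ j<))) ≤-refl (s≤s j<) (λ { (_ , refl) → <-irrefl refl i<j })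
                  (λ e _ → contradiction e (m≢1+m+n u)) (λ e _ → contradiction e (m≢1+m+n u)))
              (All.applyUpTo⁺₁ (λ i → u′ , 2 + i) w′ λ i< → All.applyUpTo⁺₁ (λ i → u , 2 + i) w′ λ j< →
                apart (n≤1+n u′) (s≤s i<) ≤-refl (s≤s j<) (λ { (() , _) })
                  (λ {J} e _ → contradiction (≡.trans e (cong suc (sym (+-suc u′ J)))) (m≢1+m+n u′)) (λ e _ → inj₁ (one-step ≤-refl e))))
            (All.applyUpTo⁺₁ (λ i → i , 1) (suc u) λ i< → All.++⁺
              (All.applyUpTo⁺₁ (λ i → u′ , 2 + i) w′ λ j< →
                apart (s≤s⁻¹ i<) z<s (n≤1+n u′) (s≤s j<) (λ ()) (λ e _ → inj₁ (one-step i< e)) (λ _ ()))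
              (All.applyUpTo⁺₁ (λ i → u , 2 + i) w′ λ j< →
                apart (s≤s⁻¹ i<) z<s ≤-refl (s≤s j<) (λ ())
                  (λ { refl _ → contradiction (s≤s⁻¹ (s≤s⁻¹ i<)) (<⇒≱ (s≤s (m≤m+n u′ _))) }) (λ _ ()))))
          (All.applyUpTo⁺₁ (λ i → i , 0) (suc u) λ i< → All.++⁺
            (All.applyUpTo⁺₁ (λ i → i , 1) (suc u) λ j< →
              apart (s≤s⁻¹ i<) z≤n (s≤s⁻¹ j<) z<s (λ ()) (λ { _ refl → inj₂ refl }) (λ _ ()))
            (All.++⁺
              (All.applyUpTo⁺₁ (λ i → u′ , 2 + i) w′ λ j< →
                apart (s≤s⁻¹ i<) z≤n (n≤1+n u′) (s≤s j<) (λ ()) (λ e _ → inj₁ (one-step i< e)) (λ _ ()))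
              (All.applyUpTo⁺₁ (λ i → u , 2 + i) w′ λ j< →
                apart (s≤s⁻¹ i<) z≤n ≤-refl (s≤s j<) (λ ())
                  (λ { refl _ → contradiction (s≤s⁻¹ (s≤s⁻¹ i<)) (<⇒≱ (s≤s (m≤m+n u′ _))) }) (λ _ ())))))

  -- If neither value is a small multiple of the other, the border consists of 2(|B| + |C|) distinct
  -- sums, exactly as many as `Small` forbids.
  smooth-two-valued : ∀ B C → All (_≈ b) B → All (_≈ c) C → 1 ≤ length B → 1 ≤ length C →
                      ZeroFree (B ++ C) → Small (B ++ C) → ∃[ g ] SmoothBy g (B ++ C)
  smooth-two-valued {b} {c} B@(b₀ ∷ B′) C@(c₀ ∷ C′) B≈ C≈ _ _ zf small
    with nonMultiple? b (length B) c | nonMultiple? c (length C) b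
  ... | inj₁ (j , 1≤j , j≤ , e) | _ =
    b , SmoothBy-↭ (++-comm C B) (smooth-++ (smooth-constant B≈) 1≤j
      (m≤n⇒m≤1+n (subst (j ≤_) (sym (total-constant B≈)) j≤)) e C≈)
  ... | inj₂ _ | inj₁ (j , 1≤j , j≤ , e) =
    c , smooth-++ (smooth-constant C≈) 1≤j (m≤n⇒m≤1+n (subst (j ≤_) (sym (total-constant C≈)) j≤)) e B≈
  ... | inj₂ c≉ | inj₂ b≉ = contradiction
    (small (border-distinct nonzero c≉ b≉)
      (All.map⁺ (border-All λ {x} {y} x≤ y≤ → x + y , constant-sum B≈ x≤ ++ᵐ constant-sum C≈ y≤)))
    (<-irrefl (≡.trans (length-map value border) (≡.trans length-border (cong (2 *_) (sym (length-++ B))))))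
    where
    open Grid b c (length B′) (length C′)
    nonzero : ∀ {x y} → x ≤ length B → y ≤ length C → 1 ≤ x + y → ¬ x * b + y * c ≈ 0
    nonzero {x} {y} x≤ y≤ 1≤ e with x + y | constant-sum B≈ x≤ ++ᵐ constant-sum C≈ y≤
    ... | suc _ | _ , p , f = zf p (≈-trans f e)

-- Three values, the induction, and the order of the generator

module LongZeroFree (n : ℕ) .{{_ : NonZero n}} where

  open Congruence n
  open SavchevChen n
  open TwoValued n
  open SmoothBy using (total; multiple≉0; multiple-sum; multiple-sum⁺; length≤total)

  private
    variable
      q : ℕ
      ρ : List ℕ

  -- Small forces all subset sums other than σ into the two rows; this puts c in the
  -- coset of b and then makes (v + 1) g and b + c incompatible.
  no-two-outside : (S : SmoothBy g ρ) → total S ≡ length ρ → 1 ≤ length ρ →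
                   ZeroFree (b ∷ c ∷ ρ) → Small (b ∷ c ∷ ρ) → ¬ b ≈ c →
                   NonMultiple g (total S) b → NonMultiple g (total S) c → ⊥
  no-two-outside {g} {ρ} {b} {c} S v≡ 1≤v zf small b≉c nmb nmc = b+c-outside
    where
    v : ℕ
    v = total S
    ρ∈ : j ≤ v → j * g ∈Σ₀ ρ
    ρ∈ = multiple-sum S
    1≤v′ : 1 ≤ v
    1≤v′ = subst (1 ≤_) (sym v≡) 1≤v
    b+≉0 : j ≤ v → ¬ b + j * g ≈ 0
    b+≉0 j≤ = zeroFree zf (∈Σ₁-take (∈Σ₀-skip (ρ∈ j≤)))
    c+≉0 : j ≤ v → ¬ c + j * g ≈ 0
    c+≉0 j≤ = zeroFree zf (∈Σ₁-skip (∈Σ₁-take (ρ∈ j≤)))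
    b+c+≉0 : j ≤ v → ¬ b + (c + j * g) ≈ 0
    b+c+≉0 j≤ = zeroFree zf (∈Σ₁-take (Σ₁⇒Σ₀ (∈Σ₁-take (ρ∈ j≤))))
    g≉0 : NonMultiple g v 0
    g≉0 = multiple≉0 S (ZeroFree-∷ (ZeroFree-∷ zf))
    c≉mult : j ≤ v → ¬ j * g ≈ c
    c≉mult {zero} _ e = c+≉0 z≤n (≈-trans (≈-reflexive (+-identityʳ c)) (≈-sym e))
    c≉mult {suc j} j≤ e = nmc z<s j≤ e
    σ : ℕ
    σ = b + (c + v * g)
    σ∉₁ : i ≤ v → ¬ σ ≈ i * g
    σ∉₁ {i} i≤ e with d , v≡i+d ← excess i≤ = b+c+≉0 {j = d} (subst (d ≤_) v≡i+d (m≤n+m d i))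
      (linᶜ (subst (λ v → b + (c + v * g) ≈ i * g) (sym v≡i+d) e) (solve (b & c & i & d & g & [])))
    σ∉₂ : i ≤ v → ¬ σ ≈ b + i * g
    σ∉₂ {i} i≤ e with d , v≡i+d ← excess i≤ = c+≉0 {j = d} (subst (d ≤_) v≡i+d (m≤n+m d i))
      (linᶜ (subst (λ v → b + (c + v * g) ≈ b + i * g) (sym v≡i+d) e) (solve (b & c & i & d & g & [])))
    -- The two rows and `σ` already make 2|ρ| + 3 distinct sums, since `v` is |ρ|. One more would
    -- reach twice the length of `b ∷ c ∷ ρ`.
    in-rows : x ∈Σ₀ (b ∷ c ∷ ρ) → (x ≈ σ) ⊎ (∃[ i ] i ≤ v × x ≈ i * g) ⊎ (∃[ i ] i ≤ v × x ≈ b + i * g)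
    in-rows {x} x∈ with x ≈? σ | anyUpTo? (λ i → x ≈? i * g) (suc v) | anyUpTo? (λ i → x ≈? b + i * g) (suc v)
    ... | yes e | _ | _ = inj₁ e
    ... | no _ | yes (i , i< , e) | _ = inj₂ (inj₁ (i , s≤s⁻¹ i< , e))
    ... | no _ | no _ | yes (i , i< , e) = inj₂ (inj₂ (i , s≤s⁻¹ i< , e))
    ... | no x≉σ | no no₁ | no no₂ = contradiction
      (small {x ∷ σ ∷ rows g b v}
        ((x≉σ ∷ rows-all (λ i≤ e → no₁ (_ , s≤s i≤ , e)) (λ i≤ e → no₂ (_ , s≤s i≤ , e)))
          ∷ rows-all σ∉₁ σ∉₂ ∷ rows-distinct g≉0 nmb b+≉0)
        (x∈ ∷ Σ₁⇒Σ₀ (∈Σ₁-take (Σ₁⇒Σ₀ (∈Σ₁-take (ρ∈ ≤-refl))))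
          ∷ rows-all (∈Σ₀-skip ∘ ∈Σ₀-skip ∘ ρ∈) (λ i≤ → Σ₁⇒Σ₀ (∈Σ₁-take (∈Σ₀-skip (ρ∈ i≤))))))
      (<-irrefl (≡.trans (cong (2 +_) (length-rows g b v)) (≡.trans (cong (λ l → 2 + 2 * suc l) v≡) (arith (length ρ)))))
      where
      arith : ∀ l → 2 + 2 * suc l ≡ 2 * suc (suc l)
      arith l = solve (l & [])
    c-in-row : ∃[ i ] 1 ≤ i × i ≤ v × c ≈ b + i * g
    c-in-row with in-rows (∈Σ₀-skip (Σ₁⇒Σ₀ ∈Σ₁-head))
    ... | inj₁ c≈σ = contradiction (linᶜ (≈-sym c≈σ) (arith b c (v * g))) (b+≉0 ≤-refl)
      where
      arith : ∀ b c z → b + z + c ≡ b + (c + z)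
      arith b c z = solve (b & c & z & [])
    ... | inj₂ (inj₁ (i , i≤ , e)) = contradiction (≈-sym e) (c≉mult i≤)
    ... | inj₂ (inj₂ (zero , _ , e)) = contradiction (≈-sym (≈-trans e (≈-reflexive (+-identityʳ b)))) b≉c
    ... | inj₂ (inj₂ (suc i , i≤ , e)) = suc i , s≤s z≤n , i≤ , e
    -- With c ≈ b + i g, the sum c + (v - i + 1) g ≈ b + (v + 1) g lies just past the end of the
    -- second row. Every place that `in-rows` offers is contradictory except the start `b` of that
    -- row.
    g-order : suc v * g ≈ 0
    g-order with c-in-row
    ... | i , 1≤i , i≤v , c≈ with d , v≡i+d ← excess i≤v = order-from
      (in-rows (∈Σ₀-skip (Σ₁⇒Σ₀ (∈Σ₁-take (ρ∈ {suc d} d<v)))))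
      where
      d<v : d < v
      d<v = subst (d <_) v≡i+d (m<n+m d 1≤i)
      beyond : c + suc d * g ≈ b + suc v * g
      beyond = ≈-trans (c≈ ⊞ ≈-refl) (≈-reflexive (subst (λ v → b + i * g + suc d * g ≡ b + suc v * g) v≡i+d (solve (b & i & d & g & []))))
      order-from : (c + suc d * g ≈ σ) ⊎ (∃[ j ] j ≤ v × c + suc d * g ≈ j * g) ⊎ (∃[ j ] j ≤ v × c + suc d * g ≈ b + j * g) →
                   suc v * g ≈ 0
      order-from (inj₁ e) = contradiction (linᶜ (≈-trans (≈-sym beyond) e) (arith b c g (v * g))) (c≉mult 1≤v′)
        where
        arith : ∀ b c g z → 1 * g + (b + (c + z)) ≡ c + (b + (g + z))
        arith b c g z = solve (b & c & g & z & [])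
      order-from (inj₂ (inj₁ (j , j≤ , e))) with j ≤? suc d
      ... | yes j≤d with k , j+k≡ ← excess j≤d = ⊥-elim
        (c+≉0 {j = k} (≤-trans (subst (k ≤_) j+k≡ (m≤n+m k j)) d<v)
          (linᶜ (subst (λ d → c + d * g ≈ j * g) (sym j+k≡) e) (solve (c & j & k & g & []))))
      ... | no j≰d with k , refl ← excess (≰⇒≥ j≰d) = ⊥-elim
        (c≉mult (≤-trans (m≤n+m k (suc d)) j≤) (linᶜ˘ e (solve (c & d & k & g & []))))
      order-from (inj₂ (inj₂ (zero , _ , e))) = linᶜ (≈-trans (≈-sym beyond) e) (arith b (suc v * g))
        where
        arith : ∀ b z → z + (b + 0) ≡ b + z
        arith b z = solve (b & z & [])
      order-from (inj₂ (inj₂ (suc j , j≤ , e))) with k , v≡j+k ← excess j≤ = ⊥-elim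
        (g≉0 {suc k} z<s (subst (suc k ≤_) v≡j+k (s≤s (m≤n+m k j)))
          (linᶜ (subst (λ v → b + suc v * g ≈ b + suc j * g) (sym v≡j+k) (≈-trans (≈-sym beyond) e)) (solve (b & j & k & g & []))))
    b+c-outside : ⊥
    b+c-outside with in-rows (Σ₁⇒Σ₀ (∈Σ₁-take (Σ₁⇒Σ₀ ∈Σ₁-head)))
    ... | inj₁ e = g≉0 1≤v′ ≤-refl (linᶜ˘ e (arith b c (v * g)))
      where
      arith : ∀ b c z → z + (b + c) ≡ b + (c + z)
      arith b c z = solve (b & c & z & [])
    ... | inj₂ (inj₁ (zero , _ , e)) = b+c+≉0 z≤n (≈-trans (≈-reflexive (arith b c)) e)
      where
      arith : ∀ b c → b + (c + 0) ≡ b + c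
      arith b c = solve (b & c & [])
    -- Further multiples of `g` carry b + c ≈ (j + 1) g on to (v + 1) g ≈ 0, so that `b`, `c` and
    -- terms of `ρ` would have sum 0.
    ... | inj₂ (inj₁ (suc j , j≤ , e)) with k , v≡j+k ← excess j≤ =
      b+c+≉0 {suc k} (subst (suc k ≤_) v≡j+k (s≤s (m≤n+m k j)))
        (≈-trans (linᶜ {x = b + (c + suc k * g)} {y = suc (suc (j + k)) * g} e (solve (b & c & j & k & g & [])))
          (subst (λ v → suc v * g ≈ 0) (sym v≡j+k) g-order))
    ... | inj₂ (inj₂ (j , j≤ , e)) = c≉mult j≤ (linᶜ˘ e (solve (b & c & j & g & [])))

  private
    -- `total S ≡ length E` means that all coefficients are 1, so that every term of `E` is
    -- congruent to `g`.
    data Outcome (E : List ℕ) (S : SmoothBy g E) (x : ℕ) (α : List ℕ) : Set where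
      smooth  : SmoothBy g α → Outcome E S x α
      equal   : total S ≡ length E → g ≈ x → Outcome E S x α
      outside : total S ≡ length E → NonMultiple g (suc (total S)) x → Outcome E S x α

  -- The distinct `p` and `q` contribute three sums. If `x` cannot be appended, these and the
  -- doubled sums of `ρ` leave no room for a total N above |ρ|. If `x` is appended with coefficient
  -- y, then either y + N ≥ |ρ| + 2, which suffices for `finish`, or y = 1 and N = |ρ|.
  append : (S : SmoothBy g ρ) → ZeroFree (p ∷ q ∷ x ∷ ρ) → Small (p ∷ q ∷ x ∷ ρ) → ¬ p ≈ q →
           Outcome ρ S x (p ∷ q ∷ x ∷ ρ)
  append {g} {ρ} {p} {q} {x} S zf small p≉q
    with dist , sums ← two-sums (λ s → zf (inject₁ (x ∷ ρ) s)) p≉q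
    with extend {τ = p ∷ q ∷ []} S zf small dist sums
  ... | inj₂ (nm , bound) = outside (≤-antisym (arith (total S) (length ρ) bound) (length≤total S)) nm
    where
    arith : ∀ N e → 3 + 2 * suc N < 2 * (3 + e) → N ≤ e
    arith N e h = *-cancelˡ-≤ 2 (lin 0 h (solve (N & e & [])))
  ... | inj₁ (y , 1≤y , y≤ , e) with 2 + length ρ ≤? y + total S
  ...   | yes long = smooth (finish (p ∷ q ∷ []) (smooth-∷ S 1≤y y≤ e) zf small (s≤s long))
  ...   | no short = equal N≡ (≈-trans (≈-reflexive (sym (≡.trans (cong (_* g) y≡1) (+-identityʳ g)))) e)
    where
    y+N≤ : y + total S ≤ 1 + length ρ
    y+N≤ = s≤s⁻¹ (≰⇒> short)
    N≡ : total S ≡ length ρ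
    N≡ = ≤-antisym (s≤s⁻¹ (≤-trans (+-monoˡ-≤ (total S) 1≤y) y+N≤)) (length≤total S)
    y≡1 : y ≡ 1
    y≡1 = ≤-antisym (+-cancelʳ-≤ (total S) y 1 (≤-trans y+N≤ (s≤s (length≤total S)))) 1≤y

  private
    Small⇒nonempty : Small ρ → 1 ≤ length ρ
    Small⇒nonempty {[]} small = contradiction (small {[]} [] []) λ ()
    Small⇒nonempty {_ ∷ _} _ = s≤s z≤n

    smooth-equal : SmoothBy g ρ → g ≈ a → SmoothBy g (a ∷ ρ)
    smooth-equal {g} S g≈a = smooth-∷ {y = 1} S ≤-refl z<s (≈-trans (≈-reflexive (+-identityʳ g)) g≈a)

    late : (S : SmoothBy g ρ) → total S ≡ length ρ → NonMultiple g (suc (total S)) x → 1 ≤ y → y * g ≈ x →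
           3 + length ρ ≤ suc (y + suc (total S))
    late {y = y} S N≡ nm 1≤y e with 2 ≤? y
    ... | yes 2≤y = s≤s (+-mono-≤ 2≤y (≤-trans (≤-reflexive (sym N≡)) (n≤1+n _)))
    ... | no 2≰y = contradiction e (nm 1≤y (≤-trans (s≤s⁻¹ (≰⇒> 2≰y)) z<s))

    -- Once `a` has joined the terms equal to `g`, the total is one larger. A coefficient of `b` or
    -- `c` that only now comes within reach is at least 2, enough for `finish`; if there is none,
    -- `no-two-outside` applies.
    one-equal : (S : SmoothBy g ρ) → total S ≡ length ρ → 1 ≤ length ρ →
                ZeroFree (b ∷ c ∷ a ∷ ρ) → Small (b ∷ c ∷ a ∷ ρ) → g ≈ a → ¬ b ≈ c →
                NonMultiple g (suc (total S)) b → NonMultiple g (suc (total S)) c → SmoothBy g (b ∷ c ∷ a ∷ ρ)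
    one-equal {g} {ρ} {b} {c} {a} S N≡ 1≤e zf small g≈a b≉c nmb nmc
      with nonMultiple? g (suc (suc (total S))) b | nonMultiple? g (suc (suc (total S))) c
    ... | inj₁ (y , 1≤y , y≤ , e) | _ = SmoothBy-↭ (swap c b refl)
      (finish (c ∷ []) (smooth-∷ (smooth-equal S g≈a) 1≤y y≤ e) (ZeroFree-↭ (swap b c refl) zf) (Small-↭ (swap b c refl) small)
        (late {y = y} S N≡ nmb 1≤y e))
    ... | inj₂ _ | inj₁ (y , 1≤y , y≤ , e) =
      finish (b ∷ []) (smooth-∷ (smooth-equal S g≈a) 1≤y y≤ e) zf small (late {y = y} S N≡ nmc 1≤y e)
    ... | inj₂ nmb′ | inj₂ nmc′ = ⊥-elim (no-two-outside (smooth-equal S g≈a) (cong suc N≡) z<s zf small b≉c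
        (λ 1≤j j≤ → nmb′ 1≤j (m≤n⇒m≤1+n j≤)) (λ 1≤j j≤ → nmc′ 1≤j (m≤n⇒m≤1+n j≤)))

    -- All terms of ρ equal g, so the distinct terms g, b, c can be removed instead of a, b, c.
    all-outside : (S : SmoothBy g ρ) → total S ≡ length ρ → 1 ≤ length ρ →
                  ZeroFree (b ∷ c ∷ a ∷ ρ) → Small (b ∷ c ∷ a ∷ ρ) → ¬ b ≈ c → ¬ g ≈ b → ¬ g ≈ c →
                  NonMultiple g (suc (total S)) a → ⊥
    all-outside {g} {h ∷ ρ} {b} {c} {a} (smoothBy (y ∷ ys) (e ∷ es) pos comp) N≡ _ zf small b≉c g≉b g≉c nma
      with refl ∷ ones ← ones-sum pos (≤-reflexive (≡.trans N≡ (cong suc (sym (Pointwise.Pointwise-length es))))) =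
      <-irrefl (≡.trans (length-rows g a (sum ys)) (cong (2 *_) N≡))
        (Small-remove-three (ZeroFree-↭ σ zf) (Small-↭ σ small) b≉c
          (λ b≈h → g≉b (≈-trans g≈h (≈-sym b≈h))) (λ c≈h → g≉c (≈-trans g≈h (≈-sym c≈h)))
          (proj₁ dist-sums) (proj₂ dist-sums))
      where
      g≈h : g ≈ h
      g≈h = ≈-trans (≈-reflexive (sym (+-identityʳ g))) e
      σ : b ∷ c ∷ a ∷ h ∷ ρ ↭ b ∷ c ∷ h ∷ a ∷ ρ
      σ = prep b (prep c (swap a h refl))
      S′ : SmoothBy g ρ
      S′ = smoothBy ys es (All.tail pos) (complete-ones ones)
      dist-sums : Distinct (rows g a (sum ys)) × All (_∈Σ₀ (a ∷ ρ)) (rows g a (sum ys))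
      dist-sums = smooth-rows S′ ≤-refl (ZeroFree-++ʳ (b ∷ c ∷ h ∷ []) (ZeroFree-↭ σ zf))
        (λ 1≤j j≤ → nma 1≤j (≤-trans j≤ (≤-trans (n≤1+n _) (n≤1+n _))))

  -- Each of the three terms is tried as the first to append. Unless a try succeeds, all terms of
  -- `ρ` are congruent to `g`, and at most one of the distinct `a`, `b`, `c` is.
  smooth-three-valued : SmoothBy g ρ → ZeroFree (a ∷ b ∷ c ∷ ρ) → Small (a ∷ b ∷ c ∷ ρ) → Small ρ →
                        ¬ a ≈ b → ¬ a ≈ c → ¬ b ≈ c → SmoothBy g (a ∷ b ∷ c ∷ ρ)
  smooth-three-valued {g} {ρ} {a} {b} {c} S zf small small-ρ a≉b a≉c b≉c =
    combine (append S (ZeroFree-↭ σa zf) (Small-↭ σa small) b≉c)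
            (append S (ZeroFree-↭ σb zf) (Small-↭ σb small) a≉c)
            (append S zf small a≉b)
    where
    σa : a ∷ b ∷ c ∷ ρ ↭ b ∷ c ∷ a ∷ ρ
    σa = trans (swap a b refl) (prep b (swap a c refl))
    σb : a ∷ b ∷ c ∷ ρ ↭ a ∷ c ∷ b ∷ ρ
    σb = prep a (swap b c refl)
    1≤e : 1 ≤ length ρ
    1≤e = Small⇒nonempty small-ρ
    not : NonMultiple g (suc (total S)) x → ¬ g ≈ x
    not nm e = nm ≤-refl z<s (≈-trans (≈-reflexive (+-identityʳ g)) e)
    combine : Outcome ρ S a (b ∷ c ∷ a ∷ ρ) → Outcome ρ S b (a ∷ c ∷ b ∷ ρ) → Outcome ρ S c (a ∷ b ∷ c ∷ ρ) →
              SmoothBy g (a ∷ b ∷ c ∷ ρ)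
    combine (smooth S′) _ _ = SmoothBy-↭ (↭-sym σa) S′
    combine _ (smooth S′) _ = SmoothBy-↭ (↭-sym σb) S′
    combine _ _ (smooth S′) = S′
    combine (equal _ g≈a) (equal _ g≈b) _ = contradiction (≈-trans (≈-sym g≈a) g≈b) a≉b
    combine (equal _ g≈a) _ (equal _ g≈c) = contradiction (≈-trans (≈-sym g≈a) g≈c) a≉c
    combine _ (equal _ g≈b) (equal _ g≈c) = contradiction (≈-trans (≈-sym g≈b) g≈c) b≉c
    combine (equal N≡ g≈a) (outside _ nmb) (outside _ nmc) = SmoothBy-↭ (↭-sym σa)
      (one-equal S N≡ 1≤e (ZeroFree-↭ σa zf) (Small-↭ σa small) g≈a b≉c nmb nmc)
    combine (outside _ nma) (equal N≡ g≈b) (outside _ nmc) = SmoothBy-↭ (↭-sym σb)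
      (one-equal S N≡ 1≤e (ZeroFree-↭ σb zf) (Small-↭ σb small) g≈b a≉c nma nmc)
    combine (outside _ nma) (outside _ nmb) (equal N≡ g≈c) = one-equal S N≡ 1≤e zf small g≈c a≉b nma nmb
    combine (outside N≡ nma) (outside _ nmb) (outside _ nmc) = ⊥-elim
      (all-outside S N≡ 1≤e (ZeroFree-↭ σa zf) (Small-↭ σa small) b≉c (not nmb) (not nmc) nma)

  Small⇒smooth : ZeroFree ts → Small ts → ∃[ g ] SmoothBy g ts
  Small⇒smooth {ts} = go (length ts) ts ≤-refl
    where
    go : ∀ m ts → length ts ≤ m → ZeroFree ts → Small ts → ∃[ g ] SmoothBy g ts
    go m [] _ _ small = 0 , smoothBy [] [] [] complete-[]
    go (suc m) (a ∷ ts) (s≤s len) zf small with find-other (_≈? a) ts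
    ... | inj₁ ts≈a = a , smooth-constant (≈-refl ∷ ts≈a)
    ... | inj₂ (b , us , b≉a , σ) with find-other (λ x → (x ≈? a) ⊎-dec (x ≈? b)) us
    ...   | inj₁ us≈ = let as , bs , as≈ , bs≈ , τ = separate us≈
                           π = trans (prep a (trans σ (prep b τ))) (prep a (↭-sym (shift b as bs)))
                           g , S = smooth-two-valued (a ∷ as) (b ∷ bs) (≈-refl ∷ as≈) (≈-refl ∷ bs≈) z<s z<s
                                     (ZeroFree-↭ π zf) (Small-↭ π small)
                       in g , SmoothBy-↭ (↭-sym π) S
    ...   | inj₂ (c , vs , c≉ , τ) =
      let π = prep a (trans σ (prep b τ))
          a≉b = b≉a ∘ ≈-sym
          a≉c = c≉ ∘ inj₁ ∘ ≈-sym
          b≉c = c≉ ∘ inj₂ ∘ ≈-sym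
          zf′ = ZeroFree-↭ π zf
          small′ = Small-↭ π small
          small-vs = Small-remove-three zf′ small′ a≉b a≉c b≉c
          g , S = go m vs (≤-trans (≤-trans (n≤1+n _) (n≤1+n _)) (≤-trans (≤-reflexive (sym (↭-length (trans σ (prep b τ))))) len))
                    (ZeroFree-++ʳ (a ∷ b ∷ c ∷ []) zf′) small-vs
      in g , SmoothBy-↭ (↭-sym π) (smooth-three-valued S zf′ small′ small-vs a≉b a≉c b≉c)

  Distinct-lookup : Distinct xs → ∀ i j → lookup xs i ≈ lookup xs j → i ≡ j
  Distinct-lookup (_ ∷ _) zero zero e = refl
  Distinct-lookup {xs = x ∷ xs} (x≉ ∷ _) zero (suc j) e = contradiction e (All.lookup x≉ (∈-lookup j))
  Distinct-lookup {xs = x ∷ xs} (x≉ ∷ _) (suc i) zero e = contradiction (≈-sym e) (All.lookup x≉ (∈-lookup i))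
  Distinct-lookup (_ ∷ dist) (suc i) (suc j) e = cong suc (Distinct-lookup dist i j e)

  Distinct-length : Distinct xs → length xs ≤ n
  Distinct-length {xs} dist = injective⇒≤ {f = λ i → fromℕ< (m%n<n (lookup xs i) n)}
    λ {i} {j} e → Distinct-lookup dist i j (residues (fromℕ<-injective _ _ _ _ e))

  -- The theorem of Savchev and Chen.
  long-zero-free : n < 2 * length ts → ZeroFree ts → ∃[ g ] SmoothBy g ts
  long-zero-free long zf = Small⇒smooth zf λ dist _ → ≤-<-trans (Distinct-length dist) long

  module _ (S : SmoothBy g ts) (zf : ZeroFree ts) where

    -- If m g ≈ 0, then already d g ≈ 0 for d = gcd(m, n). A proper divisor d would not exceed the
    -- total, where multiples of `g` do not vanish.
    smooth-order : (∀ {d} → d ∣ n → d < n → d ≤ total S) → ∀ {m} → 1 ≤ m → m * g ≈ 0 → n ≤ m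
    smooth-order divisors≤ {m} 1≤m e with gcd m n <? n
    ... | no d≮n = ≤-trans (≮⇒≥ d≮n) (∣⇒≤ {{>-nonZero 1≤m}} (gcd[m,n]∣m m n))
    ... | yes d<n = contradiction d*g≈0 (multiple≉0 S zf 1≤d (divisors≤ (gcd[m,n]∣n m n) d<n))
      where
      d*g≈0 : gcd m n * g ≈ 0
      d*g≈0 = ∣⇒≈0 (subst (n ∣_) (≡.trans (sym (c*gcd[m,n]≡gcd[cm,cn] g m n)) (*-comm g (gcd m n)))
        (gcd-greatest (subst (n ∣_) (*-comm m g) (≈0⇒∣ e)) (n∣m*n g)))
      1≤d : 1 ≤ gcd m n
      1≤d = n≢0⇒n>0 λ d≡0 → contradiction (subst (_∣ n) d≡0 (gcd[m,n]∣n m n)) 0∤n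
        where
        0∤n : ¬ 0 ∣ n
        0∤n (divides q n≡) = ≢-nonZero⁻¹ n (≡.trans n≡ (*-zeroʳ q))

    smooth-order-long : n ≤ 2 * length ts → ∀ {m} → 1 ≤ m → m * g ≈ 0 → n ≤ m
    smooth-order-long long = smooth-order λ {d} d∣n d<n → ≤-trans
      (*-cancelˡ-≤ 2 (≤-trans (double≤ d∣n d<n) long)) (length≤total S)
      where
      double≤ : ∀ {d} → d ∣ n → d < n → 2 * d ≤ n
      double≤ (divides zero n≡) d<n = contradiction (≤-trans d<n (≤-reflexive n≡)) λ ()
      double≤ {d} (divides 1 n≡) d<n = contradiction (≡.trans n≡ (+-identityʳ d)) (<⇒≢ d<n ∘ sym)
      double≤ {d} (divides (suc (suc q)) n≡) d<n = ≤-trans (*-monoˡ-≤ d {2} {suc (suc q)} (s≤s z<s)) (≤-reflexive (sym n≡))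

-- Index larger than the period

-- In C_{k;n} the multiple x s is idempotent if and only if n ∣ x and x ≥ K = ⌈ k / n ⌉ n.
SumFree : ℕ → ℕ → List ℕ → Set
SumFree K n ts = ∀ {c x} → SumOf ts (suc c) x → n ∣ x → x < K

SumFree-↭ : ∀ {K} → ts ↭ us → SumFree K n ts → SumFree K n us
SumFree-↭ σ free p = free (SumOf-↭ (↭-sym σ) p)

∈⇒↭∷ : x ∈ ts → ∃[ us ] ts ↭ x ∷ us
∈⇒↭∷ {x} x∈ with us , vs , refl ← ∈-∃++ x∈ = us ++ vs , shift x us vs

replicate-sum : ∀ {v} → j ≤ v → ∀ g → SumOf (replicate v g) j (j * g)
replicate-sum z≤n g = emptySum _
replicate-sum (s≤s j≤v) g = take (replicate-sum j≤v g)

module Long (m n : ℕ) .{{_ : NonZero n}} (2≤m : 2 ≤ m) (2≤n : 2 ≤ n) where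

  K : ℕ
  K = m * n

  2n≤K : 2 * n ≤ K
  2n≤K = *-monoˡ-≤ n 2≤m

  n≤K : n ≤ K
  n≤K = ≤-trans (m≤m+n n _) 2n≤K

  instance
    K-nonZero : NonZero K
    K-nonZero = >-nonZero (≤-trans (≤-trans z<s 2≤n) n≤K)

  open Congruence K
  open SavchevChen K using (zeroFree)
  open LongZeroFree K
  open SmoothBy using (total; multiple≉0; multiple-sum; multiple-sum⁺; length≤total)

  -- The threshold ⌈(K + n) / 2⌉, and one less if n ≥ 3 and K is even. The slack 2 of the second
  -- case is the `d` in the estimates on the generator.
  IsLong : ℕ → Set
  IsLong l = (K + n ≤ 2 * l) ⊎ (3 ≤ n × 2 ∣ K × K + n ≤ 2 * l + 2)

  IsLong⇒K<2l : ∀ {l} → IsLong l → K < 2 * l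
  IsLong⇒K<2l {l} (inj₁ h) = go K n l 2≤n h
    where
    go : ∀ K n l → 2 ≤ n → K + n ≤ 2 * l → K < 2 * l
    go K n l 2≤n h = lin 1 (h ⊕ 2≤n) (solve (K & n & l & []))
  IsLong⇒K<2l {l} (inj₂ (3≤n , _ , h)) = go K n l 3≤n h
    where
    go : ∀ K n l → 3 ≤ n → K + n ≤ 2 * l + 2 → K < 2 * l
    go K n l 3≤n h = lin 0 (h ⊕ 3≤n) (solve (K & n & l & []))

  IsLong⇒K+n≤2l+2 : ∀ {l} → IsLong l → K + n ≤ 2 * l + 2
  IsLong⇒K+n≤2l+2 (inj₁ h) = ≤-trans h (m≤m+n _ 2)
  IsLong⇒K+n≤2l+2 (inj₂ (_ , _ , h)) = h

  n∣K : n ∣ K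
  n∣K = n∣m*n m

  ∣-resp-≈ : x ≈ y → n ∣ y → n ∣ x
  ∣-resp-≈ {x} {y} e n∣y = ∣m+n∣m⇒∣n
    (subst (n ∣_) (≡.trans (sym (multiple-shift e)) (+-comm x _)) (∣m∣n⇒∣m+n n∣y (∣n⇒∣m*n (x / K) n∣K)))
    (∣n⇒∣m*n (y / K) n∣K)

  SumFree⇒ZeroFree : All (1 ≤_) ts → SumFree K n ts → ZeroFree ts
  SumFree⇒ZeroFree pos free p x≈0 = <⇒≱ (free p (∣-trans n∣K (≈0⇒∣ x≈0)))
    (∣⇒≤ {{>-nonZero (≤-trans z<s (count≤SumOf pos p))}} (≈0⇒∣ x≈0))

  total<K : (S : SmoothBy g ts) → ZeroFree ts → total S < K
  total<K {g} S zf = ≰⇒> λ K≤ → multiple≉0 S zf (>-nonZero⁻¹ K) K≤ (∣⇒≈0 (m∣m*n g))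

  -- Without x the coefficients stay complete, so x can be completed to a sum divisible by n.
  head<K : SmoothBy g (x ∷ ts) → All (1 ≤_) (x ∷ ts) → SumFree K n (x ∷ ts) → IsLong (suc (length ts)) → x < K
  head<K {g} {x} {ts} S@(smoothBy (y ∷ ys) (e ∷ es) (1≤y ∷ pos) comp) pos′ free long =
    let c , p = complete-long pos short r r≤
        z , q , f = SmoothBy.coefficient-sum (smoothBy ys es pos (complete-long pos short)) p
    in ≤-<-trans (m≤m+n x z) (free (take q)
         (∣-resp-≈ (≈-trans (≈-sym e ⊞ f) (≈-reflexive (sym (*-distribʳ-+ g y r)))) (∣m⇒∣m*n g n∣y+r)))
    where
    module N = Congruence n
    r : ℕ
    -- The residue of -y modulo `n`. It is below `n`, hence at most the number of the remaining
    -- coefficients, and these are complete.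
    r = y * pred n % n
    n∣y+r : n ∣ y + r
    n∣y+r = N.≈0⇒∣ (N.≈-trans (N.≈-refl N.⊞ N.%-≈ (y * pred n)) (N.∣⇒≈0
      (divides y (≡.trans (sym (*-suc y (pred n))) (cong (y *_) (suc-pred n))))))
    len≡ : length ys ≡ length ts
    len≡ = Pointwise.Pointwise-length es
    short : sum ys < 2 * length ys
    short = subst (λ l → sum ys < 2 * l) (sym len≡)
      (arith y (sum ys) K (length ts) 1≤y (total<K S (SumFree⇒ZeroFree pos′ free)) (IsLong⇒K<2l {suc (length ts)} long))
      where
      arith : ∀ y s K l → 1 ≤ y → y + s < K → K < 2 * suc l → s < 2 * l
      arith y s K l h₁ h₂ h₃ = lin 0 (h₁ ⊕ h₂ ⊕ h₃) (solve (y & s & K & l & []))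
    r≤ : r ≤ sum ys
    r≤ = ≤-trans (s≤s⁻¹ (≤-trans (m%n<n (y * pred n) n) (≤-trans
      (arith n K (length ts) 2≤n 2n≤K (IsLong⇒K+n≤2l+2 {suc (length ts)} long)) (≤-reflexive (cong suc (sym len≡))))))
      (length≤sum pos)
      where
      arith : ∀ n K l → 2 ≤ n → 2 * n ≤ K → K + n ≤ 2 * suc l + 2 → n ≤ suc l
      arith n K l h₁ h₂ h₃ = *-cancelˡ-≤ 2 (lin 0 (h₁ ⊕ h₂ ⊕ h₃) (solve (n & K & l & [])))

  terms<K : SmoothBy g ts → All (1 ≤_) ts → SumFree K n ts → IsLong (length ts) → All (_< K) ts
  terms<K {g} {ts} S pos free long = All.tabulate λ x∈ → let us , σ = ∈⇒↭∷ x∈ in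
    head<K (SmoothBy-↭ σ S) (All-resp-↭ σ pos) (SumFree-↭ σ free) (subst IsLong (↭-length σ) long)

  record OnesFirst (g : ℕ) (ys ts : List ℕ) : Set where
    constructor ones-first
    field
      {v}      : ℕ
      {ys′ ts′} : List ℕ
      perm     : ts ↭ replicate v g ++ ts′
      rest     : Pointwise (λ y t → y * g ≈ t) ys′ ts′
      ≥2       : All (2 ≤_) ys′
      lengths  : v + length ys′ ≡ length ys
      sums     : v + sum ys′ ≡ sum ys

  onesFirst : g < K → All (_< K) ts → Pointwise (λ y t → y * g ≈ t) ys ts → All (1 ≤_) ys → OnesFirst g ys ts
  onesFirst g<K [] [] [] = ones-first refl [] [] refl refl
  onesFirst {g} g<K (t< ∷ ts<) (e ∷ es) (_∷_ {x = y} 1≤y pos) with onesFirst g<K ts< es pos | y ≟ 1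
  ... | ones-first {v} σ pw ≥2 l s | yes refl with refl ← <⇒≈⇒≡ g<K t< (≈-trans (≈-reflexive (sym (+-identityʳ g))) e) =
    ones-first (prep _ σ) pw ≥2 (cong suc l) (cong suc s)
  ... | ones-first {v} {ys′} {ts′} σ pw ≥2 l s | no y≢1 =
    ones-first (trans (prep _ σ) (↭-sym (shift _ (replicate v g) ts′))) (e ∷ pw) (≤∧≢⇒< 1≤y (y≢1 ∘ sym) ∷ ≥2)
      (≡.trans (+-suc v (length ys′)) (cong suc l)) (≡.trans (x∙yz≈y∙xz v y (sum ys′)) (cong (y +_) s))

  twos-sum : All (2 ≤_) ys → 2 * length ys ≤ sum ys
  twos-sum [] = z≤n
  twos-sum {y ∷ ys} (2≤y ∷ ≥2) = ≤-trans (≤-reflexive (*-suc 2 (length ys))) (+-mono-≤ 2≤y (twos-sum ≥2))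

  private
    -- The other coefficients are at least 2 and the total is below K, so without slack there would
    -- be more than `n` ones. With slack 2 the count forces n = v + 1 and a first remaining
    -- coefficient equal to 2, and evenness of K gives v ≥ 3. Then v - 1 copies of g and that one
    -- term have a sum congruent to n g, hence below K; since 2g < K follows, the term is exactly
    -- 2g.
    few-ones : (ys′ ts′ : List ℕ) → ∀ {v} → SumFree K n (replicate v g ++ ts′) → g < K → All (_< K) ts′ →
               Pointwise (λ y t → y * g ≈ t) ys′ ts′ → All (2 ≤_) ys′ → v + sum ys′ < K → v < n →
               IsLong (v + length ys′) → n * g < K
    few-ones {g} ys′ ts′ {v} free g<K ts< pw ≥2 sum<K v<n (inj₁ h) =
      ⊥-elim (arith K n v (length ys′) (sum ys′) h (twos-sum ≥2) sum<K v<n)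
      where
      arith : ∀ K n v l s → K + n ≤ 2 * (v + l) → 2 * l ≤ s → v + s < K → v < n → ⊥
      arith K n v l s h₁ h₂ h₃ h₄ = lin⊥ 1 (h₁ ⊕ h₂ ⊕ h₃ ⊕ h₄) (solve (K & n & v & l & s & []))
    few-ones [] [] {v} free g<K ts< [] [] sum<K v<n (inj₂ (_ , _ , h)) =
      ⊥-elim (arith K n v h 2n≤K v<n 2≤n)
      where
      arith : ∀ K n v → K + n ≤ 2 * (v + 0) + 2 → 2 * n ≤ K → v < n → 2 ≤ n → ⊥
      arith K n v h₁ h₂ h₃ h₄ = lin⊥ 1 (h₁ ⊕ h₂ ⊕ 2 ⊛ h₃ ⊕ h₄) (solve (K & n & v & []))
    few-ones {g} (y ∷ ys′) (x ∷ ts′) {v} free g<K (x<K ∷ _) (e ∷ _) (2≤y ∷ ≥2) sum<K v<n (inj₂ (3≤n , 2∣K , h)) =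
      go v refl n≡ 3≤v
      where
      n≡ : n ≡ suc v
      n≡ = ≤-antisym (arith K n v (length ys′) y (sum ys′) h 2≤y (twos-sum ≥2) sum<K) v<n
        where
        arith : ∀ K n v l y s → K + n ≤ 2 * (v + suc l) + 2 → 2 ≤ y → 2 * l ≤ s → v + (y + s) < K → n ≤ suc v
        arith K n v l y s h₁ h₂ h₃ h₄ = lin 0 (h₁ ⊕ h₂ ⊕ h₃ ⊕ h₄) (solve (K & n & v & l & y & s & []))
      y≡2 : y ≡ 2
      y≡2 = ≤-antisym (arith K v (length ys′) y (sum ys′) (subst (λ n → K + n ≤ 2 * (v + suc (length ys′)) + 2) n≡ h) (twos-sum ≥2) sum<K) 2≤y
        where
        arith : ∀ K v l y s → K + suc v ≤ 2 * (v + suc l) + 2 → 2 * l ≤ s → v + (y + s) < K → y ≤ 2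
        arith K v l y s h₁ h₂ h₃ = lin 0 (h₁ ⊕ h₂ ⊕ h₃) (solve (K & v & l & y & s & []))
      K≡ : K ≡ suc v + suc (length ys′) * 2
      K≡ = ≤-antisym
        (upper K v (length ys′) (subst (λ n → K + n ≤ 2 * (v + suc (length ys′)) + 2) n≡ h))
        (lower K v (length ys′) y (sum ys′) 2≤y (twos-sum ≥2) sum<K)
        where
        upper : ∀ K v l → K + suc v ≤ 2 * (v + suc l) + 2 → K ≤ suc v + suc l * 2
        upper K v l h₁ = lin 0 h₁ (solve (K & v & l & []))
        lower : ∀ K v l y s → 2 ≤ y → 2 * l ≤ s → v + (y + s) < K → suc v + suc l * 2 ≤ K
        lower K v l y s h₁ h₂ h₃ = lin 0 (h₁ ⊕ h₂ ⊕ h₃) (solve (K & v & l & y & s & []))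
      2≤v : 2 ≤ v
      2≤v = s≤s⁻¹ (subst (3 ≤_) n≡ 3≤n)
      2≢v : 2 ≢ v
      2≢v refl = case ∣m+n∣m⇒∣n (subst (2 ∣_) (≡.trans K≡ (+-comm 3 _)) 2∣K) (n∣m*n (suc (length ys′))) of λ where
        (divides zero ())
        (divides (suc zero) ())
        (divides (suc (suc _)) ())
      3≤v : 3 ≤ v
      3≤v = ≤∧≢⇒< 2≤v 2≢v
      go : ∀ w → w ≡ v → n ≡ suc w → 3 ≤ w → n * g < K
      go (suc w) w≡v n≡ (s≤s 2≤w) = subst (_< K) total≡ sum<
        where
        x≈2g : x ≈ 2 * g
        x≈2g = ≈-sym (subst (λ y → y * g ≈ x) y≡2 e)
        n*g≡ : w * g + 2 * g ≡ n * g
        n*g≡ = ≡.trans (sym (*-distribʳ-+ g w 2)) (cong (_* g) (≡.trans (+-comm w 2) (sym n≡)))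
        sum< : w * g + (x + 0) < K
        sum< = free (castCount (replicate-sum (≤-trans (n≤1+n w) (≤-reflexive w≡v)) g ++ˢ take (emptySum ts′)))
          (∣-resp-≈ (≈-trans (≈-refl {x = w * g} ⊞ ≈-trans (≈-reflexive (+-identityʳ x)) x≈2g) (≈-reflexive n*g≡)) (m∣m*n g))
          where
          castCount : ∀ {ts c x} → SumOf ts (c + 1) x → SumOf ts (suc c) x
          castCount {ts} {c} {x} = subst (λ c → SumOf ts c x) (+-comm c 1)
        2g<K : 2 * g < K
        2g<K = ≤-<-trans (≤-trans (*-monoˡ-≤ g 2≤w) (m≤m+n (w * g) _)) sum<
        total≡ : w * g + (x + 0) ≡ n * g
        total≡ = ≡.trans (cong (w * g +_) (≡.trans (+-identityʳ x) (<⇒≈⇒≡ x<K 2g<K x≈2g))) n*g≡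

  -- `n` copies of `g` have a sum divisible by `n`, which sum-freeness keeps below `K`. `few-ones`
  -- treats the case of fewer copies.
  n*g<K : g < K → (S : SmoothBy g ts) → All (1 ≤_) ts → SumFree K n ts → IsLong (length ts) → n * g < K
  n*g<K {g} {ts} g<K S pos free long with terms<K S pos free long
  ... | ts<K with onesFirst g<K ts<K (SmoothBy.multiples S) (SmoothBy.positive S)
  ... | ones-first {v} {ys′} {ts′} σ pw ≥2 l s with n ≤? v
  ...   | yes n≤v = free′ (castCount 2≤n (inject₁ ts′ (replicate-sum n≤v g))) (m∣m*n g)
    where
    free′ : SumFree K n (replicate v g ++ ts′)
    free′ = SumFree-↭ σ free
    castCount : ∀ {ts n x} → 2 ≤ n → SumOf ts n x → SumOf ts (suc (pred n)) x
    castCount (s≤s _) p = p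
  ...   | no n≰v = few-ones ys′ ts′ (SumFree-↭ σ free) g<K (All.++⁻ʳ (replicate v g) (All-resp-↭ σ ts<K)) pw ≥2
    (subst (_< K) (sym s) (total<K S (SumFree⇒ZeroFree pos free))) (≰⇒> n≰v)
    (subst IsLong (sym (≡.trans l (Pointwise.Pointwise-length (SmoothBy.multiples S)))) long)

  -- An index x < K with x ≈ y g is equal to y g exactly if y is low.
  data Split (g : ℕ) : List ℕ → List ℕ → List ℕ → Set where
    []   : Split g [] [] []
    low  : ∀ {ys ls hs} → y * g < K → Split g ys ls hs → Split g (y ∷ ys) (y ∷ ls) hs
    high : ∀ {ys ls hs} → K < y * g → Split g ys ls hs → Split g (y ∷ ys) ls (y ∷ hs)

  private
    variable
      ls hs : List ℕ

  split : All (λ y → y * g ≢ K) ys → ∃₂ λ ls hs → Split g ys ls hs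
  split [] = [] , [] , []
  split {g} {y ∷ ys} (y*g≢K ∷ all) with split all | <-cmp (y * g) K
  ... | ls , hs , s | tri< y*g<K _ _ = y ∷ ls , hs , low y*g<K s
  ... | ls , hs , s | tri≈ _ y*g≡K _ = contradiction y*g≡K y*g≢K
  ... | ls , hs , s | tri> _ _ K<y*g = ls , y ∷ hs , high K<y*g s

  Split-length : Split g ys ls hs → length ls + length hs ≡ length ys
  Split-length [] = refl
  Split-length (low _ s) = cong suc (Split-length s)
  Split-length (high _ s) = ≡.trans (+-suc _ _) (cong suc (Split-length s))

  Split-sum : Split g ys ls hs → sum ls + sum hs ≡ sum ys
  Split-sum [] = refl
  Split-sum (low {y} _ s) = ≡.trans (+-assoc y _ _) (cong (y +_) (Split-sum s))
  Split-sum (high {y} {ls = ls} {hs} _ s) = ≡.trans (x∙yz≈y∙xz (sum ls) y (sum hs)) (cong (y +_) (Split-sum s))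

  Split-low : ∀ {P : ℕ → Set} → Split g ys ls hs → All P ys → All P ls
  Split-low [] [] = []
  Split-low (low _ s) (p ∷ ps) = p ∷ Split-low s ps
  Split-low (high _ s) (_ ∷ ps) = Split-low s ps

  Split-high : Split g ys ls hs → All (λ y → K < y * g) hs
  Split-high [] = []
  Split-high (low _ s) = Split-high s
  Split-high (high h s) = h ∷ Split-high s

  low-sum : Split g ys ls hs → j * g < K → SumOf ys c j → SumOf ls c j
  low-sum [] _ nil = nil
  low-sum (low _ s) j< (skip p) = skip (low-sum s j< p)
  low-sum {g} (low {y} _ s) j< (take {x = x} p) = take (low-sum s (≤-<-trans (*-monoˡ-≤ g (m≤n+m x y)) j<) p)
  low-sum (high _ s) j< (skip p) = low-sum s j< p
  low-sum {g} (high {y} K< s) j< (take {x = x} p) = contradiction (<-trans K< (≤-<-trans (*-monoˡ-≤ g (m≤m+n y x)) j<)) (<-irrefl refl)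

  index-sum : Split g ys ls hs → All (_< K) ts → Pointwise (λ y t → y * g ≈ t) ys ts → SumOf ls c j → SumOf ts c (j * g)
  index-sum [] [] [] nil = nil
  index-sum (high _ s) (_ ∷ ts<) (_ ∷ es) p = skip (index-sum s ts< es p)
  index-sum (low _ s) (_ ∷ ts<) (_ ∷ es) (skip p) = skip (index-sum s ts< es p)
  index-sum {g} (low y< s) (t< ∷ ts<) (e ∷ es) (take {x = x} {a = y} p) with refl ← <⇒≈⇒≡ y< t< e =
    castSum (sym (*-distribʳ-+ g y x)) (take (index-sum s ts< es p))

  private
    high-sum : ∀ {θ} → All (θ <_) hs → length hs * suc θ ≤ sum hs
    high-sum [] = z≤n
    high-sum (θ< ∷ all) = +-mono-≤ θ< (high-sum all)

  module _ (S : SmoothBy g ts) (pos : All (1 ≤_) ts) (free : SumFree K n ts) (long : IsLong (length ts))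
           (2≤g : 2 ≤ g) (g<K : g < K) where

    private
      open SmoothBy S using (coefficients; complete) renaming (multiples to congruences; positive to coefficients≥1)

      zf : ZeroFree ts
      zf = SumFree⇒ZeroFree pos free

      order : ∀ {j} → 1 ≤ j → j * g ≈ 0 → K ≤ j
      order = smooth-order-long S zf (<⇒≤ (IsLong⇒K<2l {length ts} long))

      below-order : j ≤ total S → j * g ≢ K
      below-order {zero} _ 0≡K = ≢-nonZero⁻¹ K (sym 0≡K)
      below-order {suc j} j≤ e = <⇒≱ (≤-<-trans j≤ (total<K S zf)) (order z<s (∣⇒≈0 (subst (K ∣_) (sym e) (divides 1 (sym (+-identityʳ K))))))

      coefficient≤ : All (_≤ total S) coefficients
      coefficient≤ = All.tabulate λ y∈ → SumOf≤sum (member y∈)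

      parts : ∃₂ λ ls hs → Split g coefficients ls hs
      parts = split (All.map below-order coefficient≤)

      ls₀ hs₀ : List ℕ
      ls₀ = proj₁ parts
      hs₀ = proj₁ (proj₂ parts)

      s : Split g coefficients ls₀ hs₀
      s = proj₂ (proj₂ parts)

      M q r : ℕ
      M = sum ls₀
      q = M / n
      r = M % n

      M≤total : M ≤ total S
      M≤total = ≤-trans (m≤m+n M (sum hs₀)) (≤-reflexive (Split-sum s))

      ng<K : n * g < K
      ng<K = n*g<K g<K S pos free long

      -- Removing coefficients of sum r from the low ones leaves low coefficients of sum q n. Their
      -- indices add up exactly to q n g, a multiple of n, so sum-freeness gives q n g < K = m n.
      -- Only low coefficients are involved in reaching r because r g ≤ n g < K.
      qg<m : q * g < m
      qg<m = *-cancelʳ-< n (q * g) m (subst (_< K) (rearrange q n g) qng<K)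
        where
        rearrange : ∀ q n g → q * n * g ≡ q * g * n
        rearrange q n g = solve (q & n & g & [])
        index : ∀ {c z} → SumOf ts c z → n ∣ z → z < K
        index {zero} p _ = ≤-<-trans (≤-reflexive (zeroTerms p)) (>-nonZero⁻¹ K)
        index {suc c} p n∣z = free p n∣z
        qng<K : q * n * g < K
        qng<K with _ , p ← complete r (≤-trans (m%n≤m M n) M≤total)
          with complement-of {total = t} p′ _ r+t≡M ← complement (low-sum s (≤-<-trans (*-monoˡ-≤ g (<⇒≤ (m%n<n M n))) ng<K) p)
          with refl ← +-cancelˡ-≡ r t (q * n) (≡.trans r+t≡M (m≡m%n+[m/n]*n M n)) =
          index (index-sum s (terms<K S pos free long) congruences p′) (∣m⇒∣m*n g (n∣m*n q))

      -- A high coefficient exceeds θ = ⌊K / g⌋. If there is one, the low ones add up to at least θ,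
      -- since θ is a sum of coefficients and θ g < K admits only low ones. A total below K then
      -- leaves room for at most g - 2 high coefficients, and there are at most M low ones.
      length≤M : length ts + 2 ≤ M + g
      length≤M = subst (λ l → l + 2 ≤ M + g)
        (≡.trans (Split-length s) (Pointwise.Pointwise-length congruences))
        (go hs₀ (Split-high s) (Split-sum s))
        where
        instance
          g-nonZero : NonZero g
          g-nonZero = >-nonZero (≤-trans z<s 2≤g)
        θ : ℕ
        θ = K / g
        K<θ+1 : K < suc θ * g
        K<θ+1 = ≤-<-trans (≤-reflexive (m≡m%n+[m/n]*n K g)) (+-monoˡ-< (θ * g) (m%n<n K g))
        few : ∀ β B → θ ≤ M → β * suc θ ≤ B → M + B < K → suc β < g
        few β B θ≤M β≤B total< = ≰⇒> λ g≤ → arith K g (suc β * suc θ) (≤-trans z<s 2≤g)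
          (≤-trans (+-mono-≤ (s≤s θ≤M) β≤B) total<)
          (≤-trans (*-monoˡ-≤ (suc K) g≤) (≤-trans (*-monoʳ-≤ (suc β) K<θ+1) (≤-reflexive (sym (*-assoc (suc β) (suc θ) g)))))
          where
          arith : ∀ K g x → 1 ≤ g → x ≤ K → g * suc K ≤ x * g → ⊥
          arith K g x 1≤g x≤K h = <⇒≱ 1≤g (cancel K g (≤-trans h (*-monoˡ-≤ g x≤K)))
            where
            cancel : ∀ K g → g * suc K ≤ K * g → g ≤ 0
            cancel K g h = lin 0 h (solve (K & g & []))
        go : ∀ hs → All (λ y → K < y * g) hs → M + sum hs ≡ total S → length ls₀ + length hs + 2 ≤ M + g
        go [] _ _ = +-mono-≤ (≤-trans (≤-reflexive (+-identityʳ _)) (length≤sum (Split-low s coefficients≥1))) 2≤g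
        go hs@(h ∷ hs′) hs> M+B≡ = arith (length ls₀) (length hs) M g (length≤sum (Split-low s coefficients≥1))
          (few (length hs) (sum hs) θ≤M (high-sum (All.map above hs>)) (subst (_< K) (sym M+B≡) (total<K S zf)))
          where
          arith : ∀ l β M g → l ≤ M → suc β < g → l + β + 2 ≤ M + g
          arith l β M g h₁ h₂ = lin 0 (h₁ ⊕ h₂) (solve (l & β & M & g & []))
          above : ∀ {y} → K < y * g → θ < y
          above K< = *-cancelʳ-< g θ _ (≤-<-trans (m/n*n≤m K g) K<)
          θ≤total : θ ≤ total S
          θ≤total = <⇒≤ (<-≤-trans (above (All.head hs>)) (≤-trans (m≤m+n h (sum hs′)) (≤-trans (m≤n+m (sum hs) M) (≤-reflexive M+B≡))))
          θ≤M : θ ≤ M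
          θ≤M = let _ , p = complete θ θ≤total in
            SumOf≤sum (low-sum s (≤∧≢⇒< (m/n*n≤m K g) (below-order θ≤total)) p)

      g<m : g < m
      g<m = *-cancelʳ-< n g m (subst (_< K) (*-comm n g) ng<K)

      bound : ∀ l → l + 2 ≤ M + g → ∀ {d} → m * n + n ≤ 2 * l + d → m * n + 6 ≤ n + 2 * (q * n) + 2 * g + d
      bound l h₁ {d} h₂ = arith (m * n) n l d M g r (q * n) h₁ (m%n<n M n) (≤-reflexive (m≡m%n+[m/n]*n M n)) h₂
        where
        arith : ∀ K n l d M g r t → l + 2 ≤ M + g → r < n → M ≤ r + t → K + n ≤ 2 * l + d → K + 6 ≤ n + 2 * t + 2 * g + d
        arith K n l d M g r t h₁ h₂ h₃ h₄ = lin 0 (2 ⊛ h₁ ⊕ 2 ⊛ h₂ ⊕ 2 ⊛ h₃ ⊕ h₄) (solve (K & n & l & d & M & g & r & t & []))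

    -- By `qg<m`, K ≥ n + (q n) g. For q ≥ 1 the estimate `bound` becomes (q n - 2)(g - 2) ≤ d - 2
    -- with slack d = 0 or 2. This fails for d = 0 because q n and g are at least 2, and for d = 2
    -- because both are at least 3. The condition on `a` in `case-suc` is (a - 2)² > d - 2.
    generator-small : ⊥
    generator-small = go q qg<m long bound
      where
      case-zero : ∀ d → d ≤ 2 → m * n + 6 ≤ n + 2 * (0 * n) + 2 * g + d → ⊥
      case-zero d d≤2 h = arith m n g d 2≤n (*-monoˡ-≤ n g<m) (*-monoʳ-≤ g 2≤n) d≤2 h
        where
        arith : ∀ m n g d → 2 ≤ n → suc g * n ≤ m * n → g * 2 ≤ g * n → d ≤ 2 → m * n + 6 ≤ n + 2 * (0 * n) + 2 * g + d → ⊥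
        arith m n g d _ h₁ h₂ h₃ h₄ = lin⊥ 3 (h₁ ⊕ h₂ ⊕ h₃ ⊕ h₄) (solve (m & n & g & d & []))
      case-suc : ∀ q d a → q * g < m → a ≤ q * n → a ≤ g → m * n + 6 ≤ n + 2 * (q * n) + 2 * g + d →
                 4 * a + d < 6 + a * a → 2 ≤ a → ⊥
      case-suc q d a qg<m a≤qn a≤g h small 2≤a
        with t , e ← excess a≤qn | f , e′ ← excess a≤g | a′ , refl ← excess 2≤a =
        arith a′ t f d (m * n) n (≤-trans (≤-reflexive area) (*-monoˡ-≤ n qg<m))
          (subst₂ (λ x y → m * n + 6 ≤ n + 2 * x + 2 * y + d) (sym e) (sym e′) h) small
        where
        area : n + (2 + a′ + t) * (2 + a′ + f) ≡ suc (q * g) * n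
        area = ≡.trans (cong₂ (λ x y → n + x * y) e e′) (rearrange n q g)
          where
          rearrange : ∀ n q g → n + q * n * g ≡ suc (q * g) * n
          rearrange n q g = solve (n & q & g & [])
        arith : ∀ a t f d K n → n + (2 + a + t) * (2 + a + f) ≤ K → K + 6 ≤ n + 2 * (2 + a + t) + 2 * (2 + a + f) + d →
                4 * (2 + a) + d < 6 + (2 + a) * (2 + a) → ⊥
        arith a t f d K n h₁ h₂ h₃ = lin⊥ (a * t + a * f + t * f) (h₁ ⊕ h₂ ⊕ h₃) (solve (a & t & f & d & K & n & []))
      go : ∀ q → q * g < m → IsLong (length ts) →
           (∀ l → l + 2 ≤ M + g → ∀ {d} → m * n + n ≤ 2 * l + d → m * n + 6 ≤ n + 2 * (q * n) + 2 * g + d) → ⊥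
      go zero _ (inj₁ h) bound = case-zero 0 z≤n (bound (length ts) length≤M (≤-trans h (m≤m+n _ 0)))
      go zero _ (inj₂ (_ , _ , h)) bound = case-zero 2 ≤-refl (bound (length ts) length≤M h)
      go (suc q) qg<m (inj₁ h) bound = case-suc (suc q) 0 2 qg<m (≤-trans 2≤n (m≤m+n n _)) 2≤g
        (bound (length ts) length≤M (≤-trans h (m≤m+n _ 0))) (s≤s (m≤m+n 8 1)) ≤-refl
      go (suc q) qg<m (inj₂ (3≤n , 2∣K , h)) bound = case-suc (suc q) 2 3 qg<m (≤-trans 3≤n (m≤m+n n _)) 3≤g
        (bound (length ts) length≤M h) (≤-refl {15}) (s≤s z<s)
        where
        -- For g = 2 and even K, (K / 2) g ≈ 0 would contradict the order of g.
        3≤g : 3 ≤ g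
        3≤g = ≤∧≢⇒< 2≤g λ 2≡g → even-impossible 2≡g 2∣K
          where
          even-impossible : 2 ≡ g → 2 ∣ K → ⊥
          even-impossible 2≡g (divides zero K≡) = ≢-nonZero⁻¹ K K≡
          even-impossible 2≡g (divides (suc h) K≡) = <⇒≱ (subst (suc h <_) (sym K≡) (s≤s (s≤s (m≤m*n h 2))))
            (order {suc h} z<s (∣⇒≈0 (subst (λ g → K ∣ suc h * g) 2≡g (divides 1 (≡.trans (sym K≡) (sym (+-identityʳ K)))))))

  complete-of-sum-free : All (1 ≤_) ts → SumFree K n ts → IsLong (length ts) → Complete ts
  complete-of-sum-free {ts} pos free long with long-zero-free (IsLong⇒K<2l {length ts} long) (SumFree⇒ZeroFree pos free)
  ... | g₀ , smoothBy ys es ys≥1 comp = by-generator (g₀ % K) refl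
    where
    S : SmoothBy (g₀ % K) ts
    S = smoothBy ys (Pointwise.map (λ {y} e → ≈-trans (y ⊠ %-≈ g₀) e) es) ys≥1 comp
    zf : ZeroFree ts
    zf = SumFree⇒ZeroFree pos free
    by-generator : ∀ g → g₀ % K ≡ g → Complete ts
    by-generator zero g≡ = contradiction
      (smooth-order-long S zf (<⇒≤ (IsLong⇒K<2l {length ts} long)) {1} ≤-refl (≈-reflexive (≡.trans (+-identityʳ _) g≡)))
      (<⇒≱ (≤-trans 2≤n n≤K))
    -- With generator 1 a coefficient and its index are congruent and both below `K`, so they
    -- coincide.
    by-generator (suc zero) g≡ = subst Complete (Pointwise.Pointwise-≡⇒≡ (unit coefficient<K (terms<K S pos free long) (SmoothBy.multiples S))) comp
      where
      coefficient<K : All (_< K) ys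
      coefficient<K = All.tabulate λ y∈ → ≤-<-trans (SumOf≤sum (member y∈)) (total<K S zf)
      unit : ∀ {ys ts} → All (_< K) ys → All (_< K) ts → Pointwise (λ y t → y * (g₀ % K) ≈ t) ys ts → Pointwise _≡_ ys ts
      unit [] [] [] = []
      unit {y ∷ _} (y< ∷ ys<) (t< ∷ ts<) (e ∷ es) =
        <⇒≈⇒≡ y< t< (≈-trans (≈-reflexive (sym (≡.trans (cong (y *_) g≡) (*-identityʳ y)))) e) ∷ unit ys< ts< es
    by-generator (suc (suc g)) g≡ = ⊥-elim
      (generator-small S pos free long (subst (2 ≤_) (sym g≡) (s≤s z<s)) (m%n<n g₀ K))

-- Minimal sequences and the bounds they inherit

-- `κ` stands for the least multiple of `n` that is at least k. Divisibility by `n` and size at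
-- least `κ` together express that a sum is idempotent.
Minimal : ℕ → ℕ → List ℕ → Set
Minimal κ n ts = n ∣ sum ts × κ ≤ sum ts × (∀ {c x} → SumOf ts (suc c) x → suc c < length ts → n ∣ x → x < κ)

Minimal-↭ : ts ↭ us → Minimal κ n ts → Minimal κ n us
Minimal-↭ {κ = κ} {n} σ (n∣ , κ≤ , proper) =
  subst (n ∣_) (sum-↭ σ) n∣ , subst (κ ≤_) (sum-↭ σ) κ≤ ,
  λ p c< → proper (SumOf-↭ (↭-sym σ) p) (subst (_ <_) (sym (↭-length σ)) c<)

Minimal⇒tail-free : Minimal κ n (a ∷ ts) → SumFree κ n ts
Minimal⇒tail-free (_ , _ , proper) p = proper (skip p) (s≤s (SumOf-count≤ p))

one-from-sum : SumOf ts c y → y ≡ 1 → ∃[ us ] ts ↭ 1 ∷ us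
one-from-sum (skip p) e = let us , σ = one-from-sum p e in _ , trans (prep _ σ) (swap _ _ refl)
one-from-sum (take {a = zero} p) e = let us , σ = one-from-sum p e in _ , trans (prep _ σ) (swap _ _ refl)
one-from-sum (take {a = suc zero} p) e = _ , refl

Bounded : ℕ → List ℕ → Set
Bounded B = All (λ t → 1 ≤ t × t ≤ B)

positive-terms : Bounded B ts → All (1 ≤_) ts
positive-terms = All.map proj₁

FreeComplete MinimalComplete : (B κ n l : ℕ) → Set
FreeComplete B κ n l = ∀ ts → Bounded B ts → SumFree κ n ts → l ≤ length ts → Complete ts
MinimalComplete B κ n l = ∀ ts → Bounded B ts → Minimal κ n ts → l ≤ length ts → Complete ts

-- Removing any term shows that T contains 1; removing this 1 shows that the rest is complete.
free⇒minimal : 1 ≤ l → FreeComplete B κ n l → MinimalComplete B κ n (suc l)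
free⇒minimal {l} 1≤l free (a ∷ ts) bd@((1≤a , a≤B) ∷ bd′) min (s≤s l≤) =
  let comp = free ts bd′ (Minimal⇒tail-free min) l≤
      _ , p = comp 1 (≤-trans (≤-trans 1≤l l≤) (length≤sum (positive-terms bd′)))
      us , σ = one-from-sum p refl
      τ = trans (prep a σ) (swap a 1 refl)
      rest = free (a ∷ us) (All.tail (All-resp-↭ τ bd)) (Minimal⇒tail-free (Minimal-↭ τ min))
               (≤-trans l≤ (≤-reflexive (↭-length σ)))
  in Complete-↭ (↭-sym τ) (complete-∷ {y = 1} rest z<s)

-- For period 1 every sum is divisible, so the total itself is below `κ` and `complete-long`
-- applies.
free-upper-one : 1 ≤ l → κ ≤ 2 * l → FreeComplete B κ 1 l
free-upper-one 1≤l κ≤ [] bd free l≤ = complete-[]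
free-upper-one 1≤l κ≤ ts@(_ ∷ _) bd free l≤ = complete-long (positive-terms bd)
  (<-≤-trans (free (fullSum ts) (1∣ _)) (≤-trans κ≤ (*-monoʳ-≤ 2 l≤)))

free-upper : ∀ m n .{{_ : NonZero n}} (2≤m : 2 ≤ m) (2≤n : 2 ≤ n) →
             (m * n + n ≤ 2 * l) ⊎ (3 ≤ n × 2 ∣ m * n × m * n + n ≤ 2 * l + 2) → FreeComplete B (m * n) n l
free-upper m n 2≤m 2≤n long ts bd free l≤ =
  Long.complete-of-sum-free m n 2≤m 2≤n (positive-terms bd) free
    ([ (λ h → inj₁ (≤-trans h (*-monoʳ-≤ 2 l≤)))
     , (λ (3≤n , 2∣κ , h) → inj₂ (3≤n , 2∣κ , ≤-trans h (+-monoˡ-≤ 2 (*-monoʳ-≤ 2 l≤)))) ]′ long)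

-- Minimal sequences of period two

module PeriodTwo {K : ℕ} (2∣K : 2 ∣ K) (4≤K : 4 ≤ K) where

  even-step : 2 ∣ x → x < K → 2 + x ≤ K
  even-step 2∣x x<K = go 2∣x 2∣K x<K
    where
    go : ∀ {K} → 2 ∣ x → 2 ∣ K → x < K → 2 + x ≤ K
    go (divides q refl) (divides r refl) x<K = *-monoˡ-≤ 2 (*-cancelʳ-< 2 q r x<K)

  -- The complement of a subsequence of sum 2 is proper and has an even sum below K, hence at most K
  -- - 2. So the whole sum is at most K, which is less than twice the length.
  sum-two : All (1 ≤_) ts → Minimal K 2 ts → K + 2 ≤ 2 * length ts → SumOf ts c 2 → Complete ts
  sum-two {c = zero} _ _ _ p = contradiction (zeroTerms p) λ ()
  sum-two {ts} {suc c} pos (2∣ , K≤ , proper) long p with complement p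
  ... | complement-of {zero} q e f = ⊥-elim (arith (length ts) c K e (count≤SumOf pos p) 4≤K long)
    where
    arith : ∀ l c K → suc c + 0 ≡ l → suc c ≤ 2 → 4 ≤ K → K + 2 ≤ 2 * l → ⊥
    arith _ c K refl h₁ h₂ h₃ = lin⊥ 1 (2 ⊛ h₁ ⊕ h₂ ⊕ h₃) (solve (c & K & []))
  ... | complement-of {suc d} {t} q e f = complete-long pos (≤-trans (s≤s (subst (_≤ K) f
      (even-step (∣m+n∣m⇒∣n (subst (2 ∣_) (sym f) 2∣) (divides 1 refl))
        (proper q (≤-trans (s≤s (m≤n+m (suc d) c)) (≤-reflexive e)) (∣m+n∣m⇒∣n (subst (2 ∣_) (sym f) 2∣) (divides 1 refl))))))
      (≤-trans (arith K) long))
    where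
    arith : ∀ K → suc K ≤ K + 2
    arith K = lin 1 (z≤n {0}) (solve (K & []))

  odd-parity : All (λ t → ¬ 2 ∣ t) ts → 2 ∣ sum ts + length ts
  odd-parity [] = divides 0 refl
  odd-parity {t ∷ ts} (odd ∷ odds) = subst (2 ∣_) (arith t (sum ts) (length ts)) (∣m∣n⇒∣m+n (suc-even t odd) (odd-parity odds))
    where
    arith : ∀ t s l → suc t + (s + l) ≡ t + s + suc l
    arith t s l = solve (t & s & l & [])
    suc-even : ∀ t → ¬ 2 ∣ t → 2 ∣ suc t
    suc-even zero odd = contradiction (divides 0 refl) odd
    suc-even (suc zero) odd = divides 1 refl
    suc-even (suc (suc t)) odd = ∣m∣n⇒∣m+n (divides 1 refl) (suc-even t λ 2∣t → odd (∣m∣n⇒∣m+n (divides 1 refl) 2∣t))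

  odd-one : All (λ t → ¬ 2 ∣ t) ts → 2 ≤ length ts → sum ts ≤ suc (2 * length ts) → ∃[ us ] ts ↭ 1 ∷ us
  odd-one {ts} odds 2≤ sum≤ with find-other (λ t → ¬? (t ≟ 1)) ts
  ... | inj₂ (x , us , x≡1 , σ) with x ≟ 1
  ...   | yes refl = us , σ
  ...   | no x≢1 = contradiction x≢1 x≡1
  odd-one {ts} odds 2≤ sum≤ | inj₁ ≢1 = ⊥-elim (arith (sum ts) (length ts) (threes odds ≢1) 2≤ sum≤)
    where
    arith : ∀ s l → 3 * l ≤ s → 2 ≤ l → s ≤ suc (2 * l) → ⊥
    arith s l h₁ h₂ h₃ = lin⊥ 0 (h₁ ⊕ h₂ ⊕ h₃) (solve (s & l & []))
    threes : ∀ {ts} → All (λ t → ¬ 2 ∣ t) ts → All (_≢ 1) ts → 3 * length ts ≤ sum ts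
    threes [] [] = z≤n
    threes {zero ∷ ts} (odd ∷ _) _ = contradiction (divides 0 refl) odd
    threes {1 ∷ ts} _ (≢1 ∷ _) = contradiction refl ≢1
    threes {2 ∷ ts} (odd ∷ _) _ = contradiction (divides 1 refl) odd
    threes {suc (suc (suc t)) ∷ ts} (_ ∷ odds) (_ ∷ ≢1) =
      ≤-trans (≤-reflexive (*-suc 3 (length ts))) (+-mono-≤ (s≤s (s≤s z<s)) (threes odds ≢1))

  -- Without two odd terms the sum is still even and therefore below K. This is too small for the
  -- remaining odd terms all to be at least 3.
  third-one : ∀ a b us → All (λ t → ¬ 2 ∣ t) (a ∷ b ∷ us) → Minimal K 2 (a ∷ b ∷ us) →
              K + 2 ≤ 2 * (2 + length us) → ∃[ vs ] us ↭ 1 ∷ vs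
  third-one a b us (odd-a ∷ odd-b ∷ odds) (2∣ , _ , proper) long = odd-one odds 2≤len
    (arith (sum us) K (length us) long (full<K us 2≤len even proper))
    where
    arith : ∀ s K l → K + 2 ≤ 2 * (2 + l) → s < K → s ≤ suc (2 * l)
    arith s K l h₁ h₂ = lin 0 (h₁ ⊕ h₂) (solve (s & K & l & []))
    2∣length : 2 ∣ 2 + length us
    2∣length = ∣m+n∣m⇒∣n (odd-parity (odd-a ∷ odd-b ∷ odds)) 2∣
    2≤len : 2 ≤ length us
    2≤len = two≤ (length us) 2∣length long
      where
      two≤ : ∀ l → 2 ∣ 2 + l → K + 2 ≤ 2 * (2 + l) → 2 ≤ l
      two≤ 0 _ h = contradiction (≤-trans (+-monoˡ-≤ 2 4≤K) h) λ { (s≤s (s≤s (s≤s (s≤s ())))) }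
      two≤ 1 (divides zero ())
      two≤ 1 (divides (suc zero) ())
      two≤ 1 (divides (suc (suc _)) ())
      two≤ (suc (suc _)) _ _ = s≤s z<s
    even : 2 ∣ sum us
    even = ∣m+n∣m⇒∣n {m = a + b} (subst (2 ∣_) (sym (+-assoc a b (sum us))) 2∣) (∣m+n∣m⇒∣n
      (subst (2 ∣_) (arith′ a b) (odd-parity (odd-a ∷ odd-b ∷ []))) (divides 1 refl))
      where
      arith′ : ∀ a b → a + (b + 0) + 2 ≡ 2 + (a + b)
      arith′ a b = solve (a & b & [])
    full<K : ∀ us → 2 ≤ length us → 2 ∣ sum us →
             (∀ {c x} → SumOf (a ∷ b ∷ us) (suc c) x → suc c < 2 + length us → 2 ∣ x → x < K) → sum us < K
    full<K us@(_ ∷ _) _ even proper = proper (skip (skip (fullSum us))) (n≤1+n _) even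

  -- Everything reduces to finding a subsequence of sum 2. Beside an even term, the rest has an even
  -- sum below K and is complete. If all terms are odd, `third-one` is applied twice, the second
  -- time with the 1 already found among the two dropped terms, so that two different 1's appear.
  minimal-upper-two : K + 2 ≤ 2 * l → MinimalComplete B K 2 l
  minimal-upper-two {l} l-long ts bd min l≤ with find-other (λ t → ¬? (2 ∣? t)) ts
  ... | inj₂ (e , us , ¬odd , σ) with 2 ∣? e
  ...   | no odd = contradiction odd ¬odd
  ...   | yes 2∣e = Complete-↭ (↭-sym σ) (sum-two pos min′ long (skip (proj₂ (complete-us 2 (≤-trans 2≤len (length≤sum (All.tail pos)))))))
    where
    pos : All (1 ≤_) (e ∷ us)
    pos = All-resp-↭ σ (positive-terms bd)
    min′ : Minimal K 2 (e ∷ us)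
    min′ = Minimal-↭ σ min
    long : K + 2 ≤ 2 * suc (length us)
    long = ≤-trans l-long (*-monoʳ-≤ 2 (≤-trans l≤ (≤-reflexive (↭-length σ))))
    2≤len : 2 ≤ length us
    2≤len = arith K (length us) 4≤K long
      where
      arith : ∀ K l → 4 ≤ K → K + 2 ≤ 2 * suc l → 2 ≤ l
      arith K l h₁ h₂ = *-cancelˡ-≤ 2 (lin 0 (h₁ ⊕ h₂) (solve (K & l & [])))
    full<K : ∀ us → 2 ≤ length us → Minimal K 2 (e ∷ us) → sum us < K
    full<K us@(_ ∷ _) _ (2∣ , _ , proper) = proper (skip (fullSum us)) ≤-refl (∣m+n∣m⇒∣n 2∣ 2∣e)
    complete-us : Complete us
    complete-us = complete-long (All.tail pos) (arith K (length us) (sum us) long (full<K us 2≤len min′))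
      where
      arith : ∀ K l s → K + 2 ≤ 2 * suc l → s < K → s < 2 * l
      arith K l s h₁ h₂ = lin 0 (h₁ ⊕ h₂) (solve (K & l & s & []))
  minimal-upper-two {l} l-long ts bd min l≤ | inj₁ odds = go ts odds bd min (≤-trans l-long (*-monoʳ-≤ 2 l≤))
    where
    go : ∀ ts → All (λ t → ¬ 2 ∣ t) ts → Bounded B ts → Minimal K 2 ts → K + 2 ≤ 2 * length ts → Complete ts
    go [] _ _ _ _ = complete-[]
    go (a ∷ []) _ _ _ h = contradiction (≤-trans (+-monoˡ-≤ 2 4≤K) h) λ { (s≤s (s≤s ())) }
    go (a ∷ b ∷ us) odds bd min long =
      let vs , σ = third-one a b us odds min long
          τ = trans (prep a (trans (prep b σ) (swap b 1 refl))) (swap a 1 refl)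
          len≡ = cong (2 +_) (↭-length σ)
          ws , σ′ = third-one 1 a (b ∷ vs) (All-resp-↭ τ odds) (Minimal-↭ τ min) (subst (λ l → K + 2 ≤ 2 * l) len≡ long)
          π = trans τ (prep 1 (prep a σ′))
      in Complete-↭ (↭-sym π) (sum-two (All-resp-↭ π (positive-terms bd)) (Minimal-↭ π min)
           (≤-trans long (*-monoʳ-≤ 2 (≤-reflexive (↭-length π)))) (take (skip (take (emptySum ws)))))

-- Lower bounds from sequences of twos

replicate-two-sum : ∀ p → SumOf (replicate p 2) c x → x ≡ c * 2 × c ≤ p
replicate-two-sum zero nil = refl , z≤n
replicate-two-sum (suc p) (skip q) = let e , c≤ = replicate-two-sum p q in e , m≤n⇒m≤1+n c≤
replicate-two-sum (suc p) (take q) = let e , c≤ = replicate-two-sum p q in cong (2 +_) e , s≤s c≤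

sum-replicate-two : ∀ p → sum (replicate p 2) ≡ p * 2
sum-replicate-two zero = refl
sum-replicate-two (suc p) = cong (2 +_) (sum-replicate-two p)

no-sum-one : All (2 ≤_) ts → y ≡ 1 → ¬ SumOf ts c y
no-sum-one (_ ∷ ≥2) e (skip p) = no-sum-one ≥2 e p
no-sum-one {a ∷ _} (2≤a ∷ _) e (take p) = contradiction (≤-trans 2≤a (≤-trans (m≤m+n a _) (≤-reflexive e))) λ { (s≤s ()) }

incomplete : All (2 ≤_) ts → 1 ≤ length ts → ¬ Complete ts
incomplete {ts} ≥2 1≤l comp = no-sum-one ≥2 refl
  (proj₂ (comp 1 (≤-trans 1≤l (length≤sum (All.map (≤-trans z<s) ≥2)))))

multiple-between : n ∣ κ → n ∣ x → κ ≤ x → x < κ + n → x ≡ κ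
multiple-between {n} {κ} n∣κ n∣x κ≤x x< with excess κ≤x
... | zero , e = ≡.trans (sym e) (+-identityʳ κ)
... | suc d , refl = contradiction (∣⇒≤ (∣m+n∣m⇒∣n n∣x n∣κ)) (<⇒≱ (+-cancelˡ-< κ (suc d) n x<))

-- The only multiple of `n` from `κ` up to the total is `κ`, which is odd.
twos-free : n ∣ κ → ¬ 2 ∣ κ → p * 2 < κ + n → SumFree κ n (replicate p 2)
twos-free {p = p} n∣κ odd p< {c} q n∣x = ≰⇒> λ κ≤x → let e , c≤ = replicate-two-sum p q in
  odd (divides (suc c) (≡.trans (sym (multiple-between n∣κ n∣x κ≤x (≤-<-trans (≤-trans (≤-reflexive e) (*-monoˡ-≤ 2 c≤)) p<))) e))

few-twos-free : p * 2 < κ → SumFree κ n (replicate p 2)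
few-twos-free {p} p< q _ = let e , c≤ = replicate-two-sum p q in ≤-<-trans (≤-trans (≤-reflexive e) (*-monoˡ-≤ 2 c≤)) p<

-- The total is κ + 1, so only the value κ has to be avoided. It is even, while sums with the 3 are
-- odd, and the twos alone reach only κ - 2.
three-twos-free : n ∣ κ → 2 ≤ n → 2 + p * 2 ≡ κ → SumFree κ n (3 ∷ replicate p 2)
three-twos-free {p = p} n∣κ 2≤n refl (skip q) n∣x = few-twos-free (s≤s (n≤1+n (p * 2))) q n∣x
three-twos-free {p = p} n∣κ 2≤n refl (take {c = c} q) n∣x = ≰⇒> λ κ≤x → let e , c≤ = replicate-two-sum p q in
  odd-even p c (≡.trans (sym (multiple-between n∣κ n∣x κ≤x (≤-trans (s≤s (s≤s (s≤s (s≤s (≤-trans (≤-reflexive e) (*-monoˡ-≤ 2 c≤))))))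
    (≤-trans (≤-reflexive (+-comm 2 (2 + p * 2))) (+-monoʳ-≤ (2 + p * 2) 2≤n))))) (cong (3 +_) e))
  where
  odd-even : ∀ p c → 2 + p * 2 ≡ 3 + c * 2 → ⊥
  odd-even zero zero ()
  odd-even zero (suc c) ()
  odd-even (suc p) zero ()
  odd-even (suc p) (suc c) e = odd-even p c (suc-injective (suc-injective e))

twos-minimal : n ∣ κ → p * 2 ≡ κ → Minimal κ n (replicate p 2)
twos-minimal {p = p} n∣κ refl = subst (_ ∣_) (sym (sum-replicate-two p)) n∣κ , ≤-reflexive (sym (sum-replicate-two p)) ,
  λ q c< _ → ≤-<-trans (≤-reflexive (proj₁ (replicate-two-sum p q))) (*-monoˡ-< 2 (≤-trans c< (≤-reflexive (length-replicate p))))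

-- The total κ + n is a multiple of `n`, and a proper sum lies below it. The only multiple left is
-- κ, which is odd and so not a sum of twos.
odd-twos-minimal : n ∣ κ → ¬ 2 ∣ κ → p * 2 ≡ κ + n → Minimal κ n (replicate p 2)
odd-twos-minimal {n} {κ} {p} n∣κ odd e =
  subst (n ∣_) (sym sum≡) (∣m∣n⇒∣m+n n∣κ ∣-refl) , ≤-trans (m≤m+n κ n) (≤-reflexive (sym sum≡)) ,
  λ {c} q c< n∣x → ≰⇒> λ κ≤x → let f = proj₁ (replicate-two-sum p q) in
    odd (divides (suc c) (≡.trans (sym (multiple-between n∣κ n∣x κ≤x
      (<-≤-trans (≤-<-trans (≤-reflexive f) (*-monoˡ-< 2 (≤-trans c< (≤-reflexive (length-replicate p))))) (≤-reflexive e)))) f))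
  where
  sum≡ : sum (replicate p 2) ≡ κ + n
  sum≡ = ≡.trans (sum-replicate-two p) e

bounded-twos : 2 ≤ B → ∀ p → Bounded B (replicate p 2)
bounded-twos 2≤B p = All.replicate⁺ p (s≤s z≤n , 2≤B)

not-free-complete : Bounded B ts → SumFree κ n ts → All (2 ≤_) ts → 1 ≤ length ts → length ts ≡ l → ¬ FreeComplete B κ n l
not-free-complete bd free ≥2 1≤ refl f = incomplete ≥2 1≤ (f _ bd free ≤-refl)

not-minimal-complete : Bounded B ts → Minimal κ n ts → All (2 ≤_) ts → 1 ≤ length ts → length ts ≡ l → ¬ MinimalComplete B κ n l
not-minimal-complete bd min ≥2 1≤ refl f = incomplete ≥2 1≤ (f _ bd min ≤-refl)

-- Decidability and the existence of least lengths

sumFree? : ∀ κ n ts → Dec (SumFree κ n ts)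
sumFree? κ n ts = map′
  (λ f {c} {x} p → f {c} (≤-trans (n≤1+n _) (s≤s (SumOf-count≤ p))) {x} (s≤s (SumOf≤sum p)) p)
  (λ f {c} _ {x} _ p → f p)
  (allUpTo? (λ c → allUpTo? (λ x → sumOf? ts (suc c) x →-dec (n ∣? x →-dec x <? κ)) (suc (sum ts))) (suc (length ts)))

minimal? : ∀ κ n ts → Dec (Minimal κ n ts)
minimal? κ n ts = (n ∣? sum ts) ×-dec (κ ≤? sum ts) ×-dec map′
  (λ f {c} {x} p → f {c} (≤-trans (n≤1+n _) (s≤s (SumOf-count≤ p))) {x} (s≤s (SumOf≤sum p)) p)
  (λ f {c} _ {x} _ p → f p)
  (allUpTo? (λ c → allUpTo? (λ x → sumOf? ts (suc c) x →-dec (suc c <? length ts →-dec (n ∣? x →-dec x <? κ))) (suc (sum ts))) (suc (length ts)))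

bounded-all? : ∀ {Q : List ℕ → Set} → (∀ ts → Dec (Q ts)) → ∀ B l → Dec (∀ ts → Bounded B ts → length ts ≡ l → Q ts)
bounded-all? Q? B zero = map′ (λ { q [] _ _ → q }) (λ f → f [] [] refl) (Q? [])
bounded-all? Q? B (suc l) = map′
  (λ { f (t ∷ ts) ((1≤t , t≤B) ∷ bd) e → f (s≤s t≤B) 1≤t ts bd (suc-injective e) })
  (λ f {t} t< 1≤t ts bd e → f (t ∷ ts) ((1≤t , s≤s⁻¹ t<) ∷ bd) (cong suc e))
  (allUpTo? (λ t → (1 ≤? t) →-dec bounded-all? (λ ts → Q? (t ∷ ts)) B l) (suc B))

-- A descending search. `P l` speaks of all lengths from `l` on, infinitely many; once `P (suc l)`
-- is known, only length `l` itself is left, where bounded terms allow a finite check.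
least : ∀ {P : ℕ → Set} → (∀ l → P (suc l) → Dec (P l)) → (∀ l → P l → P (suc l)) → ∀ u → P (suc u) → ∃[ m ] LeastPositive P m
least P? step zero p = 1 , ≤-refl , p , λ _ 1≤j _ → 1≤j
least {P} P? step (suc u) p with P? (suc u) p
... | yes q = least P? step u q
... | no ¬q = suc (suc u) , s≤s z≤n , p , λ j _ pj → ≮⇒≥ λ j< → ¬q (rise (s≤s⁻¹ j<) pj)
  where
  rise : ∀ {i j} → i ≤ j → P i → P j
  rise i≤j pi with d , refl ← excess i≤j = go d
    where
    go : ∀ d → P (_ + d)
    go zero = subst P (sym (+-identityʳ _)) pi
    go (suc d) = subst P (sym (+-suc _ d)) (step _ (go d))

least-length : ∀ {Q : List ℕ → Set} → (∀ ts → Dec (Q ts)) → ∀ B → let P = λ l → ∀ ts → Bounded B ts → l ≤ length ts → Q ts in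
               ∀ u → 1 ≤ u → P u → ∃[ m ] LeastPositive P m
least-length {Q} Q? B (suc u) _ = least
  (λ l above → map′
    (λ exact ts bd l≤ → case m≤n⇒m<n∨m≡n l≤ of λ where
      (inj₁ l<) → above ts bd l<
      (inj₂ l≡) → exact ts bd (sym l≡))
    (λ f ts bd e → f ts bd (≤-reflexive (sym e)))
    (bounded-all? Q? B l))
  (λ l f ts bd l< → f ts bd (<⇒≤ l<)) u

least-free : ∀ B κ n u → 1 ≤ u → FreeComplete B κ n u → ∃[ m ] LeastPositive (FreeComplete B κ n) m
least-free B κ n u 1≤u f =
  let m , 1≤m , p , min = least-length (λ ts → sumFree? κ n ts →-dec complete? ts) B u 1≤u (λ ts bd l≤ free → f ts bd free l≤)
  in m , 1≤m , (λ ts bd free l≤ → p ts bd l≤ free) , λ j 1≤j pj → min j 1≤j λ ts bd l≤ free → pj ts bd free l≤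

least-minimal : ∀ B κ n u → 1 ≤ u → MinimalComplete B κ n u → ∃[ m ] LeastPositive (MinimalComplete B κ n) m
least-minimal B κ n u 1≤u f =
  let m , 1≤m , p , min = least-length (λ ts → minimal? κ n ts →-dec complete? ts) B u 1≤u (λ ts bd l≤ min → f ts bd min l≤)
  in m , 1≤m , (λ ts bd min l≤ → p ts bd l≤ min) , λ j 1≤j pj → min j 1≤j λ ts bd l≤ min → pj ts bd min l≤

⌊double/2⌋ : ∀ h → ⌊ h * 2 /2⌋ ≡ h
⌊double/2⌋ zero = refl
⌊double/2⌋ (suc h) = cong suc (⌊double/2⌋ h)

⌊suc-double/2⌋ : ∀ h → ⌊ suc (h * 2) /2⌋ ≡ h
⌊suc-double/2⌋ zero = refl
⌊suc-double/2⌋ (suc h) = cong suc (⌊suc-double/2⌋ h)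

even-or-odd : ∀ n → ∃[ h ] (n ≡ h * 2 ⊎ n ≡ suc (h * 2))
even-or-odd zero = 0 , inj₁ refl
even-or-odd (suc zero) = 0 , inj₂ refl
even-or-odd (suc (suc n)) with even-or-odd n
... | h , inj₁ e = suc h , inj₁ (cong (2 +_) e)
... | h , inj₂ e = suc h , inj₂ (cong (2 +_) e)

odd≢even : ∀ i j → suc (i * 2) ≢ j * 2
odd≢even zero (suc j) ()
odd≢even (suc i) (suc j) e = odd≢even i j (suc-injective (suc-injective e))

n≤2*⌈n/2⌉ : ∀ n → n ≤ 2 * ⌈ n /2⌉
n≤2*⌈n/2⌉ n = ≤-trans (≤-reflexive (sym (⌊n/2⌋+⌈n/2⌉≡n n)))
  (≤-trans (+-monoˡ-≤ ⌈ n /2⌉ (⌊n/2⌋≤⌈n/2⌉ n)) (≤-reflexive (cong (⌈ n /2⌉ +_) (sym (+-identityʳ ⌈ n /2⌉)))))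

free-lower : LeastPositive (FreeComplete B κ n) m → ¬ FreeComplete B κ n l → suc l ≤ m
free-lower (_ , p , _) ¬p = ≰⇒> λ m≤l → ¬p λ ts bd free l≤ → p ts bd free (≤-trans m≤l l≤)

minimal-lower : LeastPositive (MinimalComplete B κ n) m → ¬ MinimalComplete B κ n l → suc l ≤ m
minimal-lower (_ , p , _) ¬p = ≰⇒> λ m≤l → ¬p λ ts bd min l≤ → p ts bd min (≤-trans m≤l l≤)

-- The values for index larger than the period

LongIndex : (n K L Smo Ŝmo : ℕ) → Set
LongIndex n K L Smo Ŝmo =
  Smo ≤ Ŝmo + 1 ×
  (3 ≤ n × K % 2 ≡ 0 → ⌊ K /2⌋ + 1 ≤ Ŝmo × Ŝmo ≤ ⌈ L /2⌉ ∸ 1) ×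
  (¬ (3 ≤ n × K % 2 ≡ 0) → Ŝmo ≡ ⌊ L /2⌋) ×
  (3 ≤ n × K % 2 ≡ 0 → ⌊ K /2⌋ + 1 ≤ Smo × Smo ≤ ⌈ L /2⌉) ×
  (n ≡ 2 → Smo ≡ ⌊ L /2⌋) ×
  (¬ (3 ≤ n × K % 2 ≡ 0) → n ≢ 2 → Smo ≡ ⌊ L /2⌋ + 1)

-- `c` is ⌈k / n⌉ and `B` the largest index. The lower bounds on `B` ensure that 2, and for n ≥ 2
-- also 3, occur as indices.
module _ (c n B : ℕ) .{{_ : NonZero n}} (2≤c : 2 ≤ c) (2≤B : 2 ≤ B) (3≤B : 2 ≤ n → 3 ≤ B) where

  private
    K L : ℕ
    K = c * n
    L = (c + 1) * n

    L≡K+n : L ≡ K + n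
    L≡K+n = ≡.trans (*-distribʳ-+ n c 1) (cong (K +_) (+-identityʳ n))

    n∣K : n ∣ K
    n∣K = n∣m*n c

    1≤n : 1 ≤ n
    1≤n = >-nonZero⁻¹ n

    2n≤K : 2 * n ≤ K
    2n≤K = *-monoˡ-≤ n 2≤c

    Invariants : Set
    Invariants = ∃₂ λ Smo Ŝmo → LeastPositive (MinimalComplete B K n) Smo × LeastPositive (FreeComplete B K n) Ŝmo ×
      LongIndex n K L Smo Ŝmo

    exist : 1 ≤ l → FreeComplete B K n l →
            ∃₂ λ Smo Ŝmo → LeastPositive (MinimalComplete B K n) Smo × LeastPositive (FreeComplete B K n) Ŝmo ×
              Ŝmo ≤ l × Smo ≤ Ŝmo + 1
    exist {u} 1≤u f =
      let Ŝ , Ŝ-least = least-free B K n u 1≤u f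
          1≤Ŝ , Ŝ-free , Ŝ-min = Ŝ-least
          minimal = free⇒minimal 1≤Ŝ Ŝ-free
          S , S-least = least-minimal B K n (suc Ŝ) z<s minimal
          _ , _ , S-min = S-least
      in S , Ŝ , S-least , Ŝ-least , Ŝ-min u 1≤u f , ≤-trans (S-min (suc Ŝ) z<s minimal) (≤-reflexive (+-comm 1 Ŝ))

    three-twos : ∀ p → 2 ≤ n → suc p * 2 ≡ K → ¬ FreeComplete B K n (suc p)
    three-twos p 2≤n e = not-free-complete
      ((s≤s z≤n , 3≤B 2≤n) ∷ bounded-twos 2≤B p) (three-twos-free n∣K 2≤n e)
      (s≤s z<s ∷ All.replicate⁺ p ≤-refl) z<s (cong suc (length-replicate p))

    half-twos : ∀ p → 1 ≤ p → p * 2 ≡ K → ¬ MinimalComplete B K n p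
    half-twos p 1≤p e = not-minimal-complete (bounded-twos 2≤B p) (twos-minimal {p = p} n∣K e)
      (All.replicate⁺ p ≤-refl) (≤-trans 1≤p (≤-reflexive (sym (length-replicate p)))) (length-replicate p)

    even-long : ∀ h → K ≡ h * 2 → 3 ≤ n → Invariants
    even-long zero e _ = contradiction (≤-trans 2n≤K (≤-reflexive e)) (<⇒≱ (*-monoʳ-< 2 1≤n))
    even-long (suc p) e 3≤n =
      let S , Ŝ , S-least , Ŝ-least , Ŝ≤u , S≤Ŝ+1 = exist 1≤u
            (free-upper c n 2≤c 2≤n (inj₂ (3≤n , divides (suc p) e , K+n≤)))
          h<Ŝ = subst (_≤ Ŝ) K/2+1 (free-lower Ŝ-least (three-twos p 2≤n (sym e)))
          h<S = subst (_≤ S) K/2+1 (minimal-lower S-least (half-twos (suc p) z<s (sym e)))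
      in S , Ŝ , S-least , Ŝ-least , S≤Ŝ+1
         , (λ _ → h<Ŝ , Ŝ≤u)
         , (λ not → contradiction (3≤n , even%) not)
         , (λ _ → h<S , ≤-trans S≤Ŝ+1 (≤-trans (+-monoˡ-≤ 1 Ŝ≤u) (≤-reflexive (m∸n+n≡m 1≤⌈L/2⌉))))
         , (λ n≡2 → contradiction (≤-trans 3≤n (≤-reflexive n≡2)) 1+n≰n)
         , (λ not _ → contradiction (3≤n , even%) not)
      where
      2≤n : 2 ≤ n
      2≤n = ≤-trans (n≤1+n 2) 3≤n
      u₀ : ℕ
      u₀ = ⌈ L /2⌉ ∸ 1
      9≤L : 9 ≤ L
      9≤L = *-mono-≤ (+-monoˡ-≤ 1 2≤c) 3≤n
      5≤⌈L/2⌉ : 5 ≤ ⌈ L /2⌉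
      5≤⌈L/2⌉ = ⌈n/2⌉-mono 9≤L
      1≤⌈L/2⌉ : 1 ≤ ⌈ L /2⌉
      1≤⌈L/2⌉ = ≤-trans z<s 5≤⌈L/2⌉
      1≤u : 1 ≤ u₀
      1≤u = ≤-trans z<s (∸-monoˡ-≤ 1 5≤⌈L/2⌉)
      K+n≤ : K + n ≤ 2 * u₀ + 2
      K+n≤ = ≤-trans (≤-reflexive (sym L≡K+n)) (≤-trans (n≤2*⌈n/2⌉ L)
        (≤-reflexive (≡.trans (cong (2 *_) (sym (m∸n+n≡m 1≤⌈L/2⌉))) (*-distribˡ-+ 2 u₀ 1))))
      K/2+1 : suc (suc p) ≡ ⌊ K /2⌋ + 1
      K/2+1 = ≡.trans (+-comm 1 (suc p)) (cong (_+ 1) (≡.trans (sym (⌊double/2⌋ (suc p))) (cong ⌊_/2⌋ (sym e))))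
      even% : K % 2 ≡ 0
      even% = n∣m⇒m%n≡0 K 2 (divides (suc p) e)

    exact : ∀ {Smo Ŝmo} → ¬ (3 ≤ n × K % 2 ≡ 0) → n ≢ 2 → Ŝmo ≡ ⌊ L /2⌋ → Smo ≡ ⌊ L /2⌋ + 1 → LongIndex n K L Smo Ŝmo
    exact ¬E n≢2 Ŝ≡ S≡ = ≤-reflexive (≡.trans S≡ (cong (_+ 1) (sym Ŝ≡))) , (λ E → contradiction E ¬E) , (λ _ → Ŝ≡)
      , (λ E → contradiction E ¬E) , (λ n≡2 → contradiction n≡2 n≢2) , (λ _ _ → S≡)

    exact-invariants : ∀ u → ¬ (3 ≤ n × K % 2 ≡ 0) → n ≢ 2 → ⌊ L /2⌋ ≡ suc u → FreeComplete B K n (suc u) →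
                       (1 ≤ u → ¬ FreeComplete B K n u) → ¬ MinimalComplete B K n (suc u) → Invariants
    exact-invariants u ¬E n≢2 L/2≡ free ¬free ¬minimal =
      let S , Ŝ , S-least , Ŝ-least , Ŝ≤u , S≤Ŝ+1 = exist z<s free
          Ŝ≡ = ≤-antisym Ŝ≤u (lower u Ŝ-least ¬free)
          S≡ = ≤-antisym (≤-trans S≤Ŝ+1 (≤-reflexive (≡.trans (cong (_+ 1) Ŝ≡) (+-comm (suc u) 1)))) (minimal-lower S-least ¬minimal)
      in S , Ŝ , S-least , Ŝ-least , exact ¬E n≢2 (≡.trans Ŝ≡ (sym L/2≡)) (≡.trans S≡ (≡.trans (+-comm 1 (suc u)) (cong (_+ 1) (sym L/2≡))))
      where
      lower : ∀ u {Ŝ} → LeastPositive (FreeComplete B K n) Ŝ → (1 ≤ u → ¬ FreeComplete B K n u) → suc u ≤ Ŝ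
      lower zero (1≤Ŝ , _) _ = 1≤Ŝ
      lower (suc u) Ŝ-least ¬free = free-lower Ŝ-least (¬free z<s)

    even-one : ∀ h → K ≡ h * 2 → n ≡ 1 → Invariants
    even-one zero e _ = contradiction (≤-trans 2n≤K (≤-reflexive e)) (<⇒≱ (*-monoʳ-< 2 1≤n))
    even-one (suc p) e refl = exact-invariants p (λ { (s≤s () , _) }) (λ ())
      (≡.trans (cong ⌊_/2⌋ (≡.trans L≡K+n (≡.trans (+-comm K 1) (cong suc e)))) (⌊suc-double/2⌋ (suc p)))
      (free-upper-one z<s (≤-reflexive (≡.trans (≡.trans e (*-comm (suc p) 2)) refl)))
      (λ 1≤p → not-free-complete (bounded-twos 2≤B p) (few-twos-free {p} (≤-trans (n≤1+n (suc (p * 2))) (≤-reflexive (sym e))))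
        (All.replicate⁺ p ≤-refl) (≤-trans 1≤p (≤-reflexive (sym (length-replicate p)))) (length-replicate p))
      (half-twos (suc p) z<s (sym e))

    odd-index : ∀ h → K ≡ suc (h * 2) → Invariants
    odd-index h e with even-or-odd n
    ... | i , inj₁ n≡ = contradiction (≡.trans (sym e) (≡.trans (cong (c *_) n≡) (sym (*-assoc c i 2)))) (odd≢even h (c * i))
    ... | i , inj₂ n≡ = exact-invariants (h + i)
      (λ (_ , K%2≡0) → odd (m%n≡0⇒n∣m K 2 K%2≡0)) (λ n≡2 → odd≢even i 1 (≡.trans (sym n≡) n≡2))
      (≡.trans (cong ⌊_/2⌋ (≡.trans L≡K+n K+n≡)) (⌊double/2⌋ (suc (h + i))))
      (upper (n ≟ 1))
      (λ 1≤p → not-free-complete (bounded-twos 2≤B (h + i))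
        (twos-free {p = h + i} n∣K odd (≤-trans (s≤s (n≤1+n _)) (≤-reflexive (sym K+n≡))))
        (All.replicate⁺ (h + i) ≤-refl) (≤-trans 1≤p (≤-reflexive (sym (length-replicate (h + i))))) (length-replicate (h + i)))
      (not-minimal-complete (bounded-twos 2≤B (suc (h + i)))
        (odd-twos-minimal {p = suc (h + i)} n∣K odd (sym K+n≡))
        (All.replicate⁺ (suc (h + i)) ≤-refl) z<s (length-replicate (suc (h + i))))
      where
      odd : ¬ 2 ∣ K
      odd (divides j K≡) = odd≢even h j (≡.trans (sym e) K≡)
      K+n≡ : K + n ≡ suc (h + i) * 2
      K+n≡ = ≡.trans (cong₂ _+_ e n≡) (arith h i)
        where
        arith : ∀ h i → suc (h * 2) + suc (i * 2) ≡ suc (h + i) * 2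
        arith h i = solve (h & i & [])
      K+n≤ : K + n ≤ 2 * suc (h + i)
      K+n≤ = ≤-reflexive (≡.trans K+n≡ (*-comm (suc (h + i)) 2))
      upper : Dec (n ≡ 1) → FreeComplete B K n (suc (h + i))
      upper (yes n≡1) = subst (λ n′ → FreeComplete B K n′ (suc (h + i))) (sym n≡1) (free-upper-one z<s (≤-trans (m≤m+n K n) K+n≤))
      upper (no n≢1) = free-upper c n 2≤c (≤∧≢⇒< 1≤n (n≢1 ∘ sym)) (inj₁ K+n≤)

    -- Here Smo and Ŝmo coincide. The passage by `free⇒minimal` would give a bound one too large, so
    -- the bound for minimal sequences is taken from `PeriodTwo`.
    period-two : n ≡ 2 → Invariants
    period-two refl =
      let S , Ŝ , S-least , Ŝ-least , Ŝ≤u , S≤Ŝ+1 = exist z<s (free-upper c 2 2≤c ≤-refl (inj₁ K+2≤))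
          Ŝ≡ = ≤-antisym Ŝ≤u (lower c 2≤c refl Ŝ-least)
          S≡ = ≤-antisym (proj₂ (proj₂ S-least) (suc c) z<s (PeriodTwo.minimal-upper-two (n∣m*n c) 2n≤K K+2≤))
                 (minimal-lower S-least (half-twos c (≤-trans z<s 2≤c) refl))
      in S , Ŝ , S-least , Ŝ-least , S≤Ŝ+1
         , (λ { (s≤s (s≤s ()) , _) }) , (λ _ → ≡.trans Ŝ≡ (sym L/2≡))
         , (λ { (s≤s (s≤s ()) , _) }) , (λ _ → ≡.trans S≡ (sym L/2≡)) , (λ _ n≢2 → contradiction refl n≢2)
      where
      L/2≡ : ⌊ L /2⌋ ≡ suc c
      L/2≡ = ≡.trans (⌊double/2⌋ (c + 1)) (+-comm c 1)
      K+2≤ : c * 2 + 2 ≤ 2 * suc c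
      K+2≤ = ≤-reflexive (arith c)
        where
        arith : ∀ c → c * 2 + 2 ≡ 2 * suc c
        arith c = solve (c & [])
      lower : ∀ c′ → 2 ≤ c′ → c′ ≡ c → ∀ {Ŝ} → LeastPositive (FreeComplete B K 2) Ŝ → suc c′ ≤ Ŝ
      lower (suc p) _ e Ŝ-least = free-lower Ŝ-least (three-twos p ≤-refl (cong (_* 2) e))

  long-index-invariants : Invariants
  long-index-invariants with even-or-odd K | n ≟ 1 | n ≟ 2
  ... | h , inj₂ e | _ | _ = odd-index h e
  ... | h , inj₁ e | yes n≡1 | _ = even-one h e n≡1
  ... | h , inj₁ e | no _ | yes n≡2 = period-two n≡2
  ... | h , inj₁ e | no n≢1 | no n≢2 = even-long h e (≤∧≢⇒< (≤∧≢⇒< 1≤n (n≢1 ∘ sym)) (n≢2 ∘ sym))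

-- Index at most the period

module ShortIndex (n : ℕ) .{{_ : NonZero n}} where

  open Congruence n
  open SavchevChen n
  open TwoValued n
  open LongZeroFree n
  open SmoothBy using (total; multiple≉0; multiple-sum; multiple-sum⁺; length≤total; coefficients)

  Order : ℕ → Set
  Order g = ∀ {m} → 1 ≤ m → m * g ≈ 0 → n ≤ m

  FreeForm MinimalForm : List ℕ → Set
  FreeForm    ts = ∃[ g ] Order g × ∃[ S ] total {g} {ts} S < n
  MinimalForm ts = ∃[ g ] Order g × ∃[ S ] total {g} {ts} S ≡ n

  FreeSmooth MinimalSmooth : (B l : ℕ) → Set
  FreeSmooth    B l = ∀ ts → Bounded B ts → SumFree n n ts → l ≤ length ts → FreeForm ts
  MinimalSmooth B l = ∀ ts → Bounded B ts → Minimal n n ts → l ≤ length ts → MinimalForm ts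

  sumFree⇒zeroFree : All (1 ≤_) ts → SumFree n n ts → ZeroFree ts
  sumFree⇒zeroFree pos free p x≈0 = <⇒≱ (free p (≈0⇒∣ x≈0))
    (∣⇒≤ {{>-nonZero (≤-trans z<s (count≤SumOf pos p))}} (≈0⇒∣ x≈0))

  n*g≈0 : ∀ g → n * g ≈ 0
  n*g≈0 g = ∣⇒≈0 (m∣m*n g)

  free-form : (S : SmoothBy g ts) → ZeroFree ts → Order g → FreeForm ts
  free-form S zf order = _ , order , S , ≰⇒> λ n≤ → multiple≉0 S zf (>-nonZero⁻¹ n) n≤ (n*g≈0 _)

  long-free : n < 2 * l → FreeSmooth B l
  long-free n<2l ts bd free l≤ =
    let zf = sumFree⇒zeroFree (positive-terms bd) free
        n<2len = <-≤-trans n<2l (*-monoʳ-≤ 2 l≤)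
        g , S = long-zero-free n<2len zf
    in free-form S zf (smooth-order-long S zf (<⇒≤ n<2len))

  FreeSmooth-step : FreeSmooth B (suc l) → (∀ ts → Bounded B ts → SumFree n n ts → length ts ≡ l → FreeForm ts) → FreeSmooth B l
  FreeSmooth-step above exact ts bd free l≤ with m≤n⇒m<n∨m≡n l≤
  ... | inj₁ l< = above ts bd free l<
  ... | inj₂ l≡ = exact ts bd free (sym l≡)

  -- The last term of a minimal sequence is (n - N) g, where N is the coefficient sum of the others.
  minimal-smooth : n ≤ suc (2 * l) → FreeSmooth B l → MinimalSmooth B (suc l)
  minimal-smooth {l} n≤ free (a ∷ ts) bd min@(n∣ , _) (s≤s l≤) with free ts (All.tail bd) (Minimal⇒tail-free min) l≤
  ... | g , order , S , N<n with d , N+d≡n ← excess (<⇒≤ N<n) =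
    g , order , smooth-∷ S 1≤d d≤ d*g≈a , ≡.trans (+-comm d (total S)) N+d≡n
    where
    1≤d : 1 ≤ d
    1≤d = n≢0⇒n>0 λ d≡0 → <⇒≢ N<n (≡.trans (sym (+-identityʳ _)) (≡.trans (cong (total S +_) (sym d≡0)) N+d≡n))
    -- With N the total, N ≥ l and N + d ≤ 2 l + 1 give d ≤ l + 1 ≤ N + 1.
    d≤ : d ≤ suc (total S)
    d≤ = arith (total S) d l (length ts) (length≤total S) l≤ (subst (_≤ suc (2 * l)) (sym N+d≡n) n≤)
      where
      arith : ∀ N d l t → t ≤ N → l ≤ t → N + d ≤ suc (2 * l) → d ≤ suc N
      arith N d l t h₁ h₂ h₃ = lin 0 (2 ⊛ h₁ ⊕ 2 ⊛ h₂ ⊕ h₃) (solve (N & d & l & t & []))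
    sum≈ : sum ts ≈ total S * g
    sum≈ = go (SmoothBy.multiples S)
      where
      go : ∀ {ys ts} → Pointwise (λ y t → y * g ≈ t) ys ts → sum ts ≈ sum ys * g
      go [] = ≈-refl
      go {y ∷ ys} (e ∷ es) = ≈-trans (≈-sym e ⊞ go es) (≈-reflexive (sym (*-distribʳ-+ g y (sum ys))))
    d*g≈a : d * g ≈ a
    d*g≈a = +-cancelʳ-≈ (total S * g) (≈-trans (≈-reflexive (≡.trans (+-comm (d * g) _) (sym (*-distribʳ-+ g (total S) d))))
      (≈-trans (subst (λ k → k * g ≈ 0) (sym N+d≡n) (n*g≈0 g)) (≈-sym (≈-trans (≈-refl {a} ⊞ ≈-sym sum≈) (∣⇒≈0 n∣)))))

  divisors-order : (S : SmoothBy g ts) → ZeroFree ts → 1 ≤ length ts → (∀ {d} → d < n → d ∣ n → d ≤ 1) → Order g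
  divisors-order S zf 1≤l prime = smooth-order S zf λ d∣n d<n → ≤-trans (prime d<n d∣n) (≤-trans 1≤l (length≤total S))

  singleton-free : (∀ {d} → d < n → d ∣ n → d ≤ 1) → ∀ ts → Bounded B ts → SumFree n n ts → length ts ≡ 1 → FreeForm ts
  singleton-free prime (a ∷ []) bd free refl =
    let zf = sumFree⇒zeroFree (positive-terms bd) free
        S = smooth-constant (≈-refl ∷ [])
    in free-form S zf (divisors-order S zf z<s prime)

  -- A proper sum divisible by `n` that uses `a` would leave a nonempty divisible complement inside
  -- `ts`.
  minimal-∷ : All (1 ≤_) ts → SumFree n n ts → n ∣ a + sum ts → 1 ≤ a → Minimal n n (a ∷ ts)
  minimal-∷ {ts} {a} pos free n∣ 1≤a = n∣ , ∣⇒≤ {{>-nonZero (≤-trans 1≤a (m≤m+n a _))}} n∣ , proper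
    where
    proper : ∀ {c x} → SumOf (a ∷ ts) (suc c) x → suc c < suc (length ts) → n ∣ x → x < n
    proper (skip p) _ = free p
    proper (take {x = x} p) (s≤s c<) n∣x with complement p
    ... | complement-of {zero} q e f = contradiction (≡.trans (sym (+-identityʳ _)) e) (<⇒≢ c<)
    ... | complement-of {suc d} {t} q e f = contradiction (∣⇒≈0 n∣t) (sumFree⇒zeroFree pos free q)
      where
      n∣t : n ∣ t
      n∣t = ∣m+n∣m⇒∣n (subst (n ∣_) (≡.trans (cong (a +_) (sym f)) (sym (+-assoc a x t))) n∣) n∣x

  -- Coefficients of the lower-bound sequences

  jump : ∀ {x y} → y < x → x ≈ y → n + y ≤ x
  jump {x} {y} y<x e with d , refl ← excess (<⇒≤ y<x) =
    ≤-trans (≤-reflexive (+-comm n y)) (+-monoʳ-≤ y (∣⇒≤ {{≢-nonZero d≢0}} (≈0⇒∣ (linᶜ e (arith y d)))))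
    where
    d≢0 : d ≢ 0
    d≢0 d≡0 = <⇒≢ y<x (≡.trans (sym (+-identityʳ y)) (cong (y +_) (sym d≡0)))
    arith : ∀ y d → d + y ≡ 0 + (y + d)
    arith y d = solve (y & d & [])

  twos-lower : ∀ p → (∀ {m} → 1 ≤ m → m * g ≈ 2 → b ≤ m * a) → All (1 ≤_) ms →
               Pointwise (λ m t → m * g ≈ t) ms (replicate p 2) → p * b ≤ sum ms * a
  twos-lower zero _ [] [] = z≤n
  twos-lower {a = a} {ms = m ∷ ms} (suc p) low (1≤m ∷ pos) (e ∷ es) =
    ≤-trans (+-mono-≤ (low 1≤m e) (twos-lower p low pos es)) (≤-reflexive (sym (*-distribʳ-+ a m (sum ms))))

  twice-minus-one : suc g ≈ 0 → 1 ≤ m → m * g ≈ 2 → n ≤ 2 + m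
  twice-minus-one {g} {m} g+1≈0 1≤m e = ∣⇒≤ (≈0⇒∣ (linᶜ (≈-sym e ⊞ m ⊠ g+1≈0) (arith m g)))
    where
    arith : ∀ m g → 2 + m + (m * g + m * 0) ≡ 0 + (2 + m * suc g)
    arith m g = solve (m & g & [])

  twice-three : g ≈ 3 → 1 ≤ m → m * g ≈ 2 → n + 2 ≤ m * 3
  twice-three {m = m} g≈3 1≤m e = jump (*-monoˡ-≤ 3 1≤m) (≈-trans (≈-sym (m ⊠ g≈3)) e)

  thrice-two : 3 < n → g ≈ 2 → 1 ≤ m → m * g ≈ 3 → n + 3 ≤ m * 2
  thrice-two {m = suc zero} 3<n g≈2 1≤m e = contradiction
    (<⇒≈⇒≡ 3<n (<-trans ≤-refl 3<n) (≈-trans (≈-sym e) (1 ⊠ g≈2))) λ ()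
  thrice-two {m = suc (suc m)} _ g≈2 1≤m e = jump (s≤s (s≤s (s≤s z<s))) (≈-trans (≈-sym (suc (suc m) ⊠ g≈2)) e)

  -- The lower-bound sequences consist of 2's, 3's and possibly n - 1, and a generator must be
  -- congruent to a term, the one with coefficient 1.
  Generators : ℕ → Set
  Generators g = g ≈ 2 ⊎ g ≈ 3 ⊎ suc g ≈ 0

  -- For g ≈ 2 the order is too small, as n is even. Otherwise every 2 is expensive: its coefficient
  -- is at least (n + 2) / 3 for g ≈ 3 and at least n - 2 for g ≈ -1. For p = 1 the estimate fails:
  -- modulo 4 the sequence 3, 2 has coefficients 1, 2 with respect to 3.
  even-large : 2 ≤ p → n ≡ 2 + p * 2 → Order g → Generators g → All (1 ≤_) ms →
               Pointwise (λ m t → m * g ≈ t) ms (3 ∷ replicate p 2) → n < sum ms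
  even-large {p} 2≤p n≡ order (inj₁ g≈2) _ _ = contradiction
    (order z<s (≈-trans (suc p ⊠ g≈2) (∣⇒≈0 (divides 1 (≡.trans (sym n≡) (sym (+-identityʳ n)))))))
    (<⇒≱ (≤-trans (s≤s (s≤s (m≤m*n p 2))) (≤-reflexive (sym n≡))))
  even-large {p} {ms = m ∷ ms} 2≤p n≡ order (inj₂ (inj₁ g≈3)) (1≤m ∷ pos) (_ ∷ es) =
    arith p m (sum ms) n 2≤p (≤-reflexive n≡) (≤-reflexive (sym n≡)) 1≤m (twos-lower {a = 3} p (twice-three g≈3) pos es)
    where
    arith : ∀ p m s n → 2 ≤ p → n ≤ 2 + p * 2 → 2 + p * 2 ≤ n → 1 ≤ m → p * (n + 2) ≤ s * 3 → n < m + s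
    arith p m s n 2≤p h₁ h₂ h₃ h₄ with p′ , refl ← excess 2≤p = *-cancelʳ-< 3 n (m + s)
      (lin (2 * p′ * p′ + 6 * p′) (3 ⊛ h₁ ⊕ p ⊛ h₂ ⊕ 3 ⊛ h₃ ⊕ h₄) (solve (p′ & m & s & n & [])))
  even-large {p} {ms = m ∷ ms} 2≤p n≡ order (inj₂ (inj₂ g+1≈0)) (1≤m ∷ pos) (_ ∷ es) =
    arith p m (sum ms) n 2≤p (≤-reflexive n≡) 1≤m (twos-lower {a = 1} p low pos es)
    where
    low : ∀ {m} → 1 ≤ m → m * _ ≈ 2 → p * 2 ≤ m * 1
    low {m} 1≤m e = ≤-trans (+-cancelˡ-≤ 2 (p * 2) m (subst (_≤ 2 + m) n≡ (twice-minus-one g+1≈0 1≤m e))) (≤-reflexive (sym (*-identityʳ m)))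
    arith : ∀ p m s n → 2 ≤ p → n ≤ 2 + p * 2 → 1 ≤ m → p * (p * 2) ≤ s * 1 → n < m + s
    arith p m s n 2≤p h₁ h₂ h₃ with p′ , refl ← excess 2≤p =
      lin (2 * p′ * p′ + 6 * p′ + 2) (h₁ ⊕ h₂ ⊕ h₃) (solve (p′ & m & s & n & []))

  -- As n is odd, g ≈ 2 has order n and must be beaten by its coefficients. This is why there are
  -- two 3's: each has coefficient at least (n + 3) / 2. For p = 1 the estimate fails: modulo 7 the
  -- sequence 3, 3, 2 has coefficients 1, 1, 3 with respect to 3.
  odd-large : 2 ≤ p → n ≡ 5 + p * 2 → Generators g → All (1 ≤_) ms →
              Pointwise (λ m t → m * g ≈ t) ms (3 ∷ 3 ∷ replicate p 2) → n < sum ms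
  odd-large {p} {ms = m ∷ m′ ∷ ms} 2≤p n≡ (inj₁ g≈2) (1≤m ∷ 1≤m′ ∷ _) (e ∷ e′ ∷ _) =
    arith m m′ (sum ms) n (thrice-two 3<n g≈2 1≤m e) (thrice-two 3<n g≈2 1≤m′ e′)
    where
    3<n : 3 < n
    3<n = ≤-trans (s≤s (s≤s (s≤s z<s))) (≤-reflexive (sym n≡))
    arith : ∀ m m′ s n → n + 3 ≤ m * 2 → n + 3 ≤ m′ * 2 → n < m + (m′ + s)
    arith m m′ s n h₁ h₂ = *-cancelʳ-< 2 n (m + (m′ + s)) (lin (5 + s * 2) (h₁ ⊕ h₂) (solve (m & m′ & s & n & [])))
  odd-large {p} {ms = m ∷ m′ ∷ ms} 2≤p n≡ (inj₂ (inj₁ g≈3)) (1≤m ∷ 1≤m′ ∷ pos) (_ ∷ _ ∷ es) =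
    arith p m m′ (sum ms) n 2≤p (≤-reflexive n≡) (≤-reflexive (sym n≡)) 1≤m 1≤m′ (twos-lower {a = 3} p (twice-three g≈3) pos es)
    where
    arith : ∀ p m m′ s n → 2 ≤ p → n ≤ 5 + p * 2 → 5 + p * 2 ≤ n → 1 ≤ m → 1 ≤ m′ → p * (n + 2) ≤ s * 3 → n < m + (m′ + s)
    arith p m m′ s n 2≤p h₁ h₂ h₃ h₄ h₅ with p′ , refl ← excess 2≤p = *-cancelʳ-< 3 n (m + (m′ + s))
      (lin (2 * p′ * p′ + 9 * p′) (3 ⊛ h₁ ⊕ p ⊛ h₂ ⊕ 3 ⊛ h₃ ⊕ 3 ⊛ h₄ ⊕ h₅) (solve (p′ & m & m′ & s & n & [])))
  odd-large {p} {ms = m ∷ m′ ∷ ms} 2≤p n≡ (inj₂ (inj₂ g+1≈0)) (1≤m ∷ 1≤m′ ∷ pos) (_ ∷ _ ∷ es) =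
    arith p m m′ (sum ms) n 2≤p (≤-reflexive n≡) 1≤m 1≤m′ (twos-lower {a = 1} p low pos es)
    where
    low : ∀ {m} → 1 ≤ m → m * _ ≈ 2 → 3 + p * 2 ≤ m * 1
    low {m} 1≤m e = ≤-trans (+-cancelˡ-≤ 2 (3 + p * 2) m (subst (_≤ 2 + m) n≡ (twice-minus-one g+1≈0 1≤m e))) (≤-reflexive (sym (*-identityʳ m)))
    arith : ∀ p m m′ s n → 2 ≤ p → n ≤ 5 + p * 2 → 1 ≤ m → 1 ≤ m′ → p * (3 + p * 2) ≤ s * 1 → n < m + (m′ + s)
    arith p m m′ s n 2≤p h₁ h₂ h₃ h₄ with p′ , refl ← excess 2≤p =
      lin (2 * p′ * p′ + 9 * p′ + 6) (h₁ ⊕ h₂ ⊕ h₃ ⊕ h₄) (solve (p′ & m & m′ & s & n & []))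

  unit-term : ∀ {P : ℕ → Set} → (S : SmoothBy g ts) → 1 ≤ total S → All P ts → ∃[ t ] P t × g ≈ t
  unit-term {g} {P = P} S 1≤N = go (SmoothBy.multiples S) refl (proj₂ (SmoothBy.complete S 1 1≤N))
    where
    go : ∀ {ys ts c y} → Pointwise (λ y t → y * g ≈ t) ys ts → y ≡ 1 → SumOf ys c y → All P ts → ∃[ t ] P t × g ≈ t
    go (_ ∷ es) y≡1 (skip p) (_ ∷ ps) = go es y≡1 p ps
    go (_ ∷ es) y≡1 (take {a = zero} p) (_ ∷ ps) = go es y≡1 p ps
    go (e ∷ _) y≡1 (take {a = suc zero} p) (q ∷ _) = _ , q , ≈-trans (≈-reflexive (sym (+-identityʳ g))) e

  OneOf : ℕ → Set
  OneOf t = t ≡ 2 ⊎ t ≡ 3 ⊎ suc t ≡ n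

  generators : (S : SmoothBy g ts) → 1 ≤ length ts → All OneOf ts → Generators g
  generators S 1≤l all with unit-term S (≤-trans 1≤l (length≤total S)) all
  ... | t , inj₁ refl , e = inj₁ e
  ... | t , inj₂ (inj₁ refl) , e = inj₂ (inj₁ e)
  ... | t , inj₂ (inj₂ t+1≡n) , e = inj₂ (inj₂ (≈-trans (1+ e) (∣⇒≈0 (divides 1 (≡.trans t+1≡n (sym (+-identityʳ n)))))))
    where
    1+_ : ∀ {x y} → x ≈ y → suc x ≈ suc y
    1+ e = ≈-refl {1} ⊞ e

  Large : List ℕ → Set
  Large ts = ∀ {g ms} → Order g → Generators g → All (1 ≤_) ms → Pointwise (λ m t → m * g ≈ t) ms ts → n < sum ms

  not-free-form : Large ts → 1 ≤ length ts → All OneOf ts → ¬ FreeForm ts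
  not-free-form large 1≤l all (g , order , S , N<n) =
    <-asym N<n (large order (generators S 1≤l all) (SmoothBy.positive S) (SmoothBy.multiples S))

  -- The coefficients of `ts` alone already exceed `n`, whatever `a` adds.
  not-minimal-form : Large ts → All OneOf (a ∷ ts) → ¬ MinimalForm (a ∷ ts)
  not-minimal-form large all (g , order , S@(smoothBy (m ∷ ms) (_ ∷ es) (_ ∷ pos) _) , N≡n) =
    <⇒≱ (large order (generators S z<s all) pos es) (≤-trans (m≤n+m (sum ms) m) (≤-reflexive N≡n))

  -- The total is n + 1, so only the odd value n has to be avoided. Sums with both 3's are even, and
  -- those with at most one 3 do not exceed n - 2.
  two-threes-free : n ≡ 5 + p * 2 → SumFree n n (3 ∷ 3 ∷ replicate p 2)
  two-threes-free {p} n≡ = free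
    where
    bound : ∀ {c x} → SumOf (replicate p 2) c x → x ≤ p * 2
    bound q = let e , c≤ = replicate-two-sum p q in ≤-trans (≤-reflexive e) (*-monoˡ-≤ 2 c≤)
    below : ∀ {x} → x ≤ 4 + p * 2 → x < n
    below h = ≤-trans (s≤s h) (≤-reflexive (sym n≡))
    free : SumFree n n (3 ∷ 3 ∷ replicate p 2)
    free (skip (skip q)) _ = below (≤-trans (bound q) (m≤n+m _ 4))
    free (skip (take q)) _ = below (≤-trans (+-monoʳ-≤ 3 (bound q)) (n≤1+n _))
    free (take (skip q)) _ = below (≤-trans (+-monoʳ-≤ 3 (bound q)) (n≤1+n _))
    free (take (take {c = c} {x = x} q)) n∣x = ≰⇒> λ n≤x → odd≢even (2 + p) (3 + c)
      (≡.trans (sym n≡) (≡.trans (sym (multiple-between {κ = n} ∣-refl n∣x n≤x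
        (≤-trans (s≤s (+-monoʳ-≤ 6 (bound q))) (≤-trans (arith p) (≤-reflexive (sym (cong₂ _+_ n≡ n≡)))))))
        (cong (6 +_) (proj₁ (replicate-two-sum p q)))))
      where
      arith : ∀ p → 7 + p * 2 ≤ 5 + p * 2 + (5 + p * 2)
      arith p = lin (3 + p * 2) (z≤n {0}) (solve (p & []))

-- Small periods by finite search

module SmallLength (n : ℕ) .{{_ : NonZero n}} where

  open Congruence n
  open SavchevChen n
  open TwoValued n
  open LongZeroFree n
  open ShortIndex n

  -- The ranges here and in `Three` are those of `complete-∷`: after a coefficient 1 the next one is
  -- at most 2, and after 1 and y at most 2 + y.
  Two : ℕ → ℕ → Set
  Two a b = ∃[ y ] y < 3 × 1 ≤ y × y * a ≈ b

  two? : ∀ a b → Dec (Two a b)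
  two? a b = anyUpTo? (λ y → (1 ≤? y) ×-dec (y * a ≈? b)) 3

  Three : ℕ → ℕ → ℕ → Set
  Three a b c = ∃[ y ] y < 3 × (1 ≤ y × y * a ≈ b) × (∃[ z ] z < 3 + y × 1 ≤ z × z * a ≈ c)

  three? : ∀ a b c → Dec (Three a b c)
  three? a b c = anyUpTo? (λ y → ((1 ≤? y) ×-dec (y * a ≈? b)) ×-dec anyUpTo? (λ z → (1 ≤? z) ×-dec (z * a ≈? c)) (3 + y)) 3

  smooth-two : Two g b → g ≈ a → SmoothBy g (b ∷ a ∷ [])
  smooth-two (y , y< , 1≤y , e) g≈a = smooth-∷ (smooth-constant (≈-sym g≈a ∷ [])) 1≤y (s≤s⁻¹ y<) e

  smooth-three : Three g b c → g ≈ a → SmoothBy g (c ∷ b ∷ a ∷ [])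
  smooth-three (y , y< , (1≤y , e) , z , z< , 1≤z , f) g≈a = smooth-∷ (smooth-two (y , y< , 1≤y , e) g≈a) 1≤z
    (≤-trans (s≤s⁻¹ z<) (≤-reflexive (cong suc (+-comm 1 y)))) f

  PairsSmooth : Set
  PairsSmooth = ∀ {a} → a < n → ∀ {b} → b < n → (a ≈ 0 ⊎ b ≈ 0 ⊎ a + b ≈ 0) ⊎ Two a b ⊎ Two b a

  pairsSmooth? : Dec PairsSmooth
  pairsSmooth? = allUpTo? (λ a → allUpTo? (λ b →
    ((a ≈? 0) ⊎-dec (b ≈? 0) ⊎-dec (a + b ≈? 0)) ⊎-dec two? a b ⊎-dec two? b a) n) n

  TriplesSmooth : Set
  TriplesSmooth = ∀ {a} → a < n → ∀ {b} → b < n → ∀ {c} → c < n →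
    (a ≈ 0 ⊎ b ≈ 0 ⊎ c ≈ 0 ⊎ a + b ≈ 0 ⊎ a + c ≈ 0 ⊎ b + c ≈ 0 ⊎ a + (b + c) ≈ 0) ⊎
    Three a b c ⊎ Three a c b ⊎ Three b a c ⊎ Three b c a ⊎ Three c a b ⊎ Three c b a

  triplesSmooth? : Dec TriplesSmooth
  triplesSmooth? = allUpTo? (λ a → allUpTo? (λ b → allUpTo? (λ c →
    ((a ≈? 0) ⊎-dec (b ≈? 0) ⊎-dec (c ≈? 0) ⊎-dec (a + b ≈? 0) ⊎-dec (a + c ≈? 0) ⊎-dec (b + c ≈? 0) ⊎-dec (a + (b + c) ≈? 0))
    ⊎-dec three? a b c ⊎-dec three? a c b ⊎-dec three? b a c ⊎-dec three? b c a ⊎-dec three? c a b ⊎-dec three? c b a) n) n) n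

  OrderOfLength : ℕ → Set
  OrderOfLength l = ∀ {g ts} → SmoothBy g ts → ZeroFree ts → length ts ≡ l → Order g

  private
    fits : OrderOfLength l → length ts ≡ l → ZeroFree ts → SmoothBy g ts → FreeForm ts
    fits order l≡ zf S = free-form S zf (order S zf l≡)

    r : ∀ x → x % n < n
    r x = m%n<n x n

  pairs-free : PairsSmooth → OrderOfLength 2 → ∀ ts → Bounded B ts → SumFree n n ts → length ts ≡ 2 → FreeForm ts
  pairs-free check order (a ∷ b ∷ []) bd free refl =
    let zf = sumFree⇒zeroFree (positive-terms bd) free in
    case check (r a) (r b) of λ where
      (inj₁ (inj₁ e)) → contradiction (≈-trans (≈-sym (%-≈ a)) e) (zeroFree zf ∈Σ₁-head)
      (inj₁ (inj₂ (inj₁ e))) → contradiction (≈-trans (≈-sym (%-≈ b)) e) (zeroFree zf (∈Σ₁-skip ∈Σ₁-head))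
      (inj₁ (inj₂ (inj₂ e))) → contradiction (≈-trans (≈-sym (%-≈ a ⊞ %-≈ b)) e) (zeroFree zf (∈Σ₁-take (Σ₁⇒Σ₀ ∈Σ₁-head)))
      (inj₂ (inj₁ t)) → fits order refl zf (SmoothBy-↭ (swap b a refl) (smooth-two (two-≈ t) (%-≈ a)))
      (inj₂ (inj₂ t)) → fits order refl zf (smooth-two (two-≈ t) (%-≈ b))
    where
    two-≈ : ∀ {g b} → Two g (b % n) → Two g b
    two-≈ {g} {b} (y , y< , 1≤y , e) = y , y< , 1≤y , ≈-trans e (%-≈ b)

  triples-free : TriplesSmooth → OrderOfLength 3 → ∀ ts → Bounded B ts → SumFree n n ts → length ts ≡ 3 → FreeForm ts
  triples-free check order (a ∷ b ∷ c ∷ []) bd free refl =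
    let zf = sumFree⇒zeroFree (positive-terms bd) free
        bad : ∀ {x y} → x ∈Σ₁ (a ∷ b ∷ c ∷ []) → y ≈ x → y ≈ 0 → FreeForm (a ∷ b ∷ c ∷ [])
        bad = λ x∈ y≈x y≈0 → contradiction (≈-trans (≈-sym y≈x) y≈0) (zeroFree zf x∈)
        good : ∀ {x y z} → z ∷ y ∷ x ∷ [] ↭ a ∷ b ∷ c ∷ [] → Three (x % n) (y % n) (z % n) → FreeForm (a ∷ b ∷ c ∷ [])
        good = λ {x} σ t → fits order refl zf (SmoothBy-↭ σ (smooth-three (three-≈ t) (%-≈ x)))
    in case check (r a) (r b) (r c) of λ where
      (inj₁ (inj₁ e)) → bad ∈Σ₁-head (%-≈ a) e
      (inj₁ (inj₂ (inj₁ e))) → bad (∈Σ₁-skip ∈Σ₁-head) (%-≈ b) e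
      (inj₁ (inj₂ (inj₂ (inj₁ e)))) → bad (∈Σ₁-skip (∈Σ₁-skip ∈Σ₁-head)) (%-≈ c) e
      (inj₁ (inj₂ (inj₂ (inj₂ (inj₁ e))))) → bad (∈Σ₁-take (Σ₁⇒Σ₀ ∈Σ₁-head)) (%-≈ a ⊞ %-≈ b) e
      (inj₁ (inj₂ (inj₂ (inj₂ (inj₂ (inj₁ e)))))) → bad (∈Σ₁-take (Σ₁⇒Σ₀ (∈Σ₁-skip ∈Σ₁-head))) (%-≈ a ⊞ %-≈ c) e
      (inj₁ (inj₂ (inj₂ (inj₂ (inj₂ (inj₂ (inj₁ e))))))) → bad (∈Σ₁-skip (∈Σ₁-take (Σ₁⇒Σ₀ ∈Σ₁-head))) (%-≈ b ⊞ %-≈ c) e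
      (inj₁ (inj₂ (inj₂ (inj₂ (inj₂ (inj₂ (inj₂ e))))))) →
        bad (∈Σ₁-take (Σ₁⇒Σ₀ (∈Σ₁-take (Σ₁⇒Σ₀ ∈Σ₁-head)))) (%-≈ a ⊞ (%-≈ b ⊞ %-≈ c)) e
      (inj₂ (inj₁ t)) → good {a} {b} {c} (trans (swap c b refl) (trans (prep b (swap c a refl)) (swap b a refl))) t
      (inj₂ (inj₂ (inj₁ t))) → good {a} {c} {b} (trans (prep b (swap c a refl)) (swap b a refl)) t
      (inj₂ (inj₂ (inj₂ (inj₁ t)))) → good {b} {a} {c} (trans (swap c a refl) (prep a (swap c b refl))) t
      (inj₂ (inj₂ (inj₂ (inj₂ (inj₁ t))))) → good {b} {c} {a} (prep a (swap c b refl)) t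
      (inj₂ (inj₂ (inj₂ (inj₂ (inj₂ (inj₁ t)))))) → good {c} {a} {b} (swap b a refl) t
      (inj₂ (inj₂ (inj₂ (inj₂ (inj₂ (inj₂ t)))))) → good {c} {b} {a} refl t
    where
    three-≈ : ∀ {g b c} → Three g (b % n) (c % n) → Three g b c
    three-≈ {g} {b} {c} (y , y< , (1≤y , e) , z , z< , 1≤z , f) =
      y , y< , (1≤y , ≈-trans e (%-≈ b)) , z , z< , 1≤z , ≈-trans f (%-≈ c)

  least-free-at : FreeSmooth B (suc l) → (1 ≤ l → ¬ FreeSmooth B l) → LeastPositive (FreeSmooth B) (suc l)
  least-free-at p below = s≤s z≤n , p , λ j 1≤j pj → ≰⇒> λ j≤u → below (≤-trans 1≤j j≤u)
    λ ts bd free l≤ → pj ts bd free (≤-trans j≤u l≤)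

  least-minimal-at : MinimalSmooth B (suc l) → (1 ≤ l → ¬ MinimalSmooth B l) → LeastPositive (MinimalSmooth B) (suc l)
  least-minimal-at p below = s≤s z≤n , p , λ j 1≤j pj → ≰⇒> λ j≤u → below (≤-trans 1≤j j≤u)
    λ ts bd min l≤ → pj ts bd min (≤-trans j≤u l≤)

  Result : ℕ → ℕ → ℕ → Set
  Result B Smo Ŝmo = LeastPositive (MinimalSmooth B) Smo × LeastPositive (FreeSmooth B) Ŝmo

  values : ∀ v → n ≤ suc (2 * suc v) → FreeSmooth B (suc v) → (1 ≤ v → ¬ FreeSmooth B v) → ¬ MinimalSmooth B (suc v) → Result B (2 + v) (suc v)
  values v n≤ free ¬free ¬min = least-minimal-at (minimal-smooth n≤ free) (λ _ → ¬min) , least-free-at free ¬free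

  not-minimal-one : ¬ Complete (n ∷ []) → n ≤ B → ¬ MinimalSmooth B 1
  not-minimal-one incomplete n≤B f
    with f (n ∷ []) ((>-nonZero⁻¹ n , n≤B) ∷ []) (minimal-∷ [] (λ ()) (∣m∣n⇒∣m+n ∣-refl (divides 0 refl)) (>-nonZero⁻¹ n)) ≤-refl
  ... | _ , _ , smoothBy (m ∷ []) (_ ∷ []) _ comp , N≡ = incomplete (subst (λ m → Complete (m ∷ [])) (≡.trans (sym (+-identityʳ m)) N≡) comp)

  prime-values : (∀ {d} → d < n → d ∣ n → d ≤ 1) → n ≤ 3 → ¬ Complete (n ∷ []) → n ≤ B → Result B 2 1
  prime-values prime n≤3 incomplete n≤B = values 0 n≤3
    (FreeSmooth-step (long-free {l = 2} (s≤s n≤3)) (singleton-free prime)) (λ ())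
    (not-minimal-one incomplete n≤B)

private
  prime : ∀ n → True (allUpTo? (λ d → (d ∣? n) →-dec (d ≤? 1)) n) → ∀ {d} → d < n → d ∣ n → d ≤ 1
  prime n = toWitness

  -- Two terms have at most three nonempty subset sums.
  two-terms-incomplete : ∀ N → True (allUpTo? (λ m → allUpTo? (λ m′ → (m + (m′ + 0) ≟ N) →-dec ¬? (complete? (m ∷ m′ ∷ []))) (suc N)) (suc N)) →
                         ∀ {m m′} → m + (m′ + 0) ≡ N → ¬ Complete (m ∷ m′ ∷ [])
  two-terms-incomplete N t {m} {m′} e = toWitness t
    (s≤s (≤-trans (m≤m+n m _) (≤-reflexive e))) (s≤s (≤-trans (≤-trans (m≤m+n m′ 0) (m≤n+m _ m)) (≤-reflexive e))) e

module Period4 where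
  open Congruence 4
  open LongZeroFree 4
  open ShortIndex 4
  open SmallLength 4

  -- The residue 2 has order 2 modulo 4, so its coefficient with respect to an element of order 4 is
  -- at least 2, and the value 1 is missed.
  not-two : 4 ≤ B → ¬ FreeSmooth B 1
  not-two 4≤B f with f (2 ∷ []) ((s≤s z≤n , ≤-trans (≤ᵇ⇒≤ 2 4 _) 4≤B) ∷ []) (few-twos-free {1} (≤ᵇ⇒≤ 3 4 _)) ≤-refl
  ... | g , order , smoothBy (m ∷ []) (e ∷ []) (1≤m ∷ []) comp , N<4 = check N<4 1≤m
    (order {2 * m} (*-mono-≤ {1} {2} {1} {m} z<s 1≤m) (≈-trans (≈-reflexive (*-assoc 2 m g)) (≈-trans (2 ⊠ e) (residues refl)))) comp
    where
    check : ∀ {m} → m + 0 < 4 → 1 ≤ m → 4 ≤ 2 * m → ¬ Complete (m ∷ [])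
    check {m} m<4 = toWitness {a? = allUpTo? (λ m → (1 ≤? m) →-dec ((4 ≤? 2 * m) →-dec ¬? (complete? (m ∷ [])))) 4} tt
      (≤-trans (s≤s (m≤m+n m 0)) m<4)

  not-one-three : 4 ≤ B → ¬ MinimalSmooth B 2
  not-one-three 4≤B f with f (1 ∷ 3 ∷ []) ((s≤s z≤n , ≤-trans z<s 4≤B) ∷ (s≤s z≤n , ≤-trans (≤ᵇ⇒≤ 3 4 _) 4≤B) ∷ [])
      (minimal-∷ (s≤s z≤n ∷ []) (toWitness {a? = sumFree? 4 4 (3 ∷ [])} tt) (divides 1 refl) z<s) ≤-refl
  ... | g , order , smoothBy (m ∷ m′ ∷ []) (_ ∷ _ ∷ []) _ comp , N≡4 = two-terms-incomplete 4 tt N≡4 comp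

  values₄ : 4 ≤ B → Result B 3 2
  values₄ 4≤B = values 1 (≤ᵇ⇒≤ 4 5 _)
    (FreeSmooth-step (long-free {l = 3} (≤ᵇ⇒≤ 5 6 _))
      (pairs-free (toWitness {a? = pairsSmooth?} tt) λ S zf l≡ → smooth-order-long S zf (≤-reflexive (cong (2 *_) (sym l≡)))))
    (λ _ → not-two 4≤B) (not-one-three 4≤B)

module Period5 where
  open Congruence 5
  open ShortIndex 5
  open SmallLength 5

  not-one-four : 5 ≤ B → ¬ MinimalSmooth B 2
  not-one-four 5≤B f with f (1 ∷ 4 ∷ []) ((s≤s z≤n , ≤-trans z<s 5≤B) ∷ (s≤s z≤n , ≤-trans (≤ᵇ⇒≤ 4 5 _) 5≤B) ∷ [])
      (minimal-∷ (s≤s z≤n ∷ []) (toWitness {a? = sumFree? 5 5 (4 ∷ [])} tt) (divides 1 refl) z<s) ≤-refl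
  ... | g , order , smoothBy (m ∷ m′ ∷ []) (_ ∷ _ ∷ []) _ comp , N≡5 = two-terms-incomplete 5 tt N≡5 comp

  free₅ : FreeSmooth B 2
  free₅ = FreeSmooth-step (long-free {l = 3} (≤ᵇ⇒≤ 6 6 _))
    (pairs-free (toWitness {a? = pairsSmooth?} tt) λ S zf l≡ → divisors-order S zf (≤-trans z<s (≤-reflexive (sym l≡))) (prime 5 tt))

  -- Zero-sum free pairs and single terms are all smooth modulo 5, which lowers the free invariant
  -- to 1. But 1, 4 is minimal, and its three nonempty sums cannot fill five values; hence the
  -- exceptional gap of two.
  values₅ : 5 ≤ B → Result B 3 1
  values₅ 5≤B =
    least-minimal-at (minimal-smooth {l = 2} (≤ᵇ⇒≤ 5 5 _) free₅) (λ _ → not-one-four 5≤B) ,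
    least-free-at (FreeSmooth-step free₅ (singleton-free (prime 5 tt))) (λ ())

module Period7 where
  open Congruence 7
  open ShortIndex 7
  open SmallLength 7

  reduce : ∀ m → m * g ≈ a → m * (g % 7) ≈ a
  reduce {g} m e = ≈-trans (m ⊠ %-≈ g) e

  not-one-three : 7 ≤ B → ¬ FreeSmooth B 2
  not-one-three 7≤B f with f (1 ∷ 3 ∷ []) ((s≤s z≤n , ≤-trans z<s 7≤B) ∷ (s≤s z≤n , ≤-trans (≤ᵇ⇒≤ 3 7 _) 7≤B) ∷ [])
      (toWitness {a? = sumFree? 7 7 (1 ∷ 3 ∷ [])} tt) ≤-refl
  ... | g , order , smoothBy (m ∷ m′ ∷ []) (e ∷ e′ ∷ []) _ comp , N<7 =
    toWitness {a? = allUpTo? (λ g → allUpTo? (λ m → allUpTo? (λ m′ → (m * g ≈? 1) →-dec ((m′ * g ≈? 3) →-dec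
        ((m + (m′ + 0) <? 7) →-dec ¬? (complete? (m ∷ m′ ∷ []))))) 7) 7) 7} tt
      (m%n<n g 7) (≤-<-trans (m≤m+n m _) N<7) (≤-<-trans (≤-trans (m≤m+n m′ 0) (m≤n+m _ m)) N<7)
      (reduce m e) (reduce m′ e′) N<7 comp

  not-five-one-one : 7 ≤ B → ¬ MinimalSmooth B 3
  not-five-one-one 7≤B f with f (5 ∷ 1 ∷ 1 ∷ [])
      ((s≤s z≤n , ≤-trans (≤ᵇ⇒≤ 5 7 _) 7≤B) ∷ (s≤s z≤n , ≤-trans z<s 7≤B) ∷ (s≤s z≤n , ≤-trans z<s 7≤B) ∷ [])
      (minimal-∷ (s≤s z≤n ∷ s≤s z≤n ∷ []) (toWitness {a? = sumFree? 7 7 (1 ∷ 1 ∷ [])} tt) (divides 1 refl) z<s) ≤-refl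
  ... | g , order , smoothBy (l ∷ m ∷ m′ ∷ []) (_ ∷ e ∷ e′ ∷ []) _ comp , N≡7 =
    toWitness {a? = allUpTo? (λ g → allUpTo? (λ m → allUpTo? (λ m′ → allUpTo? (λ l → (l + (m + (m′ + 0)) ≟ 7) →-dec
        ((m * g ≈? 1) →-dec ((m′ * g ≈? 1) →-dec ¬? (complete? (l ∷ m ∷ m′ ∷ []))))) 8) 8) 8) 7} tt
      (m%n<n g 7) (s≤s (≤-trans (≤-trans (m≤m+n m _) (m≤n+m _ l)) (≤-reflexive N≡7)))
      (s≤s (≤-trans (≤-trans (≤-trans (m≤m+n m′ 0) (m≤n+m _ m)) (m≤n+m _ l)) (≤-reflexive N≡7)))
      (s≤s (≤-trans (m≤m+n l _) (≤-reflexive N≡7))) N≡7 (reduce m e) (reduce m′ e′) comp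

  values₇ : 7 ≤ B → Result B 4 3
  values₇ 7≤B = values 2 (≤ᵇ⇒≤ 7 7 _)
    (FreeSmooth-step (long-free {l = 4} (≤ᵇ⇒≤ 8 8 _))
      (triples-free (toWitness {a? = triplesSmooth?} tt) λ S zf l≡ → divisors-order S zf (≤-trans z<s (≤-reflexive (sym l≡))) (prime 7 tt)))
    (λ _ → not-one-three 7≤B) (not-five-one-one 7≤B)

-- Period 6 and periods from 8 on

module LargePeriod (n : ℕ) .{{_ : NonZero n}} where

  open Congruence n
  open ShortIndex n
  open SmallLength n

  private
    twos-one-of : ∀ p → All OneOf (replicate p 2)
    twos-one-of p = All.replicate⁺ p (inj₁ refl)

    -- One list serves both invariants. The lists used have sum n + 1, so putting n - 1 in front
    -- gives sum 2n and a minimal sequence one term longer.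
    lower : ∀ {ts} → n ≤ B → Bounded n ts → SumFree n n ts → Large ts → 1 ≤ length ts → All OneOf ts → length ts ≡ l →
            n ∣ pred n + sum ts → 2 ≤ n → (1 ≤ l → ¬ FreeSmooth B l) × ¬ MinimalSmooth B (suc l)
    lower {B = B} {ts = ts} n≤B bd free large 1≤l all refl n∣ 2≤n =
      (λ _ f → not-free-form large 1≤l all (f ts bd′ free ≤-refl)) ,
      λ f → not-minimal-form {a = pred n} large (inj₂ (inj₂ (suc-pred n)) ∷ all)
        (f (pred n ∷ ts) ((1≤pred , ≤-trans pred[n]≤n n≤B) ∷ bd′) (minimal-∷ (positive-terms bd) free n∣ 1≤pred) ≤-refl)
      where
      bd′ : Bounded B ts
      bd′ = All.map (λ (1≤t , t≤n) → 1≤t , ≤-trans t≤n n≤B) bd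
      1≤pred : 1 ≤ pred n
      1≤pred = s≤s⁻¹ (≤-trans 2≤n (≤-reflexive (sym (suc-pred n))))

    n∣pred : ∀ {s} → s ≡ suc n → n ∣ pred n + s
    n∣pred refl = divides 2 (≡.trans (+-suc (pred n) n) (≡.trans (cong (_+ n) (suc-pred n)) (cong (n +_) (sym (+-identityʳ n)))))

  even-values : 2 ≤ p → n ≡ 2 + p * 2 → n ≤ B → Result B (3 + p) (2 + p)
  even-values {p} 2≤p n≡ n≤B = values (suc p) (≤-trans (≤-reflexive n≡) (arith₁ p)) (long-free (≤-trans (≤-reflexive (cong suc n≡)) (arith₂ p)))
    (proj₁ bounds) (proj₂ bounds)
    where
    arith₁ : ∀ p → 2 + p * 2 ≤ suc (2 * (2 + p))
    arith₁ p = lin 3 (z≤n {0}) (solve (p & []))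
    arith₂ : ∀ p → suc (2 + p * 2) ≤ 2 * (2 + p)
    arith₂ p = lin 1 (z≤n {0}) (solve (p & []))
    6≤n : 6 ≤ n
    6≤n = ≤-trans (+-monoʳ-≤ 2 (*-monoˡ-≤ 2 2≤p)) (≤-reflexive (sym n≡))
    2≤n : 2 ≤ n
    2≤n = ≤-trans (≤ᵇ⇒≤ 2 6 _) 6≤n
    bounds : (1 ≤ suc p → ¬ FreeSmooth _ (suc p)) × ¬ MinimalSmooth _ (2 + p)
    bounds = lower n≤B ((s≤s z≤n , ≤-trans (≤ᵇ⇒≤ 3 6 _) 6≤n) ∷ bounded-twos 2≤n p)
      (three-twos-free ∣-refl 2≤n (sym n≡)) (λ order → even-large 2≤p n≡ order) z<s (inj₂ (inj₁ refl) ∷ twos-one-of p)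
      (cong suc (length-replicate p)) (n∣pred (cong suc (≡.trans (cong (2 +_) (sum-replicate-two p)) (sym n≡)))) 2≤n

  odd-values : 2 ≤ p → n ≡ 5 + p * 2 → n ≤ B → Result B (4 + p) (3 + p)
  odd-values {p} 2≤p n≡ n≤B = values (2 + p) (≤-trans (≤-reflexive n≡) (arith₁ p)) (long-free (≤-trans (≤-reflexive (cong suc n≡)) (arith₂ p)))
    (proj₁ bounds) (proj₂ bounds)
    where
    arith₁ : ∀ p → 5 + p * 2 ≤ suc (2 * (3 + p))
    arith₁ p = lin 2 (z≤n {0}) (solve (p & []))
    arith₂ : ∀ p → suc (5 + p * 2) ≤ 2 * (3 + p)
    arith₂ p = lin 0 (z≤n {0}) (solve (p & []))
    9≤n : 9 ≤ n
    9≤n = ≤-trans (+-monoʳ-≤ 5 (*-monoˡ-≤ 2 2≤p)) (≤-reflexive (sym n≡))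
    2≤n : 2 ≤ n
    2≤n = ≤-trans (≤ᵇ⇒≤ 2 9 _) 9≤n
    3≤n : 3 ≤ n
    3≤n = ≤-trans (≤ᵇ⇒≤ 3 9 _) 9≤n
    bounds : (1 ≤ 2 + p → ¬ FreeSmooth _ (2 + p)) × ¬ MinimalSmooth _ (3 + p)
    bounds = lower n≤B ((s≤s z≤n , 3≤n) ∷ (s≤s z≤n , 3≤n) ∷ bounded-twos 2≤n p)
      (two-threes-free n≡) (λ _ → odd-large 2≤p n≡) z<s (inj₂ (inj₁ refl) ∷ inj₂ (inj₁ refl) ∷ twos-one-of p)
      (cong (2 +_) (length-replicate p)) (n∣pred (≡.trans (cong (6 +_) (sum-replicate-two p)) (cong suc (sym n≡)))) 2≤n

ShortIndexValues : (n Smo Ŝmo : ℕ) → Set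
ShortIndexValues n Smo Ŝmo =
  (n ≡ 5 → Smo ≡ 3 × Ŝmo ≡ 1) ×
  (n ≢ 5 →
    Smo ∸ 1 ≡ Ŝmo ×
    (n ≤ 4 ⊎ n ≡ 7 → Ŝmo ≡ ⌊ n /2⌋) ×
    (n ≡ 6 ⊎ 8 ≤ n → Ŝmo ≡ ⌊ n /2⌋ + 1))

short-index-invariants : ∀ n .{{_ : NonZero n}} → 2 ≤ n → n ≤ B →
                         ∃₂ λ Smo Ŝmo → SmallLength.Result n B Smo Ŝmo × ShortIndexValues n Smo Ŝmo
short-index-invariants 0 () _
short-index-invariants 1 (s≤s ()) _
short-index-invariants 2 _ n≤B = 2 , 1 , SmallLength.prime-values 2 (prime 2 tt) (≤ᵇ⇒≤ 2 3 _) (toWitnessFalse {a? = complete? (2 ∷ [])} tt) n≤B , (λ ()) , λ _ → refl , (λ _ → refl) ,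
  λ { (inj₁ ()) ; (inj₂ (s≤s (s≤s ()))) }
short-index-invariants 3 _ n≤B = 2 , 1 , SmallLength.prime-values 3 (prime 3 tt) ≤-refl (toWitnessFalse {a? = complete? (3 ∷ [])} tt) n≤B , (λ ()) , λ _ → refl , (λ _ → refl) ,
  λ { (inj₁ ()) ; (inj₂ (s≤s (s≤s (s≤s ())))) }
short-index-invariants 4 _ n≤B = 3 , 2 , Period4.values₄ n≤B , (λ ()) , λ _ → refl , (λ _ → refl) ,
  λ { (inj₁ ()) ; (inj₂ (s≤s (s≤s (s≤s (s≤s ()))))) }
short-index-invariants 5 _ n≤B = 3 , 1 , Period5.values₅ n≤B , (λ _ → refl , refl) , λ 5≢5 → contradiction refl 5≢5
short-index-invariants n@(suc (suc (suc (suc (suc (suc m)))))) _ n≤B with even-or-odd m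
... | h , inj₁ refl = 5 + h , 4 + h , LargePeriod.even-values n {2 + h} (s≤s z<s) refl n≤B ,
  (λ ()) , λ _ → refl ,
  (λ { (inj₁ (s≤s (s≤s (s≤s (s≤s ()))))) ; (inj₂ n≡7) → contradiction (sym n≡7) (odd≢even 3 (3 + h)) }) ,
  λ _ → cong (3 +_) (≡.trans (+-comm 1 h) (cong (_+ 1) (sym (⌊double/2⌋ h))))
... | zero , inj₂ refl = 4 , 3 , Period7.values₇ n≤B , (λ ()) , λ _ → refl , (λ _ → refl) ,
  λ { (inj₁ ()) ; (inj₂ (s≤s (s≤s (s≤s (s≤s (s≤s (s≤s (s≤s ())))))))) }
... | suc h , inj₂ refl = 6 + h , 5 + h , LargePeriod.odd-values n {2 + h} (s≤s z<s) refl n≤B ,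
  (λ ()) , λ _ → refl ,
  (λ { (inj₁ (s≤s (s≤s (s≤s (s≤s ()))))) ; (inj₂ ()) }) ,
  λ _ → cong (4 +_) (≡.trans (+-comm 1 h) (cong (_+ 1) (sym (⌊suc-double/2⌋ h))))

-- Smoothness in terms of coefficients

open import Data.Integer.Base as ℤ using (ℤ; +_; 0ℤ; 1ℤ)
import Data.Integer.DivMod as ℤ
import Data.Integer.Divisibility.Signed as ℤ
import Data.Integer.Properties as ℤ
import Data.Integer.Tactic.RingSolver as ℤ
open import Data.List.NonEmpty.Base using (_∷_)
open import Data.List.Relation.Binary.Sublist.Propositional using (_⊆_; []; _∷_; _∷ʳ_; ⊆-refl)
import Data.List.Relation.Binary.Permutation.Setoid as Permutation
open import Data.List.Relation.Unary.Linked using (Linked)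
open import Data.List.Relation.Unary.Linked.Properties using (Linked⇒All)
open import Data.List.Sort ≤-decTotalOrder using (sort; sort-↭; sort-↗)
open import Function.Bundles using (mk⇔; Equivalence)
open import Level using (Level) renaming (_⊔_ to _⊔ˡ_)

private
  variable
    o ℓ : Level

Additive : (S : CommutativeSemigroup o ℓ) → (ℕ → CommutativeSemigroup.Carrier S) → Set ℓ
Additive S μ = ∀ {t u} → 1 ≤ t → 1 ≤ u → μ (t + u) ≈ μ t ∙ μ u
  where open CommutativeSemigroup S

module Subsums (S : CommutativeSemigroup o ℓ) (μ : ℕ → CommutativeSemigroup.Carrier S) (μ-+ : Additive S μ) where

  open CommutativeSemigroup S hiding (refl; sym; trans)
  private module ≈ = CommutativeSemigroup S
  open Sequences S

  -- A semigroup need not have a neutral element, so the empty sublist has no sum there and is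
  -- paired with 0 separately.
  data Value : List Carrier → ℕ → Set (o ⊔ˡ ℓ) where
    none : Value [] 0
    some : ∀ {v vs x} → 1 ≤ x → σ (v ∷ vs) ≈ μ x → Value (v ∷ vs) x

  Value-∷ : ∀ {t a V x} → 1 ≤ t → μ t ≈ a → Value V x → Value (a ∷ V) (t + x)
  Value-∷ {t} 1≤t e none = some (≤-trans 1≤t (m≤m+n t 0)) (≈.trans (≈.sym e) (≈.reflexive (cong μ (sym (+-identityʳ t)))))
  Value-∷ {t} 1≤t e (some 1≤x f) = some (≤-trans 1≤t (m≤m+n t _)) (≈.trans (≈.∙-cong (≈.sym e) f) (≈.sym (μ-+ 1≤t 1≤x)))

  Represents : List Carrier → List ℕ → Set (o ⊔ˡ ℓ)
  Represents = Pointwise (λ a t → μ t ≈ a)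

  sublist-sum : ∀ {T ts V} → Represents T ts → All (1 ≤_) ts → V ⊆ T → ∃[ x ] SumOf ts (length V) x × Value V x
  sublist-sum [] [] [] = 0 , nil , none
  sublist-sum (_ ∷ pw) (_ ∷ pos) (_ ∷ʳ sub) = let x , p , v = sublist-sum pw pos sub in x , skip p , v
  sublist-sum (e ∷ pw) (1≤t ∷ pos) (refl ∷ sub) =
    let x , p , v = sublist-sum pw pos sub in _ , take p , Value-∷ 1≤t e v

  sum-sublist : ∀ {T ts d x} → Represents T ts → All (1 ≤_) ts → SumOf ts d x → ∃[ V ] V ⊆ T × length V ≡ d × Value V x
  sum-sublist [] [] nil = [] , [] , refl , none
  sum-sublist (_ ∷ pw) (_ ∷ pos) (skip p) = let V , sub , l , v = sum-sublist pw pos p in V , _ ∷ʳ sub , l , v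
  sum-sublist (e ∷ pw) (1≤t ∷ pos) (take p) =
    let V , sub , l , v = sum-sublist pw pos p in _ ∷ V , refl ∷ sub , cong suc l , Value-∷ 1≤t e v

module SmoothCoefficients (G : AbelianGroup o ℓ) where

  open AbelianGroup G hiding (refl; sym; trans)
  private module ≈ = AbelianGroup G
  open Algebra.Definitions.RawMonoid rawMonoid using () renaming (_×_ to _·_)
  open Algebra.Properties.Monoid.Mult monoid using (×-homo-+)
  module ↭ₛ = Permutation setoid
  open ↭ₛ using () renaming (_↭_ to _↭ₛ_)
  open Sequences commutativeSemigroup using (_∈Σ_)
  open Smoothness G

  module _ (g : Carrier) where

    open Subsums commutativeSemigroup (_· g) (λ {t} {u} _ _ → ×-homo-+ g t u)

    record Coefficients (T : List Carrier) (N : ℕ) : Set (o ⊔ˡ ℓ) where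
      constructor coefficients
      field
        list       : List ℕ
        represents : Represents T list
        positive   : All (1 ≤_) list
        complete   : Complete list
        total      : sum list ≡ N
        1≤N        : 1 ≤ N

    private
      represents-↭ₛ : ∀ {T ys} → Represents T ys → map (_· g) ys ↭ₛ T
      represents-↭ₛ pw = ↭ₛ.refl (go pw)
        where
        go : ∀ {T ys} → Represents T ys → Pointwise _≈_ (map (_· g) ys) T
        go [] = []
        go (e ∷ pw) = e ∷ go pw

      ↭ₛ-represents : ∀ {S T ys} → Represents S ys → S ↭ₛ T → ∃[ zs ] ys ↭ zs × Represents T zs
      ↭ₛ-represents pw (↭ₛ.refl es) = _ , refl , go pw es
        where
        go : ∀ {S T ys} → Represents S ys → Pointwise _≈_ S T → Represents T ys
        go [] [] = []
        go (e ∷ pw) (f ∷ es) = ≈.trans e f ∷ go pw es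
      ↭ₛ-represents (e ∷ pw) (↭ₛ.prep f σ) = let zs , τ , qw = ↭ₛ-represents pw σ in _ , prep _ τ , ≈.trans e f ∷ qw
      ↭ₛ-represents (e ∷ e′ ∷ pw) (↭ₛ.swap f f′ σ) =
        let zs , τ , qw = ↭ₛ-represents pw σ in _ , swap _ _ τ , ≈.trans e′ f′ ∷ ≈.trans e f ∷ qw
      ↭ₛ-represents pw (↭ₛ.trans σ σ′) =
        let zs , τ , qw = ↭ₛ-represents pw σ ; ws , τ′ , rw = ↭ₛ-represents qw σ′ in ws , trans τ τ′ , rw

      canonical : ∀ ys → Represents (map (_· g) ys) ys
      canonical [] = []
      canonical (y ∷ ys) = ≈.refl ∷ canonical ys

      -- A sum equal to 1 uses a term that is at most 1, and the first term of a sorted list is no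
      -- larger.
      sorted-head : ∀ zs → Linked _≤_ zs → All (1 ≤_) zs → ∀ {d y} → y ≡ 1 → SumOf zs d y → ∃[ ns ] zs ≡ 1 ∷ ns
      sorted-head (z ∷ zs) sorted (1≤z ∷ pos) y≡1 p = zs , cong (_∷ zs) (≤-antisym z≤1 1≤z)
        where
        below : ∀ {zs d y} → All (z ≤_) zs → All (1 ≤_) zs → y ≡ 1 → SumOf zs d y → z ≤ 1
        below (_ ∷ z≤) (_ ∷ pos) y≡1 (skip p) = below z≤ pos y≡1 p
        below (z≤a ∷ _) (_ ∷ _) y≡1 (take {a = a} p) = ≤-trans z≤a (≤-trans (m≤m+n a _) (≤-reflexive y≡1))
        z≤1 : z ≤ 1
        z≤1 = below (Linked⇒All ≤-trans ≤-refl sorted) (1≤z ∷ pos) y≡1 p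
      sorted-head [] _ _ () nil

    smooth-of-coefficients : ∀ {T N} → Coefficients T N → N ≤ord g → SmoothOfSum g T N
    smooth-of-coefficients {T} {N} (coefficients ys pw pos comp total 1≤N) N≤ord = from-sorted (sort ys) (sort-↭ ys) (sort-↗ ys)
      where
      from-sorted : ∀ zs → zs ↭ ys → Linked _≤_ zs → SmoothOfSum g T N
      from-sorted zs σ sorted with sorted-head zs sorted (All-resp-↭ (↭-sym σ) pos) refl
        (SumOf-↭ (↭-sym σ) (proj₂ (comp 1 (subst (1 ≤_) (sym total) 1≤N))))
      ... | ns , refl =
        ns , sorted , ↭ₛ.trans (↭⇒↭ₛ′ isEquivalence (map⁺ (_· g) σ)) (represents-↭ₛ pw) ,
        sym (≡.trans (sum-↭ σ) total) , N≤ord , λ x → mk⇔ to from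
        where
        to : ∀ {x} → x ∈Σ T → ∃[ j ] 1 ≤ j × j ≤ N × x ≈ j · g
        to (u ∷ us , sub , e) with sublist-sum pw pos sub
        ... | j , p , some 1≤j f = j , 1≤j , ≤-trans (SumOf≤sum p) (≤-reflexive total) , ≈.trans (≈.sym e) f
        from : ∀ {x} → (∃[ j ] 1 ≤ j × j ≤ N × x ≈ j · g) → x ∈Σ T
        from (j , 1≤j , j≤ , e) with sum-sublist pw pos (proj₂ (comp j (≤-trans j≤ (≤-reflexive (sym total)))))
        ... | [] , _ , _ , none = contradiction 1≤j λ ()
        ... | v ∷ vs , sub , _ , some _ f = v ∷ vs , sub , ≈.trans f (≈.sym e)

    -- Sums in the group only tell that i·g ≈ j·g for a sum i of coefficients. Since N does not
    -- exceed the order, the multiples g, 2g, ..., Ng are distinct, and i = j follows.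
    coefficients-of-smooth : ∀ {T N} → SmoothOfSum g T N → Coefficients T N
    coefficients-of-smooth {T} {N} (ns , sorted , σ , N≡ , N≤ord , sums) with ↭ₛ-represents (canonical (1 ∷ ns)) σ
    ... | ys , τ , pw = coefficients ys pw pos complete total (≤-trans z<s (≤-reflexive (sym N≡)))
      where
      total : sum ys ≡ N
      total = ≡.trans (sym (sum-↭ τ)) (sym N≡)
      pos : All (1 ≤_) ys
      pos = All-resp-↭ τ (Linked⇒All ≤-trans ≤-refl sorted)
      no-shorter : ∀ {i j} → 1 ≤ i → i < j → j ≤ N → ¬ i · g ≈ j · g
      no-shorter {i} 1≤i i<j j≤N e with d , refl ← excess i<j =
        <⇒≱ (≤-trans (s≤s (m<n+m d 1≤i)) j≤N) (N≤ord (suc d) z<s (≈.sym (∙-cancelˡ (i · g) ε (suc d · g)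
          (≈.trans (identityʳ (i · g)) (≈.trans e (≈.trans (≈.reflexive (cong (_· g) (sym (+-suc i d)))) (×-homo-+ g i (suc d))))))))
        where open import Algebra.Properties.Group group using (∙-cancelˡ)
      complete : Complete ys
      complete zero _ = 0 , emptySum ys
      complete j@(suc _) j≤ with Equivalence.from (sums (j · g)) (j , s≤s z≤n , ≤-trans j≤ (≤-reflexive total) , ≈.refl)
      ... | u ∷ us , sub , e with sublist-sum pw pos sub
      ...   | i , p , some 1≤i f with <-cmp i j
      ...     | tri≈ _ refl _ = _ , p
      ...     | tri< i<j _ _ = contradiction (≈.trans (≈.sym f) e) (no-shorter 1≤i i<j (≤-trans j≤ (≤-reflexive total)))
      ...     | tri> _ _ j<i = contradiction (≈.trans (≈.sym e) f) (no-shorter z<s j<i (≤-trans (SumOf≤sum p) (≤-reflexive total)))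

-- Smoothness over the integers and modulo n

module IntegerSmooth where

  open Smoothness ℤ.+-0-abelianGroup
  open SmoothCoefficients ℤ.+-0-abelianGroup
  open Algebra.Definitions.RawMonoid (AbelianGroup.rawMonoid ℤ.+-0-abelianGroup) using () renaming (_×_ to _·_)

  multiple-of-1 : ∀ y → y · 1ℤ ≡ + y
  multiple-of-1 zero = refl
  multiple-of-1 (suc y) = cong (λ z → 1ℤ ℤ.+ z) (multiple-of-1 y)

  complete⇒smooth : All (1 ≤_) ts → 1 ≤ length ts → Complete ts → Smooth 1ℤ (map +_ ts)
  complete⇒smooth {ts} pos 1≤l comp = sum ts ,
    smooth-of-coefficients 1ℤ (coefficients ts (go ts) pos comp refl (≤-trans 1≤l (length≤sum pos))) (λ m 1≤m e → contradiction e (infinite 1≤m)) ,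
    λ m 1≤m e → contradiction e (infinite 1≤m)
    where
    go : ∀ ts → Pointwise (λ t y → y · 1ℤ ≡ t) (map +_ ts) ts
    go [] = []
    go (t ∷ ts) = multiple-of-1 t ∷ go ts
    infinite : ∀ {m} → 1 ≤ m → m · 1ℤ ≢ 0ℤ
    infinite {suc m} _ e with () ← ≡.trans (sym (multiple-of-1 (suc m))) e

  smooth⇒complete : Smooth 1ℤ (map +_ ts) → Complete ts
  smooth⇒complete {ts} (N , smooth , _) with coefficients-of-smooth 1ℤ smooth
  ... | coefficients ys pw _ comp _ _ = subst Complete (go ts pw) comp
    where
    go : ∀ ts {ys} → Pointwise (λ t y → y · 1ℤ ≡ t) (map +_ ts) ys → ys ≡ ts
    go [] [] = refl
    go (t ∷ ts) {y ∷ _} (e ∷ pw) = cong₂ _∷_ (ℤ.+-injective (≡.trans (sym (multiple-of-1 y)) e)) (go ts pw)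

module ResidueSmooth (n : ℕ) .{{_ : NonZero n}} where

  open Congruence n
  open ShortIndex n using (Order; FreeForm; MinimalForm; n*g≈0)
  open AbelianGroup (ℤ/ n ℤ) using () renaming (refl to ≡ₙ-refl; sym to ≡ₙ-sym; trans to ≡ₙ-trans; reflexive to ≡ₙ-reflexive)
  open Smoothness (ℤ/ n ℤ)
  open SmoothCoefficients (ℤ/ n ℤ)
  open Algebra.Definitions.RawMonoid (AbelianGroup.rawMonoid (ℤ/ n ℤ)) using () renaming (_×_ to _·_)

  private
    infix 4 _≋_
    _≋_ : ℤ → ℤ → Set
    _≋_ = _≡ₙ_ n

  ≈⇒≡ₙ : ∀ {a b} → a ≈ b → + a ≋ + b
  ≈⇒≡ₙ {a} {b} e = congruent (ℤ.divides (+ (a / n) ℤ.- + (b / n)) (≡.trans (cancel (+ a) (+ b) (+ (b / n * n)) (+ (a / n * n)) shifted)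
    (≡.trans (cong₂ ℤ._-_ (ℤ.pos-* (a / n) n) (ℤ.pos-* (b / n) n)) (distrib (+ (a / n)) (+ (b / n)) (+ n)))))
    where
    shifted : + a ℤ.+ + (b / n * n) ≡ + b ℤ.+ + (a / n * n)
    shifted = ≡.trans (sym (ℤ.pos-+ a (b / n * n))) (≡.trans (cong +_ (multiple-shift e)) (ℤ.pos-+ b (a / n * n)))
    cancel : ∀ a b p q → a ℤ.+ p ≡ b ℤ.+ q → a ℤ.- b ≡ q ℤ.- p
    cancel a b p q e = ≡.trans (left a b p) (≡.trans (cong (λ x → x ℤ.- b ℤ.- p) e) (right b p q))
      where
      left : ∀ a b p → a ℤ.- b ≡ a ℤ.+ p ℤ.- b ℤ.- p
      left = ℤ.solve-∀
      right : ∀ b p q → b ℤ.+ q ℤ.- b ℤ.- p ≡ q ℤ.- p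
      right = ℤ.solve-∀
    distrib : ∀ q p n → q ℤ.* n ℤ.- p ℤ.* n ≡ (q ℤ.- p) ℤ.* n
    distrib = ℤ.solve-∀

  private
    ordered : ∀ {a b} → a ≤ b → + b ≋ + a → a ≈ b
    ordered {a} {b} a≤b (congruent d) with divides q b∸a≡ ← ℤ.∣⇒∣ᵤ d = shift-multiple {p = q} {q = 0} (≡.trans
      (cong (λ i → a + i) (≡.trans (sym b∸a≡) (≡.trans (cong ℤ.∣_∣ (ℤ.[+m]-[+n]≡m⊖n b a)) (cong ℤ.∣_∣ (ℤ.⊖-≥ a≤b)))))
      (≡.trans (m+[n∸m]≡n a≤b) (sym (+-identityʳ b))))

  ≡ₙ⇒≈ : ∀ {a b} → + a ≋ + b → a ≈ b
  ≡ₙ⇒≈ {a} {b} e with ≤-total a b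
  ... | inj₁ a≤b = ordered a≤b (≡ₙ-sym e)
  ... | inj₂ b≤a = ≈-sym (ordered b≤a e)

  multiple-residue : ∀ {g γ} → g ≋ + γ → ∀ y → y · g ≋ + (y * γ)
  multiple-residue e zero = ≡ₙ-refl
  multiple-residue {g} {γ} e (suc y) = ≡ₙ-trans
    (AbelianGroup.∙-cong (ℤ/ n ℤ) e (multiple-residue e y)) (≡ₙ-reflexive (sym (ℤ.pos-+ γ (y * γ))))

  -- A generator may be any integer, whereas `FreeForm` and `MinimalForm` take natural numbers; its
  -- residue serves instead.
  residue : ∀ g → g ≋ + (g ℤ.%ℕ n)
  residue g = congruent (ℤ.divides (g ℤ./ℕ n) (≡.trans (cong (ℤ._- + (g ℤ.%ℕ n)) (ℤ.a≡a%ℕn+[a/ℕn]*n g n)) (cancel (+ (g ℤ.%ℕ n)) (g ℤ./ℕ n ℤ.* + n))))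
    where
    cancel : ∀ r m → r ℤ.+ m ℤ.- r ≡ m
    cancel = ℤ.solve-∀

  module _ {g : ℤ} {γ : ℕ} (g≋γ : g ≋ + γ) where

    zero-multiple : ∀ m → m · g ≋ 0ℤ → m * γ ≈ 0
    zero-multiple m e = ≡ₙ⇒≈ (≡ₙ-trans (≡ₙ-sym (multiple-residue g≋γ m)) e)

    multiple-zero : ∀ m → m * γ ≈ 0 → m · g ≋ 0ℤ
    multiple-zero m e = ≡ₙ-trans (multiple-residue g≋γ m) (≈⇒≡ₙ e)

    ord-of-order : Order γ → n ≡ord g
    ord-of-order order = >-nonZero⁻¹ n , multiple-zero n (n*g≈0 γ) , λ m 1≤m e → order 1≤m (zero-multiple m e)

    order-of-ord : n ≡ord g → Order γ
    order-of-ord (_ , _ , least) {m} 1≤m e = least m 1≤m (multiple-zero m e)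

    smooth-of-form : 1 ≤ length ts → Order γ → (S : SmoothBy γ ts) → SmoothBy.total S ≤ n → SmoothOfSum g (map +_ ts) (SmoothBy.total S)
    smooth-of-form 1≤l order S@(smoothBy ys pw pos comp) N≤n = smooth-of-coefficients g
      (coefficients ys (go pw) pos comp refl (≤-trans 1≤l (SmoothBy.length≤total S))) λ m 1≤m e → ≤-trans N≤n (order 1≤m (zero-multiple m e))
      where
      go : ∀ {ys ts} → Pointwise (λ y t → y * γ ≈ t) ys ts → Pointwise (λ a y → y · g ≋ a) (map +_ ts) ys
      go [] = []
      go {y ∷ _} (e ∷ pw) = ≡ₙ-trans (multiple-residue g≋γ y) (≈⇒≡ₙ e) ∷ go pw

    form-of-smooth : ∀ {N} → SmoothOfSum g (map +_ ts) N → ∃[ S ] SmoothBy.total {γ} {ts} S ≡ N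
    form-of-smooth {ts} smooth with coefficients-of-smooth g smooth
    ... | coefficients ys pw pos comp total _ = smoothBy ys (go ts pw) pos comp , total
      where
      go : ∀ ts {ys} → Pointwise (λ a y → y · g ≋ a) (map +_ ts) ys → Pointwise (λ y t → y * γ ≈ t) ys ts
      go [] [] = []
      go (t ∷ ts) {y ∷ _} (e ∷ pw) = ≡ₙ⇒≈ (≡ₙ-trans (≡ₙ-sym (multiple-residue g≋γ y)) e) ∷ go ts pw

  free-form⇒smooth : 1 ≤ length ts → FreeForm ts → ∃[ g ] n ≡ord g × Smooth g (map +_ ts)
  free-form⇒smooth 1≤l (γ , order , S , N<n) = + γ , ord-of-order ≡ₙ-refl order , SmoothBy.total S ,
    smooth-of-form ≡ₙ-refl 1≤l order S (<⇒≤ N<n) , λ m 1≤m e → <-≤-trans N<n (order 1≤m (zero-multiple ≡ₙ-refl m e))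

  smooth⇒free-form : ∃[ g ] n ≡ord g × Smooth g (map +_ ts) → FreeForm ts
  smooth⇒free-form (g , ord , N , smooth , N<ord) =
    let S , total = form-of-smooth (residue g) smooth
    in g ℤ.%ℕ n , order-of-ord (residue g) ord , S , subst (_< n) (sym total) (N<ord n (proj₁ ord) (proj₁ (proj₂ ord)))

  minimal-form⇒smooth : 1 ≤ length ts → MinimalForm ts → ∃[ g ] n ≡ord g × ZeroSumSmooth g (map +_ ts)
  minimal-form⇒smooth 1≤l (γ , order , S , N≡n) = + γ , ord-of-order ≡ₙ-refl order , SmoothBy.total S ,
    smooth-of-form ≡ₙ-refl 1≤l order S (≤-reflexive N≡n) , subst (_≡ord (+ γ)) (sym N≡n) (ord-of-order ≡ₙ-refl order)

  smooth⇒minimal-form : ∃[ g ] n ≡ord g × ZeroSumSmooth g (map +_ ts) → MinimalForm ts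
  smooth⇒minimal-form (g , ord@(1≤n , n·g≋0 , least) , N , smooth , 1≤N , N·g≋0 , least′) =
    let S , total = form-of-smooth (residue g) smooth
    in g ℤ.%ℕ n , order-of-ord (residue g) ord , S , ≡.trans total (≤-antisym (least′ n 1≤n n·g≋0) (least N 1≤N N·g≋0))

-- Finite cyclic semigroups

module CyclicSemigroup {c ℓ} (S : CommutativeSemigroup c ℓ) (s : CommutativeSemigroup.Carrier S)
                       (k n : ℕ) .{{_ : NonZero k}} .{{_ : NonZero n}} (cyclic : IsCyclic S s k n) where

  open CommutativeSemigroup S hiding (refl; sym; trans)
  private module ≈ = CommutativeSemigroup S
  open Sequences S
  open Invariants S s k n
  open Smoothness using (Smooth; ZeroSumSmooth; _≡ord_)
  open IsCyclic cyclic

  private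
    variable
      T : List Carrier
      t u : ℕ

  ·-suc : ∀ t → 1 ≤ t → suc t · s ≈ s ∙ t · s
  ·-suc (suc t) _ = ≈.refl

  ·-+ : 1 ≤ t → 1 ≤ u → (t + u) · s ≈ t · s ∙ u · s
  ·-+ {suc zero} {u} _ 1≤u = ·-suc u 1≤u
  ·-+ {suc (suc t)} {u} _ 1≤u = ≈.trans (·-suc (suc t + u) z<s)
    (≈.trans (≈.∙-cong ≈.refl (·-+ {suc t} {u} z<s 1≤u)) (≈.sym (≈.assoc s (suc t · s) (u · s))))

  1≤k : 1 ≤ k
  1≤k = proj₁ index

  1≤n : 1 ≤ n
  1≤n = proj₁ period

  ·-cong-+ : ∀ j → 1 ≤ t → 1 ≤ u → t · s ≈ u · s → (t + j) · s ≈ (u + j) · s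
  ·-cong-+ {t} {u} zero _ _ e = ≈.trans (≈.reflexive (cong (_· s) (+-identityʳ t)))
    (≈.trans e (≈.reflexive (cong (_· s) (sym (+-identityʳ u)))))
  ·-cong-+ (suc j) 1≤t 1≤u e = ≈.trans (·-+ 1≤t z<s) (≈.trans (≈.∙-cong e ≈.refl) (≈.sym (·-+ 1≤u z<s)))

  add-period : k ≤ t → (t + n) · s ≈ t · s
  add-period k≤t with d , refl ← excess k≤t = ≈.trans
    (≈.reflexive (cong (_· s) (arith k d n)))
    (·-cong-+ d (≤-trans 1≤k (m≤m+n k n)) 1≤k (proj₁ (proj₂ period)))
    where
    arith : ∀ k d n → k + d + n ≡ k + n + d
    arith k d n = solve (k & d & n & [])

  add-periods : ∀ q → k ≤ t → (t + q * n) · s ≈ t · s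
  add-periods {t} zero k≤t = ≈.reflexive (cong (_· s) (+-identityʳ t))
  add-periods {t} (suc q) k≤t = ≈.trans (≈.reflexive (cong (_· s) (sym (+-assoc t n (q * n)))))
    (≈.trans (add-periods q (≤-trans k≤t (m≤m+n t n))) (add-period k≤t))

  -- The coincidence makes `t` a candidate for the index, so k ≤ t. Shifting it up to k + t n and
  -- removing whole periods gives (k + d) s = k s; the remainder of d modulo n then contradicts the
  -- minimality of the period unless it is 0.
  equal-multiples : ∀ d → 1 ≤ t → 1 ≤ d → t · s ≈ (t + d) · s → k ≤ t × n ∣ d
  equal-multiples {t} d 1≤t 1≤d e = k≤t , m%n≡0⇒n∣m d n (n≤0⇒n≡0 (≮⇒≥ no-remainder))
    where
    k≤t : k ≤ t
    k≤t = proj₂ (proj₂ index) t 1≤t (t + d , ≤-trans 1≤t (m≤m+n t d) , (λ t+d≡t → <⇒≢ (m<m+n t 1≤d) (sym t+d≡t)) , e)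
    shifted : (k + d) · s ≈ k · s
    shifted with j , t+j≡ ← excess {t} {k + t * n} (≤-trans (m≤m*n t n) (m≤n+m (t * n) k)) = ≈.sym (≈.trans
      (≈.sym (add-periods t ≤-refl))
      (≈.trans (≈.reflexive (cong (_· s) (sym t+j≡)))
      (≈.trans (·-cong-+ j 1≤t (≤-trans 1≤t (m≤m+n t d)) e)
      (≈.trans (≈.reflexive (cong (_· s) (≡.trans (arith t d j) (≡.trans (cong (_+ d) t+j≡) (arith k (t * n) d)))))
        (add-periods t (m≤m+n k d))))))
      where
      arith : ∀ t d j → t + d + j ≡ t + j + d
      arith t d j = solve (t & d & j & [])
    no-remainder : ¬ 0 < d % n
    no-remainder 0<r = <⇒≱ (m%n<n d n) (proj₂ (proj₂ period) (d % n) 0<r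
      (≈.trans (≈.sym (add-periods (d / n) (m≤m+n k (d % n))))
      (≈.trans (≈.reflexive (cong (_· s) (≡.trans (+-assoc k (d % n) (d / n * n)) (cong (λ i → k + i) (sym (m≡m%n+[m/n]*n d n)))))) shifted)))

  isInd : ∀ {a} → 1 ≤ t → t < k + n → t · s ≈ a → IsInd a t
  isInd {t} 1≤t t< e = 1≤t , e , λ j 1≤j f → ≮⇒≥ λ j<t → smaller j 1≤j (≈.trans f (≈.sym e)) j<t
    where
    smaller : ∀ j → 1 ≤ j → j · s ≈ t · s → ¬ j < t
    smaller j 1≤j f j<t with excess j<t
    ... | d , e′ with k≤j , n∣d ← equal-multiples (suc d) 1≤j z<s
          (≈.trans f (≈.reflexive (cong (_· s) (≡.trans (sym e′) (sym (+-suc j d)))))) =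
      <⇒≱ t< (≤-trans (+-mono-≤ k≤j (∣⇒≤ n∣d)) (≤-reflexive (≡.trans (+-suc j d) e′)))

  maxInd : ℕ
  maxInd = pred (k + n)

  suc-maxInd : suc maxInd ≡ k + n
  suc-maxInd = suc-pred (k + n) {{>-nonZero (≤-trans 1≤k (m≤m+n k n))}}

  ≤maxInd⇒< : t ≤ maxInd → t < k + n
  ≤maxInd⇒< t≤maxInd = ≤-trans (s≤s t≤maxInd) (≤-reflexive suc-maxInd)

  <⇒≤maxInd : t < k + n → t ≤ maxInd
  <⇒≤maxInd t< = s≤s⁻¹ (≤-trans t< (≤-reflexive (sym suc-maxInd)))

  ind : ∀ a → ∃[ t ] IsInd a t × 1 ≤ t × t ≤ maxInd
  ind a with generated a
  ... | t , 1≤t , e with t <? k + n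
  ...   | yes t< = t , isInd 1≤t t< e , 1≤t , <⇒≤maxInd t<
  ...   | no t≮ with d , refl ← excess (≤-trans (m≤m+n k n) (≮⇒≥ t≮)) =
    k + d % n , isInd 1≤r r< (≈.trans (≈.sym (add-periods (d / n) (m≤m+n k (d % n))))
      (≈.trans (≈.reflexive (cong (_· s) (≡.trans (+-assoc k (d % n) (d / n * n)) (cong (λ i → k + i) (sym (m≡m%n+[m/n]*n d n)))))) e))
    , 1≤r , <⇒≤maxInd r<
    where
    1≤r : 1 ≤ k + d % n
    1≤r = ≤-trans 1≤k (m≤m+n k _)
    r< : k + d % n < k + n
    r< = +-monoʳ-< k (m%n<n d n)

  ind-unique : ∀ {a} → IsInd a t → IsInd a u → t ≡ u
  ind-unique {t} {u} (1≤t , e , least) (1≤u , f , least′) = ≤-antisym (least u 1≤u f) (least′ t 1≤t e)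

  Indices : List Carrier → List ℕ → Set (c ⊔ˡ ℓ)
  Indices = Pointwise IsInd

  indices : ∀ T → ∃[ ts ] Indices T ts × Bounded maxInd ts
  indices [] = [] , [] , []
  indices (a ∷ T) = let t , i , b = ind a ; ts , is , bs = indices T in t ∷ ts , i ∷ is , b ∷ bs

  indices-unique : Indices T ts → Indices T us → ts ≡ us
  indices-unique [] [] = refl
  indices-unique (i ∷ is) (j ∷ js) = cong₂ _∷_ (ind-unique i j) (indices-unique is js)

  indices-of-multiples : Bounded maxInd ts → Indices (map (_· s) ts) ts
  indices-of-multiples [] = []
  indices-of-multiples ((1≤t , t≤maxInd) ∷ bs) = isInd 1≤t (≤maxInd⇒< t≤maxInd) ≈.refl ∷ indices-of-multiples bs

  open Subsums S (_· s) ·-+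

  indices-represent : Indices T ts → Represents T ts
  indices-represent = Pointwise.map (proj₁ ∘ proj₂)

  indices-positive : Indices T ts → All (1 ≤_) ts
  indices-positive [] = []
  indices-positive ((1≤t , _) ∷ is) = 1≤t ∷ indices-positive is

  -- Idempotence of x s compares x s with (x + x) s, a case of `equal-multiples` with difference
  -- `x`.
  idempotent⇒ : ∀ {x y} → 1 ≤ x → y ≈ x · s → y ∙ y ≈ y → k ≤ x × n ∣ x
  idempotent⇒ {x} 1≤x e idem = equal-multiples x 1≤x 1≤x
    (≈.trans (≈.sym e) (≈.trans (≈.sym idem) (≈.trans (≈.∙-cong e e) (≈.sym (·-+ 1≤x 1≤x)))))

  ⇒idempotent : ∀ {x y} → 1 ≤ x → y ≈ x · s → k ≤ x → n ∣ x → y ∙ y ≈ y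
  ⇒idempotent 1≤x e k≤x (divides q refl) = ≈.trans (≈.∙-cong e e)
    (≈.trans (≈.sym (·-+ 1≤x 1≤x)) (≈.trans (add-periods q k≤x) (≈.sym e)))

  -- K stands for the least positive multiple of n that is at least k.
  module Threshold (K : ℕ) (1≤K : 1 ≤ K) (k≤⇒K≤ : ∀ {x} → 1 ≤ x → n ∣ x → k ≤ x → K ≤ x)
                   (K≤⇒k≤ : ∀ {x} → 1 ≤ x → n ∣ x → K ≤ x → k ≤ x) where

    free⇒sumFree : Indices T ts → IdempotentSumFree T → SumFree K n ts
    free⇒sumFree is free {x = x} p n∣x with sum-sublist (indices-represent is) (indices-positive is) p
    ... | v ∷ vs , sub , _ , some 1≤x e = ≰⇒> λ K≤x → free (v ∷ vs) sub (⇒idempotent 1≤x e (K≤⇒k≤ 1≤x n∣x K≤x) n∣x)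

    sumFree⇒free : Indices T ts → SumFree K n ts → IdempotentSumFree T
    sumFree⇒free is free (u ∷ us) sub idem with sublist-sum (indices-represent is) (indices-positive is) sub
    ... | x , p , some 1≤x e with k≤x , n∣x ← idempotent⇒ 1≤x e idem = <⇒≱ (free p n∣x) (k≤⇒K≤ 1≤x n∣x k≤x)

    private
      length≡ : Indices T ts → length T ≡ length ts
      length≡ = Pointwise.Pointwise-length

      full : ∀ {x} → SumOf ts (length ts) x → x ≡ sum ts
      full {ts} {x} p with complement p
      ... | complement-of {zero} q _ f with refl ← zeroTerms q = ≡.trans (sym (+-identityʳ x)) f
      ... | complement-of {suc d} q e _ = contradiction (sym e) (<⇒≢ (m<m+n (length ts) z<s))

    minimal-idempotent⇒minimal : Indices T ts → MinimalIdempotentSum T → Minimal K n ts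
    minimal-idempotent⇒minimal {ts = ts} is ((v ∷ vs , refl , idem) , proper)
      with sublist-sum (indices-represent is) (indices-positive is) (⊆-refl {x = v ∷ vs})
    ... | x , p , some 1≤x e
      with refl ← full (subst (λ l → SumOf ts l x) (length≡ is) p)
      with k≤x , n∣x ← idempotent⇒ 1≤x e idem =
      n∣x , k≤⇒K≤ 1≤x n∣x k≤x , λ q c< n∣y → ≰⇒> λ K≤y → case sum-sublist (indices-represent is) (indices-positive is) q of λ where
        (w ∷ ws , sub , l , some 1≤y f) → proper (w ∷ ws) sub
          (≤-trans (s≤s (≤-reflexive l)) (≤-trans c< (≤-reflexive (sym (length≡ is)))))
          (⇒idempotent 1≤y f (K≤⇒k≤ 1≤y n∣y K≤y) n∣y)

    minimal⇒minimal-idempotent : Indices T ts → Minimal K n ts → MinimalIdempotentSum T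
    minimal⇒minimal-idempotent [] (_ , K≤0 , _) = contradiction (≤-trans 1≤K K≤0) λ ()
    minimal⇒minimal-idempotent {T@(v ∷ vs)} {ts} is (n∣ , K≤ , proper)
      with sublist-sum (indices-represent is) (indices-positive is) (⊆-refl {x = T})
    ... | x , p , some 1≤x e with refl ← full (subst (λ l → SumOf ts l x) (length≡ is) p) =
      (v ∷ vs , refl , ⇒idempotent 1≤x e (K≤⇒k≤ 1≤x n∣ K≤) n∣) , λ where
        (u ∷ us) sub l< idem → case sublist-sum (indices-represent is) (indices-positive is) sub of λ where
          (y , q , some 1≤y f) → let k≤y , n∣y = idempotent⇒ 1≤y f idem in
            <⇒≱ (proper q (≤-trans l< (≤-reflexive (length≡ is))) n∣y) (k≤⇒K≤ 1≤y n∣y k≤y)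

  satisfied : (Q : List ℤ → Set) → Indices T ts → IndicesSatisfy Q T → Q (map +_ ts)
  satisfied Q is (us , js , q) = subst (λ ts → Q (map +_ ts)) (indices-unique js is) q

  -- Every sequence in the semigroup has a list of indices up to `maxInd`, and every such list is
  -- the index list of the corresponding multiples of `s`. Only positive lengths are compared, which
  -- supplies the nonemptiness that smoothness demands and `Complete` does not.
  transfer : ∀ {p q r q′} {P : List Carrier → Set p} {Q : List Carrier → Set q} {P′ : List ℕ → Set r} {Q′ : List ℕ → Set q′} →
             (∀ {T ts} → Indices T ts → P T → P′ ts) → (∀ {T ts} → Indices T ts → P′ ts → P T) →
             (∀ {T ts} → Indices T ts → 1 ≤ length ts → Q T → Q′ ts) → (∀ {T ts} → Indices T ts → 1 ≤ length ts → Q′ ts → Q T) →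
             ∀ {m} → LeastPositive (λ l → ∀ ts → Bounded maxInd ts → P′ ts → l ≤ length ts → Q′ ts) m →
             LeastPositive (λ l → ∀ T → P T → l ≤ length T → Q T) m
  transfer P⇒ P⇐ Q⇒ Q⇐ (1≤m , p , least) =
    1≤m ,
    (λ T pT m≤ → let ts , is , bd = indices T ; m≤′ = ≤-trans m≤ (≤-reflexive (Pointwise.Pointwise-length is)) in
      Q⇐ is (≤-trans 1≤m m≤′) (p ts bd (P⇒ is pT) m≤′)) ,
    λ j 1≤j pj → least j 1≤j λ ts bd pts j≤ → let is = indices-of-multiples bd in
      Q⇒ is (≤-trans 1≤j j≤) (pj _ (P⇐ is pts) (≤-trans j≤ (≤-reflexive (sym (Pointwise.Pointwise-length is)))))

  ceiling : ℕ
  ceiling = ⌈ k / n ⌉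

  k≤ceiling*n : k ≤ ceiling * n
  k≤ceiling*n = +-cancelʳ-≤ (pred n) k (ceiling * n) (≤-trans (≤-reflexive (m≡m%n+[m/n]*n (k + pred n) n))
    (≤-trans (+-monoˡ-≤ (ceiling * n) (s≤s⁻¹ (≤-trans (m%n<n (k + pred n) n) (≤-reflexive (sym (suc-pred n))))))
      (≤-reflexive (+-comm (pred n) (ceiling * n)))))

  ceiling*n≤ : ∀ {x} → n ∣ x → k ≤ x → ceiling * n ≤ x
  ceiling*n≤ (divides q refl) k≤ = *-monoˡ-≤ n (s≤s⁻¹ (*-cancelʳ-< n ceiling (suc q)
    (≤-<-trans (m/n*n≤m (k + pred n) n) (≤-trans (s≤s (+-monoˡ-≤ (pred n) k≤))
      (≤-reflexive (≡.trans (sym (+-suc (q * n) (pred n))) (≡.trans (cong (λ i → q * n + i) (suc-pred n)) (+-comm (q * n) n))))))))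

  module _ (n<k : n < k) where

    private
      module Above = Threshold (ceiling * n) (≤-trans 1≤k k≤ceiling*n)
        (λ _ n∣x k≤x → ceiling*n≤ n∣x k≤x) (λ _ _ K≤x → ≤-trans k≤ceiling*n K≤x)

      2≤ceiling : 2 ≤ ceiling
      2≤ceiling = *-cancelʳ-< n 1 ceiling (≤-trans (s≤s (≤-reflexive (+-identityʳ n))) (≤-trans n<k k≤ceiling*n))

      n+k≤ : ∀ {i j} → i ≤ n → j ≤ k → i + j ≤ suc maxInd
      n+k≤ i≤ j≤ = ≤-trans (+-mono-≤ i≤ j≤) (≤-reflexive (≡.trans (+-comm n k) (sym suc-maxInd)))

      2≤k : 2 ≤ k
      2≤k = ≤-trans (s≤s 1≤n) n<k

      to : ∀ {T ts} → Indices T ts → 1 ≤ length ts → Complete ts →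
           ∀ {x} {X : Set x} → (n < k → IndicesSmooth₁ T) × (k ≤ n → X)
      to is 1≤l comp = (λ _ → _ , is , IntegerSmooth.complete⇒smooth (indices-positive is) 1≤l comp) , λ k≤n → contradiction n<k (≤⇒≯ k≤n)

      from : ∀ {T ts} → Indices T ts → (n < k → IndicesSmooth₁ T) → Complete ts
      from is f = IntegerSmooth.smooth⇒complete (satisfied (Smooth ℤ.+-0-abelianGroup 1ℤ) is (f n<k))

    long-index : ∃[ Smo ] ∃[ Ŝmo ] IsSmo Smo × IsŜmo Ŝmo × LongIndex n (ceiling * n) ((ceiling + 1) * n) Smo Ŝmo
    long-index with long-index-invariants ceiling n maxInd 2≤ceiling (s≤s⁻¹ (n+k≤ 1≤n 2≤k)) (λ 2≤n → s≤s⁻¹ (n+k≤ {1} {3} 1≤n (≤-trans (s≤s 2≤n) n<k)))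
    ... | Smo , Ŝmo , minimal , free , values =
      Smo , Ŝmo ,
      ((λ k≡1 → contradiction (≤-trans 2≤k (≤-reflexive k≡1)) 1+n≰n) , λ _ → transfer
        Above.minimal-idempotent⇒minimal Above.minimal⇒minimal-idempotent
        (λ is _ q → from is (proj₁ q)) (λ is 1≤l comp → to is 1≤l comp) minimal) ,
      ((λ k≡1 → contradiction (≤-trans 2≤k (≤-reflexive k≡1)) 1+n≰n) , λ _ → transfer
        Above.free⇒sumFree Above.sumFree⇒free
        (λ is _ q → from is (proj₁ q)) (λ is 1≤l comp → to is 1≤l comp) free) ,
      values

  module _ (k≤n : k ≤ n) where

    private
      module Below = Threshold n 1≤n
        (λ 1≤x n∣x _ → ∣⇒≤ {{>-nonZero 1≤x}} n∣x) (λ _ _ n≤x → ≤-trans k≤n n≤x)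

      SmoothResidues ZeroSumSmoothResidues : List ℤ → Set
      SmoothResidues T = ∃[ g ] _≡ord_ (ℤ/ n ℤ) n g × Smooth (ℤ/ n ℤ) g T
      ZeroSumSmoothResidues T = ∃[ g ] _≡ord_ (ℤ/ n ℤ) n g × ZeroSumSmooth (ℤ/ n ℤ) g T

      n≤maxInd : n ≤ maxInd
      n≤maxInd = s≤s⁻¹ (≤-trans (+-monoˡ-≤ n 1≤k) (≤-reflexive (sym suc-maxInd)))

    short-index : 2 ≤ n → ∃[ Smo ] ∃[ Ŝmo ] IsSmo Smo × IsŜmo Ŝmo × ShortIndexValues n Smo Ŝmo
    short-index 2≤n with short-index-invariants n 2≤n n≤maxInd
    ... | Smo , Ŝmo , (minimal , free) , values =
      Smo , Ŝmo ,
      ((λ _ n≡1 → contradiction (≤-trans 2≤n (≤-reflexive n≡1)) 1+n≰n) , λ _ → transfer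
        Below.minimal-idempotent⇒minimal Below.minimal⇒minimal-idempotent
        (λ is _ (_ , f) → ResidueSmooth.smooth⇒minimal-form n (satisfied ZeroSumSmoothResidues is (f k≤n)))
        (λ is 1≤l form → (λ n<k → contradiction n<k (≤⇒≯ k≤n)) , λ _ → _ , is , ResidueSmooth.minimal-form⇒smooth n 1≤l form) minimal) ,
      ((λ _ n≡1 → contradiction (≤-trans 2≤n (≤-reflexive n≡1)) 1+n≰n) , λ _ → transfer
        Below.free⇒sumFree Below.sumFree⇒free
        (λ is _ (_ , f) → ResidueSmooth.smooth⇒free-form n (satisfied SmoothResidues is (f k≤n)))
        (λ is 1≤l form → (λ n<k → contradiction n<k (≤⇒≯ k≤n)) , λ _ → _ , is , ResidueSmooth.free-form⇒smooth n 1≤l form) free) ,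
      values

    -- The values of the trivial semigroup are conventions, and the least-length clauses are vacuous
    -- because max(k, n) = 1.
    trivial : n ≡ 1 → IsSmo 1 × IsŜmo 0 × ShortIndexValues n 1 0
    trivial refl with refl ← ≤-antisym k≤n 1≤k =
      ((λ _ _ → refl) , λ { (s≤s ()) }) , ((λ _ _ → refl) , λ { (s≤s ()) }) ,
      (λ ()) , λ _ → refl , (λ _ → refl) , λ { (inj₁ ()) ; (inj₂ (s≤s ())) }

theorem4p4 : ∀ {c ℓ} (S : CommutativeSemigroup c ℓ) (s : CommutativeSemigroup.Carrier S)
    (k n : ℕ) .{{_ : NonZero k}} .{{_ : NonZero n}} → IsCyclic S s k n →
    let open Invariants S s k n
        K = ⌈ k / n ⌉ * n
        L = (⌈ k / n ⌉ + 1) * n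
    in
    ∃[ Smo ] ∃[ Ŝmo ] IsSmo Smo × IsŜmo Ŝmo ×
    (k ≤ n →
      (n ≡ 5 → Smo ≡ 3 × Ŝmo ≡ 1) ×
      (n ≢ 5 →
        Smo ∸ 1 ≡ Ŝmo ×
        (n ≤ 4 ⊎ n ≡ 7 → Ŝmo ≡ ⌊ n /2⌋) ×
        (n ≡ 6 ⊎ 8 ≤ n → Ŝmo ≡ ⌊ n /2⌋ + 1))) ×
    (n < k →
      Smo ≤ Ŝmo + 1 ×
      (3 ≤ n × K % 2 ≡ 0 → ⌊ K /2⌋ + 1 ≤ Ŝmo × Ŝmo ≤ ⌈ L /2⌉ ∸ 1) ×
      (¬ (3 ≤ n × K % 2 ≡ 0) → Ŝmo ≡ ⌊ L /2⌋) ×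
      (3 ≤ n × K % 2 ≡ 0 → ⌊ K /2⌋ + 1 ≤ Smo × Smo ≤ ⌈ L /2⌉) ×
      (n ≡ 2 → Smo ≡ ⌊ L /2⌋) ×
      (¬ (3 ≤ n × K % 2 ≡ 0) → n ≢ 2 → Smo ≡ ⌊ L /2⌋ + 1))
theorem4p4 S s k n cyclic with k ≤? n | n ≟ 1
... | yes k≤n | yes n≡1 =
  let Smo , Ŝmo , values = CyclicSemigroup.trivial S s k n cyclic k≤n n≡1
  in 1 , 0 , Smo , Ŝmo , (λ _ → values) , λ n<k → contradiction n<k (≤⇒≯ k≤n)
... | yes k≤n | no n≢1 =
  let Smo , Ŝmo , isSmo , isŜmo , values = CyclicSemigroup.short-index S s k n cyclic k≤n
        (≤∧≢⇒< (>-nonZero⁻¹ n) (n≢1 ∘ sym))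
  in Smo , Ŝmo , isSmo , isŜmo , (λ _ → values) , λ n<k → contradiction n<k (≤⇒≯ k≤n)
... | no k≰n | _ =
  let Smo , Ŝmo , isSmo , isŜmo , values = CyclicSemigroup.long-index S s k n cyclic (≰⇒> k≰n)
  in Smo , Ŝmo , isSmo , isŜmo , (λ k≤n → contradiction k≤n k≰n) , λ _ → values
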